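{- Let $q$ be an odd prime power. In $\mathrm{PG}(3,q^2)$, let $\mathcal H$ be a non-degenerate Hermitian surface and $\mathcal Q$ an irreducible quadric such that there is a point $P\in\mathcal H\cap\mathcal Q$ which is a nonsingular point of $\mathcal Q$ and at which $\mathcal H$ and $\mathcal Q$ have the same tangent plane. Suppose $|\mathcal H\cap\mathcal Q|=2q^3+q^2+1$. Then $\mathcal Q$ is a hyperbolic quadric in permutable position with $\mathcal H$. In particular, there is a quadric $\mathcal Q'\subseteq\mathcal H\cap\mathcal Q$, contained in a subgeometry $\mathrm{PG}(3,q)$, such that all points of $\mathcal H\cap\mathcal Q$ lie on (extended) generators of $\mathcal Q'$.
   Context: $\mathcal Q$ and $\mathcal H$ are in permutable position if the polarities of $\mathrm{PG}(3,q^2)$ induced by $\mathcal Q$ and by $\mathcal H$ commute. A subgeometry $\mathrm{PG}(3,q)$ of $\mathrm{PG}(3,q^2)$ is a Baer subgeometry. A generator of a quadric is a line contained in it; an extended generator of $\mathcal Q'\subseteq\mathrm{PG}(3,q)$ is the line of $\mathrm{PG}(3,q^2)$ containing a generator of $\mathcal Q'$. -}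

module Defs where

open import Level using (0ℓ)
open import Data.Nat as ℕ using (ℕ; zero; suc; _≥_)
open import Data.Nat.Primality using (Prime)
open import Data.Fin using (Fin; zero; suc)
open import Data.List using (List; map; concatMap; filter; length)
open import Data.Product using (Σ; _×_; _,_)
open import Relation.Binary.PropositionalEquality using (_≡_; _≢_)
open import Relation.Binary.Definitions using (DecidableEquality)
open import Relation.Nullary using (¬_; Dec; yes; no)
open import Relation.Nullary.Decidable using (_×-dec_; ¬?)
open import Function.Bundles using (_↔_; Inverse; _⇔_)
open import Algebra.Core using (Op₁; Op₂)
open import Algebra.Structures using (IsCommutativeRing)

OddPrimePower : ℕ → Set
OddPrimePower q = Σ ℕ λ p → Σ ℕ λ k → Prime p × (p ≢ 2) × (k ≥ 1) × (q ≡ p ℕ.^ k)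

record FiniteField (n : ℕ) : Set₁ where
  infixl 6 _+_
  infixl 7 _*_
  field
    Carrier : Set
    _+_ _*_ : Op₂ Carrier
    -_ : Op₁ Carrier
    0# 1# : Carrier
    isCommutativeRing : IsCommutativeRing _≡_ _+_ _*_ -_ 0# 1#
    0≢1 : 0# ≢ 1#
    inverse : ∀ x → x ≢ 0# → Σ Carrier λ y → x * y ≡ 1#
    _≟_ : DecidableEquality Carrier
    enum : Carrier ↔ Fin n

-- Geometry of PG(3, F) where F = GF(q²); points are represented by nonzero
-- vectors of F⁴, taken up to nonzero scalars.
module Geometry {n : ℕ} (F : FiniteField n) (q : ℕ) where
  open FiniteField F public

  pow : Carrier → ℕ → Carrier
  pow x zero = 1#
  pow x (suc k) = x * pow x k

  conj : Carrier → Carrier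
  conj x = pow x q

  InSubfield : Carrier → Set
  InSubfield a = conj a ≡ a

  Vec4 : Set
  Vec4 = Fin 4 → Carrier

  Matrix : Set
  Matrix = Fin 4 → Fin 4 → Carrier

  f0 f1 f2 f3 : Fin 4
  f0 = zero
  f1 = suc zero
  f2 = suc (suc zero)
  f3 = suc (suc (suc zero))

  sum4 : (Fin 4 → Carrier) → Carrier
  sum4 f = f f0 + f f1 + f f2 + f f3

  IsZero : Vec4 → Set
  IsZero v = ∀ i → v i ≡ 0#

  -- y = c x for some nonzero scalar c (same projective point when x ≠ 0)
  Proportional : Vec4 → Vec4 → Set
  Proportional x y = Σ Carrier λ c → (c ≢ 0#) × (∀ i → y i ≡ c * x i)

  lc : Carrier → Vec4 → Carrier → Vec4 → Vec4
  lc a u b v i = a * u i + b * v i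

  mv : Matrix → Vec4 → Vec4
  mv M x i = sum4 λ j → M i j * x j

  herm : Matrix → Vec4 → Vec4 → Carrier
  herm A x y = sum4 λ i → sum4 λ j → x i * A i j * conj (y j)

  Hform : Matrix → Vec4 → Carrier
  Hform A x = herm A x x

  IsHermitianMatrix : Matrix → Set
  IsHermitianMatrix A = ∀ i j → A j i ≡ conj (A i j)

  NonDegH : Matrix → Set
  NonDegH A = ∀ x → (∀ y → herm A y x ≡ 0#) → IsZero x

  -- Symmetric bilinear form  b_S(x, y) = Σ x_i S_ij y_j  and quadratic form Q(x) = b_S(x, x)
  -- (q odd, so every quadratic form has such a symmetric matrix).
  bil : Matrix → Vec4 → Vec4 → Carrier
  bil S x y = sum4 λ i → sum4 λ j → x i * S i j * y j

  Qform : Matrix → Vec4 → Carrier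
  Qform S x = bil S x x

  IsSymmetricMatrix : Matrix → Set
  IsSymmetricMatrix S = ∀ i j → S i j ≡ S j i

  NonZeroMatrix : Matrix → Set
  NonZeroMatrix S = Σ (Fin 4) λ i → Σ (Fin 4) λ j → S i j ≢ 0#

  -- the quadric given by symmetric S is reducible over F if its quadratic form is a
  -- product (l·x)(m·x) of two linear forms, i.e. coefficientwise 2 S_ij = l_i m_j + l_j m_i
  Reducible : Matrix → Set
  Reducible S = Σ Vec4 λ l → Σ Vec4 λ m → ∀ i j → S i j + S i j ≡ l i * m j + l j * m i

  Irreducible : Matrix → Set
  Irreducible S = ¬ Reducible S

  -- P is a nonsingular point of the quadric: the gradient (2 S P) does not vanish
  NonsingularQ : Matrix → Vec4 → Set
  NonsingularQ S P = ¬ IsZero (mv S P)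

  SamePlane : (Vec4 → Carrier) → (Vec4 → Carrier) → Set
  SamePlane f g = ∀ y → (f y ≡ 0#) ⇔ (g y ≡ 0#)

  polarQ : Matrix → Vec4 → (Vec4 → Carrier)
  polarQ S p y = bil S y p

  polarH : Matrix → Vec4 → (Vec4 → Carrier)
  polarH A p y = herm A y p

  NonDegQ : Matrix → Set
  NonDegQ S = ∀ x → (∀ y → bil S y x ≡ 0#) → IsZero x

  LinIndep : Vec4 → Vec4 → Set
  LinIndep u v = ∀ a b → IsZero (lc a u b v) → (a ≡ 0#) × (b ≡ 0#)

  Hyperbolic : Matrix → Set
  Hyperbolic S = NonDegQ S × (Σ Vec4 λ u → Σ Vec4 λ v → LinIndep u v ×
                              (∀ a b → Qform S (lc a u b v) ≡ 0#))

  -- permutable position: ⊥_Q ∘ ⊥_H = ⊥_H ∘ ⊥_Q on points.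
  -- z = ⊥_Q(⊥_H(x)) and w = ⊥_H(⊥_Q(x)) must be the same point.
  Permutable : Matrix → Matrix → Set
  Permutable S A = ∀ x z w → ¬ IsZero x → ¬ IsZero z → ¬ IsZero w →
                   SamePlane (polarQ S z) (polarH A x) →
                   SamePlane (polarH A w) (polarQ S x) →
                   Proportional z w

  elems : List Carrier
  elems = map (Inverse.from enum) (Data.List.allFin n)
    where import Data.List

  vec4 : Carrier → Carrier → Carrier → Carrier → Vec4
  vec4 a b c d zero = a
  vec4 a b c d (suc zero) = b
  vec4 a b c d (suc (suc zero)) = c
  vec4 a b c d (suc (suc (suc zero))) = d

  allVecs : List Vec4
  allVecs = concatMap (λ a → concatMap (λ b → concatMap (λ c →
              map (vec4 a b c) elems) elems) elems) elems

  isZero? : ∀ v → Dec (IsZero v)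
  isZero? v with v f0 ≟ 0# | v f1 ≟ 0# | v f2 ≟ 0# | v f3 ≟ 0#
  ... | yes p0 | yes p1 | yes p2 | yes p3 = yes λ where
        zero → p0
        (suc zero) → p1
        (suc (suc zero)) → p2
        (suc (suc (suc zero))) → p3
  ... | no ¬p | _ | _ | _ = no λ z → ¬p (z f0)
  ... | yes _ | no ¬p | _ | _ = no λ z → ¬p (z f1)
  ... | yes _ | yes _ | no ¬p | _ = no λ z → ¬p (z f2)
  ... | yes _ | yes _ | yes _ | no ¬p = no λ z → ¬p (z f3)

  -- number of nonzero vectors of F⁴ lying on both H and Q;
  -- the number of points |H ∩ Q| equals this divided by (q² − 1)
  countHQVectors : Matrix → Matrix → ℕ
  countHQVectors A S = length (filter (λ v → ¬? (isZero? v) ×-dec (Hform A v ≟ 0#) ×-dec (Qform S v ≟ 0#)) allVecs)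

  -- Conclusion "in particular": there is a Baer subgeometry PG(3,q) = { [M x] : x ∈ GF(q)⁴ }
  -- (M invertible) and a quadric Q' of it (nonzero symmetric T over GF(q)) with Q' ⊆ H ∩ Q,
  -- such that every point of H ∩ Q lies on an extended generator of Q'.
  SubVec : Vec4 → Set
  SubVec x = ∀ i → InSubfield (x i)

  Invertible : Matrix → Set
  Invertible M = ∀ x → IsZero (mv M x) → IsZero x

  Generator : Matrix → Vec4 → Vec4 → Set
  Generator T u v = SubVec u × SubVec v ×
                    (∀ a b → InSubfield a → InSubfield b → IsZero (lc a u b v) → (a ≡ 0#) × (b ≡ 0#)) ×
                    (∀ a b → InSubfield a → InSubfield b → Qform T (lc a u b v) ≡ 0#)

  BaerConclusion : Matrix → Matrix → Set
  BaerConclusion A S =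
    Σ Matrix λ M → Σ Matrix λ T →
      Invertible M ×
      (∀ i j → InSubfield (T i j)) × IsSymmetricMatrix T × NonZeroMatrix T ×
      (∀ x → SubVec x → ¬ IsZero x → Qform T x ≡ 0# →
         (Hform A (mv M x) ≡ 0#) × (Qform S (mv M x) ≡ 0#)) ×
      (∀ X → ¬ IsZero X → Hform A X ≡ 0# → Qform S X ≡ 0# →
         Σ Vec4 λ u → Σ Vec4 λ v → Generator T u v ×
           (Σ Carrier λ a → Σ Carrier λ b → Proportional X (mv M (lc a u b v))))

{-# OPTIONS --safe #-}
module Submission where

-- Scale Q so that its polar form B agrees with the Hermitian form h on P, and let G = 2h(v,v) − Tr B(v,v),
-- a quadratic form over GF(q) whose radical consists of the vectors on which the two polarities agree.
-- At most 2q² + 1 points of H ∩ Q lie in the common tangent plane, so at least 2q³ − q² lie off it; after the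
-- normalisation h(v,P) = 1 these are the zeros of an affine quadric in AG(4,q) with quadratic part G.
-- If all of them are singular there are at most q³.  Otherwise take a nonsingular one, R.  Every line through
-- R not tangent to the affine quadric contains at most one further zero, which accounts for at most q³ points,
-- and the tangent hyperplane at R contains at most 2q² − 1 zeros unless G vanishes on all its directions.
-- Since q³ + 2q² − 1 < 2q³ − q² for q ≥ 3, G does vanish there, and this determines both forms: in a suitable
-- basis h and B have the same Gram matrix, that of 2(x₀x₂ − x₁x₃).  The GF(q)-span of that basis is the Baer
-- subgeometry, the two polarities compose in either order to x ↦ x̄, and on a point (ac, bc, bd, ad) of Q
-- the Hermitian form is (a b̄ − ā b)(c d̄ − c̄ d), so that one of the two ratios is in GF(q).

open import Defs
open import Level using (0ℓ)
open import Algebra.Bundles using (CommutativeRing)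
import Algebra.Properties.AbelianGroup
import Algebra.Properties.CommutativeMonoid.Sum
import Algebra.Properties.CommutativeSemiring.Binomial
import Algebra.Properties.CommutativeSemiring.Exp
import Algebra.Properties.Ring
import Algebra.Properties.Semiring.Exp
import Algebra.Properties.Semiring.Mult
import Algebra.Solver.Ring
open import Algebra.Solver.Ring.AlmostCommutativeRing using (fromCommutativeRing; _-Raw-AlmostCommutative⟶_)
open import Data.Bool using (Bool)
open import Data.Empty using (⊥; ⊥-elim)
open import Data.Fin as Fin using (Fin; zero; suc)
import Data.Fin.Properties as Finₚ
open import Data.Integer as ℤ using (ℤ; -[1+_]; _⊖_) renaming (+_ to pos)
import Data.Integer.Properties as ℤₚ
open import Data.List using (List; length; filter; lookup; concatMap)
open import Data.List.Membership.Propositional using (_∈_)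
open import Data.List.Membership.Propositional.Properties using (∈-filter⁺; ∈-map⁺; ∈-allFin; ∈-lookup)
open import Data.List.Relation.Unary.All as All using (All)
import Data.List.Relation.Unary.All.Properties as Allₚ
open import Data.List.Relation.Unary.AllPairs as AllPairs using (AllPairs; _∷_)
import Data.List.Relation.Unary.AllPairs.Properties as AllPairsₚ
import Data.List.Relation.Unary.Any as Any
import Data.List.Relation.Unary.Any.Properties as Anyₚ
import Data.List.Relation.Unary.Unique.Propositional.Properties as Uniqueₚ
open import Data.Maybe using (Maybe; just; nothing)
open import Data.Nat as ℕ using (ℕ; zero; suc; _!)
import Data.Nat as N
open import Data.Nat.Combinatorics using (_C_; nCn≡1; nCk≡nC[n∸k]; k![n∸k]!∣n!)
open import Data.Nat.Combinatorics.Specification using (nCk≡n!/k![n-k]!)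
open import Data.Nat.DivMod using (m/n*n≡m)
open import Data.Nat.Divisibility as Div using (_∣_; divides)
open import Data.Nat.Primality using (Prime; euclidsLemma; prime⇒nonZero; prime⇒nonTrivial; prime⇒irreducible)
import Data.Nat.Properties as ℕₚ
open import Data.Nat.Solver using (module +-*-Solver)
open import Data.Product using (Σ; ∃; _×_; _,_; proj₁; proj₂)
open import Data.Product.Function.NonDependent.Propositional using (_×-↔_)
open import Data.Sum using (_⊎_; inj₁; inj₂)
open import Data.Sum.Function.Propositional using (_⊎-↔_)
open import Data.Unit using (⊤; tt)
open import Data.Vec as Vec using (Vec; []; _∷_)
open import Data.Vec.Functional using (removeAt)
open import Function using (_∘_)
open import Function.Bundles using (_↔_; Inverse; Injection; mk↔ₛ′; Equivalence; mk⇔)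
open import Function.Construct.Composition using (_↔-∘_)
open import Function.Construct.Identity using (↔-id)
open import Function.Construct.Symmetry using (↔-sym)
open import Function.Properties.Inverse using (↔⇒↣)
open import Relation.Binary.Definitions using (tri<; tri≈; tri>)
open import Relation.Binary.PropositionalEquality using (_≡_; _≢_; refl; sym; trans; cong; cong₂; subst; subst₂; module ≡-Reasoning)
open import Relation.Nullary using (¬_; Dec; yes; no; contradiction; does; _×-dec_)
open import Relation.Nullary.Decidable using (¬?; decidable-stable)
open import Relation.Unary using (Decidable)

-- Finite cardinalities

-- No dimension theory is used. The main estimates are injections, or at most two-to-one maps, into
-- the q⁸ vectors of F⁴: a set lying in a GF(q)-subspace is thickened by translates along a
-- complement, so that codimension becomes a factor of the domain. Vectors are counted instead of
-- points, so every count carries the factor q² - 1, written `m`; off the tangent plane the lost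
-- scalar survives as a tag in `Fin m`. The affine quadric arises as follows. A vector x with h(x,P)
-- = 1 is R + w + λP with w in W, the h-orthogonal space of P and R. Q(x) = 0 fixes λ, and H(x) = 0
-- then reads G(w) = 2 Tr h(w,c), where c represents the difference of the polar functionals B(·,R)
-- and h(·,R). W has q⁴ elements, whence AG(4,q). That G determines both forms comes from G being
-- quadratic over GF(q) only: its values at w and at multiples of w by scalars outside GF(q)
-- separate h from B.

Injective : {X Y : Set} → (X → Y) → Set
Injective f = ∀ {x y} → f x ≡ f y → x ≡ y

to-injective : {X : Set} {n : ℕ} (α : X ↔ Fin n) → Injective (Inverse.to α)
to-injective α = Injection.injective (↔⇒↣ α)

from-injective : {X : Set} {n : ℕ} (α : X ↔ Fin n) → Injective (Inverse.from α)
from-injective α = Injection.injective (↔⇒↣ (↔-sym α))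

injection⇒≤ : {X Y : Set} {m n : ℕ} → X ↔ Fin m → Y ↔ Fin n →
              (f : X → Y) → Injective f → m ℕ.≤ n
injection⇒≤ α β f inj = Finₚ.injective⇒≤ {f = Inverse.to β ∘ f ∘ Inverse.from α}
  (λ eq → from-injective α (inj (to-injective β eq)))

infixr 5 _⊗_
_⊗_ : {X Y : Set} {m n : ℕ} → X ↔ Fin m → Y ↔ Fin n → (X × Y) ↔ Fin (m ℕ.* n)
α ⊗ β = ↔-sym Finₚ.*↔× ↔-∘ (α ×-↔ β)

infixr 4 _⊞_
_⊞_ : {X Y : Set} {m n : ℕ} → X ↔ Fin m → Y ↔ Fin n → (X ⊎ Y) ↔ Fin (m ℕ.+ n)
α ⊞ β = ↔-sym Finₚ.+↔⊎ ↔-∘ (α ⊎-↔ β)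

fin : ∀ {n} → Fin n ↔ Fin n
fin = ↔-id _

⊤↔Fin1 : ⊤ ↔ Fin 1
⊤↔Fin1 = mk↔ₛ′ (λ _ → zero) (λ _ → tt) (λ { zero → refl }) (λ _ → refl)

Bool↔Fin2 : Bool ↔ Fin 2
Bool↔Fin2 = ↔-sym Finₚ.2↔Bool

injective⇒surjective : ∀ {n} (f : Fin n → Fin n) → Injective f → ∀ y → ∃ λ x → f x ≡ y
injective⇒surjective {suc n} f inj y with Finₚ.any? (λ x → f x Finₚ.≟ y)
... | yes p = p
... | no ¬p = contradiction (Finₚ.injective⇒≤ {f = g} g-inj) (ℕₚ.<⇒≱ (ℕₚ.n<1+n n))
  where
  avoid : ∀ x → y ≢ f x
  avoid x eq = ¬p (x , sym eq)
  g : Fin (suc n) → Fin n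
  g x = Fin.punchOut (avoid x)
  g-inj : Injective g
  g-inj {a} {b} eq = inj (Finₚ.punchOut-injective (avoid a) (avoid b) eq)

AtMostTwo : {X Y : Set} → (X → Y) → Set
AtMostTwo f = ∀ {x y z} → f x ≡ f y → f x ≡ f z → x ≢ y → x ≢ z → y ≡ z

-- Each point x of a fibre is tagged by whether the fibre contains an earlier point;
-- this makes an at most two-to-one map injective into two copies of its target.
module _ {m : ℕ} {Y : Set} (_≟_ : (x y : Y) → Dec (x ≡ y)) (f : Fin m → Y) where

  private
    Earlier : Fin m → Set
    Earlier x = ∃ λ y → (y Fin.< x) × (f y ≡ f x)

    earlier? : Decidable Earlier
    earlier? x = Finₚ.any? λ y → (y Finₚ.<? x) ×-dec (f y ≟ f x)

  tag : Fin m → Bool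
  tag x = does (earlier? x)

  tag-separates : AtMostTwo f → ∀ {x y} → f x ≡ f y → tag x ≡ tag y → x ≡ y
  private
    absurd-< : AtMostTwo f → ∀ {x y} → f x ≡ f y → tag x ≡ tag y → x Fin.< y → ⊥
    absurd-< two {x} {y} fe te x<y with earlier? x | earlier? y
    ... | _ | no ¬e = ¬e (x , x<y , fe)
    absurd-< two {x} {y} fe () x<y | no _ | yes _
    ... | yes (z , z<x , fz) | yes _ =
      Finₚ.<⇒≢ (Finₚ.<-trans z<x x<y)
        (sym (two fe (sym fz) (Finₚ.<⇒≢ x<y) (λ x≡z → Finₚ.<⇒≢ z<x (sym x≡z))))

  tag-separates two {x} {y} fe te with Finₚ.<-cmp x y
  ... | tri< x<y _ _ = ⊥-elim (absurd-< two fe te x<y)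
  ... | tri≈ _ eq _ = eq
  ... | tri> _ _ y<x = ⊥-elim (absurd-< two (sym fe) (sym te) y<x)

-- Everything is placed in two copies of `Y`. A point of `X` occupies one copy of its value, chosen
-- by the tag; a value of `g` is missed by `f` and occupies both, which is the summand `t * 2`.
two-to-one : {X T Y : Set} {x t y : ℕ} → X ↔ Fin x → T ↔ Fin t → Y ↔ Fin y →
             (f : X → Y) (g : T → Y) → AtMostTwo f → Injective g → (∀ a b → f a ≢ g b) →
             x ℕ.+ t ℕ.* 2 ℕ.≤ y ℕ.* 2
two-to-one {X} {T} {Y} α τ β f g two g-inj disj =
  injection⇒≤ (fin ⊞ (τ ⊗ Bool↔Fin2)) (β ⊗ Bool↔Fin2) k k-inj
  where
  a⁻ = Inverse.from α
  a⁻-inj : Injective a⁻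
  a⁻-inj = from-injective α
  _≟Y_ : (x y : Y) → Dec (x ≡ y)
  x ≟Y y with Inverse.to β x Finₚ.≟ Inverse.to β y
  ... | yes p = yes (to-injective β p)
  ... | no ¬p = no (¬p ∘ cong (Inverse.to β))
  f′ = f ∘ a⁻
  two′ : AtMostTwo f′
  two′ p q r s = a⁻-inj (two p q (r ∘ a⁻-inj) (s ∘ a⁻-inj))
  k : _ ⊎ (T × Bool) → Y × Bool
  k (inj₁ i) = f′ i , tag _≟Y_ f′ i
  k (inj₂ (t , b)) = g t , b
  k-inj : Injective k
  k-inj {inj₁ i} {inj₁ j} eq =
    cong inj₁ (tag-separates _≟Y_ f′ two′ (cong proj₁ eq) (cong proj₂ eq))
  k-inj {inj₁ i} {inj₂ (t , b)} eq = ⊥-elim (disj _ _ (cong proj₁ eq))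
  k-inj {inj₂ (t , b)} {inj₁ i} eq = ⊥-elim (disj _ _ (sym (cong proj₁ eq)))
  k-inj {inj₂ (t , b)} {inj₂ (u , c)} eq =
    cong inj₂ (cong₂ _,_ (g-inj (cong proj₁ eq)) (cong proj₂ eq))

-- A lower bound `a` for a cardinality, given by a listing without repetition. The relation is a
-- parameter because vectors are functions and are compared pointwise.
record Family {X : Set} (_≈_ : X → X → Set) (Pr : X → Set) (a : ℕ) : Set where
  field
    at : Fin a → X
    at-injective : ∀ {i j} → at i ≈ at j → i ≡ j
    satisfies : ∀ i → Pr (at i)

module _ {X : Set} {_≈_ : X → X → Set} (≈-sym : ∀ {x y} → x ≈ y → y ≈ x) where

  open Family

  family-cons : ∀ {Pr a} (x : X) → Pr x → (z : Family _≈_ Pr a) → (∀ i → ¬ (x ≈ at z i)) →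
                Family _≈_ Pr (suc a)
  family-cons x px z new .at zero = x
  family-cons x px z new .at (suc i) = at z i
  family-cons x px z new .at-injective {zero} {zero} eq = refl
  family-cons x px z new .at-injective {zero} {suc j} eq = ⊥-elim (new j eq)
  family-cons x px z new .at-injective {suc i} {zero} eq = ⊥-elim (new i (≈-sym eq))
  family-cons x px z new .at-injective {suc i} {suc j} eq = cong suc (at-injective z eq)
  family-cons x px z new .satisfies zero = px
  family-cons x px z new .satisfies (suc i) = satisfies z i

  private
    Sub : {X : Set} {a b : ℕ} → (Fin b → X) → (Fin a → X) → Set
    Sub y z = ∀ i → ∃ λ j → y i ≡ z j

    -- `Sub` strengthens the induction: the head of the list is distinct from the members of either
    -- part because those are again members of the original family.
    split′ : ∀ {Pr D : X → Set} → Decidable D → ∀ a (z : Family _≈_ Pr a) →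
      Σ ℕ λ b → Σ ℕ λ c → (a ≡ b ℕ.+ c) ×
      (Σ (Family _≈_ (λ x → Pr x × D x) b) λ y → Sub (at y) (at z)) ×
      (Σ (Family _≈_ (λ x → Pr x × ¬ D x) c) λ y → Sub (at y) (at z))
    split′ D? zero z = 0 , 0 , refl ,
      (record { at = λ () ; at-injective = λ {i} → λ { {()} } ; satisfies = λ () } , λ ()) ,
      (record { at = λ () ; at-injective = λ { {()} } ; satisfies = λ () } , λ ())
    split′ D? (suc a) z with split′ D? a (record
        { at = at z ∘ suc
        ; at-injective = λ eq → Finₚ.suc-injective (at-injective z eq)
        ; satisfies = satisfies z ∘ suc }) | D? (at z zero)
    ... | b , c , eq , (y , sy) , (w , sw) | yes d =
      suc b , c , cong suc eq ,
      (family-cons (at z zero) (satisfies z zero , d) y fresh ,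
        λ { zero → zero , refl ; (suc i) → suc (proj₁ (sy i)) , proj₂ (sy i) }) ,
      (w , λ i → suc (proj₁ (sw i)) , proj₂ (sw i))
      where
      fresh : ∀ i → ¬ (at z zero ≈ at y i)
      fresh i e with sy i
      ... | j , p with () ← at-injective z {zero} {suc j} (subst (at z zero ≈_) p e)
    ... | b , c , eq , (y , sy) , (w , sw) | no ¬d =
      b , suc c , trans (cong suc eq) (sym (ℕₚ.+-suc b c)) ,
      (y , λ i → suc (proj₁ (sy i)) , proj₂ (sy i)) ,
      (family-cons (at z zero) (satisfies z zero , ¬d) w fresh ,
        λ { zero → zero , refl ; (suc i) → suc (proj₁ (sw i)) , proj₂ (sw i) })
      where
      fresh : ∀ i → ¬ (at z zero ≈ at w i)
      fresh i e with sw i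
      ... | j , p with () ← at-injective z {zero} {suc j} (subst (at z zero ≈_) p e)

  family-split : ∀ {Pr D : X → Set} → Decidable D → ∀ {a} → Family _≈_ Pr a →
    Σ ℕ λ b → Σ ℕ λ c → (a ≡ b ℕ.+ c) ×
    Family _≈_ (λ x → Pr x × D x) b × Family _≈_ (λ x → Pr x × ¬ D x) c
  family-split D? z with split′ D? _ z
  ... | b , c , eq , (y , _) , (w , _) = b , c , eq , y , w

-- A ring solver with integer coefficients

module IntegerCoefficients (R : CommutativeRing 0ℓ 0ℓ) where
  open CommutativeRing R
    renaming (refl to ≈-refl; sym to ≈-sym; trans to ≈-trans)
  open Algebra.Properties.Semiring.Mult semiring using (×-homo-+; ×1-homo-*) renaming (_×_ to _×ᵣ_)
  open Algebra.Properties.Ring ring using (-‿distribˡ-*; -‿distribʳ-*; -‿involutive; -0#≈0#)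
  open Algebra.Properties.AbelianGroup +-abelianGroup using (⁻¹-∙-comm)
  open import Relation.Binary.Reasoning.Setoid setoid

  -- `ι 1` unfolds to `1# + 0#`, not to `1#`. Identities in which `1#` occurs therefore pass it to
  -- the solver as a variable and remove it afterwards by the identity laws.
  ι : ℕ → Carrier
  ι n = n ×ᵣ 1#

  ⟦_⟧ℤ : ℤ → Carrier
  ⟦ pos n ⟧ℤ = ι n
  ⟦ -[1+ n ] ⟧ℤ = - ι (suc n)

  ⟦⊖⟧ : ∀ m n → ⟦ m ⊖ n ⟧ℤ ≈ ι m + - ι n
  ⟦⊖⟧ m zero = ≈-sym (≈-trans (+-congˡ -0#≈0#) (+-identityʳ _))
  ⟦⊖⟧ zero (suc n) = ≈-sym (+-identityˡ _)
  ⟦⊖⟧ (suc m) (suc n) = begin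
    ⟦ suc m ⊖ suc n ⟧ℤ           ≡⟨ cong ⟦_⟧ℤ (ℤₚ.[1+m]⊖[1+n]≡m⊖n m n) ⟩
    ⟦ m ⊖ n ⟧ℤ                   ≈⟨ ⟦⊖⟧ m n ⟩
    ι m + - ι n                  ≈⟨ +-congˡ (+-identityˡ _) ⟨
    ι m + (0# + - ι n)           ≈⟨ +-congˡ (+-congʳ (-‿inverseʳ 1#)) ⟨
    ι m + (1# + - 1# + - ι n)    ≈⟨ +-congˡ (+-assoc _ _ _) ⟩
    ι m + (1# + (- 1# + - ι n))  ≈⟨ +-assoc _ _ _ ⟨
    ι m + 1# + (- 1# + - ι n)    ≈⟨ +-cong (+-comm _ _) (⁻¹-∙-comm _ _) ⟩
    ι (suc m) + - ι (suc n)      ∎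

  +-homo : ∀ i j → ⟦ i ℤ.+ j ⟧ℤ ≈ ⟦ i ⟧ℤ + ⟦ j ⟧ℤ
  +-homo (pos m) (pos n) = ×-homo-+ 1# m n
  +-homo (pos m) -[1+ n ] = ⟦⊖⟧ m (suc n)
  +-homo -[1+ m ] (pos n) = ≈-trans (⟦⊖⟧ n (suc m)) (+-comm _ _)
  +-homo -[1+ m ] -[1+ n ] = begin
    - ι (suc (suc (m ℕ.+ n)))      ≡⟨ cong (-_ ∘ ι ∘ suc) (ℕₚ.+-suc m n) ⟨
    - ι (suc m ℕ.+ suc n)          ≈⟨ -‿cong (×-homo-+ 1# (suc m) (suc n)) ⟩
    - (ι (suc m) + ι (suc n))      ≈⟨ ⁻¹-∙-comm _ _ ⟨
    - ι (suc m) + - ι (suc n)      ∎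

  -‿homo : ∀ i → ⟦ ℤ.- i ⟧ℤ ≈ - ⟦ i ⟧ℤ
  -‿homo (pos zero) = ≈-sym -0#≈0#
  -‿homo (pos (suc n)) = ≈-refl
  -‿homo -[1+ n ] = ≈-sym (-‿involutive _)

  *-homo⁺ : ∀ m j → ⟦ pos m ℤ.* j ⟧ℤ ≈ ι m * ⟦ j ⟧ℤ
  *-homo⁺ m (pos n) = ≈-trans (reflexive (cong ⟦_⟧ℤ (sym (ℤₚ.pos-* m n)))) (×1-homo-* m n)
  *-homo⁺ m -[1+ n ] = begin
    ⟦ pos m ℤ.* -[1+ n ] ⟧ℤ         ≡⟨ cong ⟦_⟧ℤ (sym (ℤₚ.neg-distribʳ-* (pos m) (pos (suc n)))) ⟩
    ⟦ ℤ.- (pos m ℤ.* pos (suc n)) ⟧ℤ    ≈⟨ -‿homo (pos m ℤ.* pos (suc n)) ⟩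
    - ⟦ pos m ℤ.* pos (suc n) ⟧ℤ        ≈⟨ -‿cong (*-homo⁺ m (pos (suc n))) ⟩
    - (ι m * ι (suc n))           ≈⟨ -‿distribʳ-* _ _ ⟩
    ι m * - ι (suc n)             ∎

  *-homo : ∀ i j → ⟦ i ℤ.* j ⟧ℤ ≈ ⟦ i ⟧ℤ * ⟦ j ⟧ℤ
  *-homo (pos m) j = *-homo⁺ m j
  *-homo -[1+ m ] j = begin
    ⟦ -[1+ m ] ℤ.* j ⟧ℤ           ≡⟨ cong ⟦_⟧ℤ (sym (ℤₚ.neg-distribˡ-* (pos (suc m)) j)) ⟩
    ⟦ ℤ.- (pos (suc m) ℤ.* j) ⟧ℤ      ≈⟨ -‿homo (pos (suc m) ℤ.* j) ⟩
    - ⟦ pos (suc m) ℤ.* j ⟧ℤ          ≈⟨ -‿cong (*-homo⁺ (suc m) j) ⟩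
    - (ι (suc m) * ⟦ j ⟧ℤ)        ≈⟨ -‿distribˡ-* _ _ ⟩
    - ι (suc m) * ⟦ j ⟧ℤ          ∎

  morphism : ℤ.+-*-rawRing -Raw-AlmostCommutative⟶ fromCommutativeRing R
  morphism = record
    { ⟦_⟧ = ⟦_⟧ℤ ; +-homo = +-homo ; *-homo = *-homo ; -‿homo = -‿homo
    ; 0-homo = ≈-refl ; 1-homo = +-identityʳ 1# }

  coefficient≟ : ∀ i j → Maybe (⟦ i ⟧ℤ ≈ ⟦ j ⟧ℤ)
  coefficient≟ i j with i ℤ.≟ j
  ... | yes eq = just (reflexive (cong ⟦_⟧ℤ eq))
  ... | no _ = nothing

  open Algebra.Solver.Ring ℤ.+-*-rawRing (fromCommutativeRing R) morphism coefficient≟ public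
    using (solve; _:=_; _:+_; _:*_; _:-_; :-_; con)

-- Prime divisors of binomial coefficients

p∤k! : ∀ {p} → Prime p → ∀ k → k ℕ.< p → ¬ (p ∣ k !)
p∤k! pr zero k<p p∣1 = contradiction (Div.∣⇒≤ p∣1)
  (ℕₚ.<⇒≱ (ℕ.nonTrivial⇒n>1 _ {{prime⇒nonTrivial pr}}))
p∤k! pr (suc k) k<p p∣ with euclidsLemma (suc k) (k !) pr p∣
... | inj₁ p∣sk = contradiction (Div.∣⇒≤ p∣sk) (ℕₚ.<⇒≱ k<p)
... | inj₂ p∣k! = p∤k! pr k (ℕₚ.<-trans (ℕₚ.n<1+n k) k<p) p∣k!

-- p divides p! = (p C k) · k! · (p - k)! but neither of the two factorials on the right, whose
-- arguments are below p.
p∣pCk : ∀ {p} → Prime p → ∀ k → 0 ℕ.< k → k ℕ.< p → p ∣ p C k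
p∣pCk {p} pr k 0<k k<p with euclidsLemma (p C k) (k ! ℕ.* (p ℕ.∸ k) !) pr p∣prod
  where
  instance
    nz : ℕ.NonZero (k ! ℕ.* (p ℕ.∸ k) !)
    nz = k ℕₚ.!* (p ℕ.∸ k) !≢0
  prod : (p C k) ℕ.* (k ! ℕ.* (p ℕ.∸ k) !) ≡ p !
  prod = trans (cong (ℕ._* (k ! ℕ.* (p ℕ.∸ k) !)) (nCk≡n!/k![n-k]! (ℕₚ.<⇒≤ k<p)))
    (m/n*n≡m (k![n∸k]!∣n! (ℕₚ.<⇒≤ k<p)))
  p∣p! : ∀ m → m ≡ p → p ∣ m !
  p∣p! zero refl = contradiction k<p (λ ())
  p∣p! (suc m) refl = Div.m∣m*n (m !)
  p∣prod : p ∣ (p C k) ℕ.* (k ! ℕ.* (p ℕ.∸ k) !)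
  p∣prod = subst (p ∣_) (sym prod) (p∣p! p refl)
... | inj₁ p∣C = p∣C
... | inj₂ p∣kk with euclidsLemma (k !) ((p ℕ.∸ k) !) pr p∣kk
... | inj₁ d = ⊥-elim (p∤k! pr k k<p d)
... | inj₂ d = ⊥-elim (p∤k! pr (p ℕ.∸ k) (ℕₚ.∸-monoʳ-< 0<k (ℕₚ.<⇒≤ k<p)) d)

-- Finite fields

module FieldTheory {n : ℕ} (F : FiniteField n) where
  open FiniteField F

  ring : CommutativeRing 0ℓ 0ℓ
  ring = record { isCommutativeRing = isCommutativeRing }

  open CommutativeRing ring public using
    ( +-assoc; +-comm; +-identityˡ; +-identityʳ; *-assoc; *-comm; *-identityˡ; *-identityʳ
    ; distribˡ; distribʳ; zeroˡ; zeroʳ; -‿inverseˡ; -‿inverseʳ; semiring; commutativeSemiring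
    ; +-commutativeMonoid; *-commutativeMonoid)
  open Algebra.Properties.Semiring.Mult semiring public
    using (×1-homo-*; ×-assoc-*) renaming (_×_ to _×ᵣ_)
  open Algebra.Properties.Semiring.Exp semiring public using (_^_; ^-assocʳ)
  open Algebra.Properties.CommutativeSemiring.Exp commutativeSemiring public using (^-distrib-*)
  open IntegerCoefficients ring public using (solve; _:=_; _:+_; _:*_; _:-_; :-_; con)
  module Sum = Algebra.Properties.CommutativeMonoid.Sum +-commutativeMonoid
  module Prod = Algebra.Properties.CommutativeMonoid.Sum *-commutativeMonoid

  recip : ∀ {x} → x ≢ 0# → Carrier
  recip {x} x≢0 = proj₁ (inverse x x≢0)

  *-recip : ∀ {x} (x≢0 : x ≢ 0#) → x * recip x≢0 ≡ 1#
  *-recip {x} x≢0 = proj₂ (inverse x x≢0)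

  recip-* : ∀ {x} (x≢0 : x ≢ 0#) → recip x≢0 * x ≡ 1#
  recip-* x≢0 = trans (*-comm _ _) (*-recip x≢0)

  recip≢0 : ∀ {x} (x≢0 : x ≢ 0#) → recip x≢0 ≢ 0#
  recip≢0 {x} x≢0 eq = 0≢1 (trans (sym (zeroʳ x)) (trans (cong (x *_) (sym eq)) (*-recip x≢0)))

  cancelˡ : ∀ {a x y} → a ≢ 0# → a * x ≡ a * y → x ≡ y
  cancelˡ {a} {x} {y} a≢0 eq = begin
    x                   ≡⟨ *-identityˡ x ⟨
    1# * x              ≡⟨ cong (_* x) (recip-* a≢0) ⟨
    recip a≢0 * a * x   ≡⟨ *-assoc _ _ _ ⟩
    recip a≢0 * (a * x) ≡⟨ cong (recip a≢0 *_) eq ⟩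
    recip a≢0 * (a * y) ≡⟨ *-assoc _ _ _ ⟨
    recip a≢0 * a * y   ≡⟨ cong (_* y) (recip-* a≢0) ⟩
    1# * y              ≡⟨ *-identityˡ y ⟩
    y                   ∎
    where open ≡-Reasoning

  zero-product : ∀ {a x} → a ≢ 0# → a * x ≡ 0# → x ≡ 0#
  zero-product a≢0 eq = cancelˡ a≢0 (trans eq (sym (zeroʳ _)))

  *≢0 : ∀ {a b} → a ≢ 0# → b ≢ 0# → a * b ≢ 0#
  *≢0 a≢0 b≢0 eq = b≢0 (zero-product a≢0 eq)

  integral : ∀ {a b} → a * b ≡ 0# → a ≡ 0# ⊎ b ≡ 0#
  integral {a} eq with a ≟ 0#
  ... | yes p = inj₁ p
  ... | no ¬p = inj₂ (zero-product ¬p eq)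

  *0 : ∀ {x y} → y ≡ 0# → x * y ≡ 0#
  *0 {x} e = trans (cong (x *_) e) (zeroʳ x)

  +0* : ∀ {x y a} → y ≡ 0# → x + a * y ≡ x
  +0* {x} {y} {a} e = trans (cong (λ z → x + a * z) e) (trans (cong (x +_) (zeroʳ a)) (+-identityʳ x))

  0+*1 : ∀ {x y a} → x ≡ 0# → y ≡ 1# → x + a * y ≡ a
  0+*1 {x} {y} {a} e f = trans (cong₂ (λ x y → x + a * y) e f) (trans (+-identityˡ _) (*-identityʳ a))

  difference≡0 : ∀ {x y} → x + - y ≡ 0# → x ≡ y
  difference≡0 {x} {y} eq = begin
    x               ≡⟨ solve 2 (λ x y → x := x :+ :- y :+ y) refl x y ⟩
    x + - y + y     ≡⟨ cong (_+ y) eq ⟩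
    0# + y          ≡⟨ +-identityˡ y ⟩
    y               ∎
    where open ≡-Reasoning

  -0≡0 : - 0# ≡ 0#
  -0≡0 = solve 0 (:- con (pos 0) := con (pos 0)) refl

  ≡⇒difference≡0 : ∀ {x y} → x ≡ y → x + - y ≡ 0#
  ≡⇒difference≡0 {x} refl = -‿inverseʳ x

  private
    el : Fin n → Carrier
    el = Inverse.from enum
    ix : Carrier → Fin n
    ix = Inverse.to enum
    el∘ix : ∀ x → el (ix x) ≡ x
    el∘ix = Inverse.strictlyInverseʳ enum
    ix∘el : ∀ i → ix (el i) ≡ i
    ix∘el = Inverse.strictlyInverseˡ enum

    permute : (f g : Carrier → Carrier) → (∀ x → f (g x) ≡ x) → (∀ x → g (f x) ≡ x) → Fin n ↔ Fin n
    permute f g fg gf = mk↔ₛ′ (ix ∘ f ∘ el) (ix ∘ g ∘ el)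
      (λ i → trans (cong (ix ∘ f) (el∘ix _)) (trans (cong ix (fg _)) (ix∘el i)))
      (λ i → trans (cong (ix ∘ g) (el∘ix _)) (trans (cong ix (gf _)) (ix∘el i)))

  -- Translation by x permutes the field, so the sum of all elements equals itself plus n copies of
  -- x.
  order-annihilates : ∀ x → n ×ᵣ x ≡ 0#
  order-annihilates x = begin
    n ×ᵣ x                    ≡⟨ solve 2 (λ a s → a := a :+ s :- s) refl (n ×ᵣ x) s ⟩
    n ×ᵣ x + s + - s          ≡⟨ cong (λ z → z + s + - s) (Sum.sum-replicate n) ⟨
    Sum.sum {n} (λ _ → x) + s + - s  ≡⟨ cong (_+ - s) (Sum.∑-distrib-+ {n} (λ _ → x) el) ⟨
    Sum.sum (λ i → x + el i) + - s   ≡⟨ cong (_+ - s) (Sum.sum-cong-≗ (λ i → el∘ix (x + el i))) ⟨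
    Sum.sum (λ i → el (ix (x + el i))) + - s ≡⟨ cong (_+ - s) (Sum.sum-permute el π) ⟨
    s + - s                   ≡⟨ -‿inverseʳ s ⟩
    0#                        ∎
    where
    open ≡-Reasoning
    s = Sum.sum el
    π = permute (x +_) (- x +_)
      (λ y → solve 2 (λ x y → x :+ (:- x :+ y) := y) refl x y)
      (λ y → solve 2 (λ x y → :- x :+ (x :+ y) := y) refl x y)

  -- The product is taken over the values unit (a·x): replacing the factor 0 by 1 keeps it nonzero.
  private
    unit : Carrier → Carrier
    unit x with x ≟ 0#
    ... | yes _ = 1#
    ... | no _ = x

    unit≢0 : ∀ x → unit x ≢ 0#
    unit≢0 x with x ≟ 0#
    ... | yes _ = 0≢1 ∘ sym
    ... | no ¬p = ¬p

    Πunit≢0 : ∀ {m} (f : Fin m → Carrier) → Prod.sum (unit ∘ f) ≢ 0#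
    Πunit≢0 {zero} f = 0≢1 ∘ sym
    Πunit≢0 {suc m} f = *≢0 (unit≢0 (f zero)) (Πunit≢0 (f ∘ suc))

  module _ {a : Carrier} (a≢0 : a ≢ 0#) where
    private
      factor : Carrier → Carrier
      factor x with x ≟ 0#
      ... | yes _ = 1#
      ... | no _ = a

      unit-* : ∀ x → unit (a * x) ≡ factor x * unit x
      unit-* x with x ≟ 0# | (a * x) ≟ 0#
      ... | yes p | yes _ = sym (*-identityˡ 1#)
      ... | yes p | no ¬q = contradiction (*0 p) ¬q
      ... | no ¬p | yes q = contradiction (zero-product a≢0 q) ¬p
      ... | no ¬p | no _ = refl

      factor-0 : factor 0# ≡ 1#
      factor-0 with 0# ≟ 0#
      ... | yes _ = refl
      ... | no ¬p = contradiction refl ¬p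

      factor-≢0 : ∀ {x} → x ≢ 0# → factor x ≡ a
      factor-≢0 {x} x≢0 with x ≟ 0#
      ... | yes p = contradiction p x≢0
      ... | no _ = refl

      -- Multiplication by a permutes the field, so the product of all `unit` values does not change
      -- when each picks up its `factor`; that product is nonzero and cancels.
      Πfactor≡1 : Prod.sum (factor ∘ el) ≡ 1#
      Πfactor≡1 = cancelˡ (Πunit≢0 el) (begin
        s * Prod.sum (factor ∘ el)                 ≡⟨ *-comm _ _ ⟩
        Prod.sum (factor ∘ el) * s                 ≡⟨ Prod.∑-distrib-+ (factor ∘ el) (unit ∘ el) ⟨
        Prod.sum (λ i → factor (el i) * unit (el i)) ≡⟨ Prod.sum-cong-≗ (λ i → unit-* (el i)) ⟨
        Prod.sum (λ i → unit (a * el i))           ≡⟨ Prod.sum-cong-≗ (λ i → cong unit (el∘ix (a * el i))) ⟨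
        Prod.sum (λ i → unit (el (ix (a * el i)))) ≡⟨ Prod.sum-permute (unit ∘ el) π ⟨
        s                                          ≡⟨ *-identityʳ s ⟨
        s * 1#                                     ∎)
        where
        open ≡-Reasoning
        s = Prod.sum (unit ∘ el)
        π = permute (a *_) (recip a≢0 *_)
          (λ y → trans (sym (*-assoc _ _ _)) (trans (cong (_* y) (*-recip a≢0)) (*-identityˡ y)))
          (λ y → trans (sym (*-assoc _ _ _)) (trans (cong (_* y) (recip-* a≢0)) (*-identityˡ y)))

      -- The factor belonging to 0 is 1, so the product contains one a fewer than there are
      -- elements; the a in front restores the exponent m.
      remove : ∀ {m} (f : Fin m → Carrier) (i : Fin m) → f i ≡ 1# → (∀ j → j ≢ i → f j ≡ a) →
               a * Prod.sum f ≡ a ^ m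
      remove {suc m} f i fi fj = cong (a *_) (begin
        Prod.sum f                            ≡⟨ Prod.sum-remove {i = i} f ⟩
        f i * Prod.sum (removeAt f i)         ≡⟨ cong (_* Prod.sum (removeAt f i)) fi ⟩
        1# * Prod.sum (removeAt f i)          ≡⟨ *-identityˡ _ ⟩
        Prod.sum (removeAt f i)               ≡⟨ Prod.sum-cong-≗ (λ j → fj _ (Finₚ.punchInᵢ≢i i j)) ⟩
        Prod.sum {m} (λ _ → a)                ≡⟨ Prod.sum-replicate m ⟩
        a ^ m                                 ∎)
        where open ≡-Reasoning

    fermat-≢0 : a ^ n ≡ a
    fermat-≢0 = begin
      a ^ n                        ≡⟨ remove (factor ∘ el) (ix 0#) (trans (cong factor (el∘ix 0#)) factor-0)
                                       (λ j j≢ → factor-≢0 (λ p → j≢ (trans (sym (ix∘el j)) (cong ix p)))) ⟨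
      a * Prod.sum (factor ∘ el)   ≡⟨ cong (a *_) Πfactor≡1 ⟩
      a * 1#                       ≡⟨ *-identityʳ a ⟩
      a                            ∎
      where open ≡-Reasoning

  fermat : ∀ a → a ^ n ≡ a
  fermat a with a ≟ 0#
  ... | no ¬p = fermat-≢0 ¬p
  -- The index of 0 witnesses that n is positive, so the power really contains a factor 0.
  ... | yes refl = go (ix 0#)
    where
    go : ∀ {m} → Fin m → 0# ^ m ≡ 0#
    go {suc m} _ = zeroˡ _

  -- A vector lists the lower coefficients of a monic polynomial, constant term first.
  eval : ∀ {d} → Vec Carrier d → Carrier → Carrier
  eval [] x = 1#
  eval (a ∷ cs) x = a + x * eval cs x

  quotient : ∀ {d} → Carrier → Vec Carrier (suc d) → Vec Carrier d
  quotient r (a ∷ []) = []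
  quotient r (a ∷ cs@(_ ∷ _)) = eval cs r ∷ quotient r cs

  quotient-eval : ∀ {d} r (cs : Vec Carrier (suc d)) x →
                  eval cs x + - eval cs r ≡ (x + - r) * eval (quotient r cs) x
  quotient-eval r (a ∷ []) x =
    solve 4 (λ a r x o → a :+ x :* o :+ :- (a :+ r :* o) := (x :+ :- r) :* o) refl a r x 1#
  quotient-eval r (a ∷ cs@(_ ∷ _)) x = begin
    a + x * f x + - (a + r * f r)
      ≡⟨ solve 5 (λ a r x fx fr → a :+ x :* fx :+ :- (a :+ r :* fr)
           := (x :+ :- r) :* fr :+ x :* (fx :+ :- fr)) refl a r x (f x) (f r) ⟩
    (x + - r) * f r + x * (f x + - f r)
      ≡⟨ cong (λ z → (x + - r) * f r + x * z) (quotient-eval r cs x) ⟩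
    (x + - r) * f r + x * ((x + - r) * g)
      ≡⟨ solve 4 (λ d fr x g → d :* fr :+ x :* (d :* g) := d :* (fr :+ x :* g)) refl (x + - r) (f r) x g ⟩
    (x + - r) * (f r + x * g)  ∎
    where
    open ≡-Reasoning
    f = eval cs
    g = eval (quotient r cs) x

  root-bound : ∀ {d m} (cs : Vec Carrier d) (r : Fin m → Carrier) → Injective r →
               (∀ i → eval cs (r i) ≡ 0#) → m ℕ.≤ d
  root-bound {m = zero} cs r inj root = ℕ.z≤n
  root-bound {zero} {suc m} [] r inj root = contradiction (sym (root zero)) 0≢1
  root-bound {suc d} {suc m} cs r inj root =
    ℕ.s≤s (root-bound (quotient (r zero) cs) (r ∘ suc) (Finₚ.suc-injective ∘ inj) λ i →
      zero-product (λ eq → contradiction (inj (difference≡0 eq)) λ ())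
        (trans (sym (quotient-eval (r zero) cs (r (suc i))))
          (trans (cong₂ (λ x y → x + - y) (root (suc i)) (root zero)) (-‿inverseʳ 0#))))

  module Frobenius {p : ℕ} (pr : Prime p) (p×1≡0 : p ×ᵣ 1# ≡ 0#) where
    open Algebra.Properties.CommutativeSemiring.Binomial commutativeSemiring
      using (theorem; binomialTerm)

    p∣⇒×≡0 : ∀ {m} → p ∣ m → ∀ x → m ×ᵣ x ≡ 0#
    p∣⇒×≡0 {m} (divides k refl) x = begin
      (k ℕ.* p) ×ᵣ x            ≡⟨ cong ((k ℕ.* p) ×ᵣ_) (*-identityˡ x) ⟨
      (k ℕ.* p) ×ᵣ (1# * x)     ≡⟨ ×-assoc-* (k ℕ.* p) 1# x ⟨
      (k ℕ.* p) ×ᵣ 1# * x       ≡⟨ cong (_* x) (×1-homo-* k p) ⟩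
      (k ×ᵣ 1#) * (p ×ᵣ 1#) * x ≡⟨ cong (λ z → (k ×ᵣ 1#) * z * x) p×1≡0 ⟩
      (k ×ᵣ 1#) * 0# * x        ≡⟨ cong (_* x) (zeroʳ _) ⟩
      0# * x                    ≡⟨ zeroˡ x ⟩
      0#                        ∎
      where open ≡-Reasoning

    private
      ends : ∀ {m} (t : Fin (suc (suc m)) → Carrier) →
             (∀ i → 0 ℕ.< Fin.toℕ i → Fin.toℕ i ℕ.< suc m → t i ≡ 0#) →
             Sum.sum t ≡ t zero + t (Fin.fromℕ (suc m))
      ends {m} t mid = cong (t zero +_) (begin
        Sum.sum (t ∘ suc)                                  ≡⟨ Sum.sum-init-last (t ∘ suc) ⟩
        Sum.sum (t ∘ suc ∘ Fin.inject₁) + t (suc (Fin.fromℕ m)) ≡⟨ cong (_+ t (suc (Fin.fromℕ m))) zeros ⟩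
        0# + t (suc (Fin.fromℕ m))                         ≡⟨ +-identityˡ _ ⟩
        t (suc (Fin.fromℕ m))                              ∎)
        where
        open ≡-Reasoning
        zeros : Sum.sum (t ∘ suc ∘ Fin.inject₁) ≡ 0#
        zeros = trans (Sum.sum-cong-≗ {m} (λ i → mid (suc (Fin.inject₁ i)) ℕ.z<s
            (ℕ.s<s (subst (ℕ._< m) (sym (Finₚ.toℕ-inject₁ i)) (Finₚ.toℕ<n i)))))
          (Sum.sum-replicate-zero m)

    frobenius-+ : ∀ x y → (x + y) ^ p ≡ x ^ p + y ^ p
    frobenius-+ x y = go p refl
      where
      open ≡-Reasoning
      go : ∀ m → m ≡ p → (x + y) ^ m ≡ x ^ m + y ^ m
      go zero eq = ⊥-elim (ℕ.≢-nonZero⁻¹ p {{prime⇒nonZero pr}} (sym eq))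
      go (suc zero) refl = contradiction (ℕ.nonTrivial⇒n>1 _ {{prime⇒nonTrivial pr}}) (ℕₚ.<-irrefl refl)
      go (suc (suc m)) refl = begin
        (x + y) ^ p
          ≡⟨ theorem p x y ⟩
        Sum.sum (binomialTerm x y p)
          ≡⟨ ends (binomialTerm x y p) (λ i lo hi → p∣⇒×≡0 (p∣pCk pr (Fin.toℕ i) lo hi) _) ⟩
        binomialTerm x y p zero + binomialTerm x y p (Fin.fromℕ p)
          ≡⟨ cong₂ _+_ t0 tp ⟩
        y ^ p + x ^ p
          ≡⟨ +-comm _ _ ⟩
        x ^ p + y ^ p ∎
        where
        once : ∀ {k} z → k ≡ 1 → k ×ᵣ z ≡ z
        once z refl = +-identityʳ z
        t0 : binomialTerm x y p zero ≡ y ^ p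
        t0 = trans (once (1# * y ^ p) (trans (nCk≡nC[n∸k] {n = p} ℕ.z≤n) (nCn≡1 p))) (*-identityˡ _)
        tp : binomialTerm x y p (Fin.fromℕ p) ≡ x ^ p
        tp = begin
          (p C Fin.toℕ (Fin.fromℕ p)) ×ᵣ (x ^ Fin.toℕ (Fin.fromℕ p) * y ^ (p ℕ.∸ Fin.toℕ (Fin.fromℕ p)))
            ≡⟨ cong (λ k → (p C k) ×ᵣ (x ^ k * y ^ (p ℕ.∸ k))) (Finₚ.toℕ-fromℕ p) ⟩
          (p C p) ×ᵣ (x ^ p * y ^ (p ℕ.∸ p))
            ≡⟨ once _ (nCn≡1 p) ⟩
          x ^ p * y ^ (p ℕ.∸ p)
            ≡⟨ cong (λ k → x ^ p * y ^ k) (ℕₚ.n∸n≡0 p) ⟩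
          x ^ p * 1#
            ≡⟨ *-identityʳ _ ⟩
          x ^ p ∎

    frobenius-^+ : ∀ k x y → (x + y) ^ (p ℕ.^ k) ≡ x ^ (p ℕ.^ k) + y ^ (p ℕ.^ k)
    frobenius-^+ zero x y = solve 3 (λ x y o → (x :+ y) :* o := x :* o :+ y :* o) refl x y 1#
    frobenius-^+ (suc k) x y = begin
      (x + y) ^ (p ℕ.* p ℕ.^ k)                        ≡⟨ ^-assocʳ (x + y) p (p ℕ.^ k) ⟨
      ((x + y) ^ p) ^ (p ℕ.^ k)                        ≡⟨ cong (_^ (p ℕ.^ k)) (frobenius-+ x y) ⟩
      (x ^ p + y ^ p) ^ (p ℕ.^ k)                      ≡⟨ frobenius-^+ k (x ^ p) (y ^ p) ⟩
      (x ^ p) ^ (p ℕ.^ k) + (y ^ p) ^ (p ℕ.^ k)        ≡⟨ cong₂ _+_ (^-assocʳ x p (p ℕ.^ k)) (^-assocʳ y p (p ℕ.^ k)) ⟩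
      x ^ (p ℕ.* p ℕ.^ k) + y ^ (p ℕ.* p ℕ.^ k)        ∎
      where open ≡-Reasoning

list-family : {X : Set} {_≈_ : X → X → Set} {Pr : X → Set} {xs : List X} → (∀ {x y} → x ≈ y → y ≈ x) →
              AllPairs (λ x y → ¬ (x ≈ y)) xs → All Pr xs → Family _≈_ Pr (length xs)
list-family {X} {_≈_} {Pr} {xs} ≈-sym apart pxs = record
  { at = lookup xs
  ; at-injective = injective apart
  ; satisfies = λ i → All.lookup pxs (∈-lookup i) }
  where
  injective : ∀ {xs} → AllPairs (λ x y → ¬ (x ≈ y)) xs → ∀ {i j} → lookup xs i ≈ lookup xs j → i ≡ j
  injective (fresh ∷ ps) {zero} {zero} eq = refl
  injective (fresh ∷ ps) {zero} {suc j} eq = contradiction eq (All.lookup fresh (∈-lookup j))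
  injective (fresh ∷ ps) {suc i} {zero} eq = contradiction (≈-sym eq) (All.lookup fresh (∈-lookup i))
  injective (fresh ∷ ps) {suc i} {suc j} eq = cong suc (injective ps eq)

-- The extension of GF(q) by GF(q²): conjugation, trace and an imaginary element

module QuadraticExtension (q : ℕ) (opp : OddPrimePower q) (F : FiniteField (q ℕ.* q)) where
  open Geometry F q
  open FieldTheory F public

  private
    p = proj₁ opp
    k = proj₁ (proj₂ opp)
    p-prime : Prime p
    p-prime = proj₁ (proj₂ (proj₂ opp))
    p≢2 : p ≢ 2
    p≢2 = proj₁ (proj₂ (proj₂ (proj₂ opp)))
    k≥1 : k ℕ.≥ 1
    k≥1 = proj₁ (proj₂ (proj₂ (proj₂ (proj₂ opp))))
    q≡p^k : q ≡ p ℕ.^ k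
    q≡p^k = proj₂ (proj₂ (proj₂ (proj₂ (proj₂ opp))))

    ×1-homo-^ : ∀ m → (p ℕ.^ m) ×ᵣ 1# ≡ (p ×ᵣ 1#) ^ m
    ×1-homo-^ zero = +-identityʳ 1#
    ×1-homo-^ (suc m) = trans (×1-homo-* p (p ℕ.^ m)) (cong ((p ×ᵣ 1#) *_) (×1-homo-^ m))

    ^≡0 : ∀ x m → x ^ m ≡ 0# → x ≡ 0#
    ^≡0 x zero eq = contradiction (sym eq) 0≢1
    ^≡0 x (suc m) eq with integral eq
    ... | inj₁ e = e
    ... | inj₂ e = ^≡0 x m e

    -- The order q² = p^(2k) annihilates 1, so the power (p·1)^(2k) is 0, and a field has no
    -- nilpotents.
    p×1≡0 : p ×ᵣ 1# ≡ 0#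
    p×1≡0 = ^≡0 _ (k ℕ.+ k) (begin
      (p ×ᵣ 1#) ^ (k ℕ.+ k)           ≡⟨ ×1-homo-^ (k ℕ.+ k) ⟨
      (p ℕ.^ (k ℕ.+ k)) ×ᵣ 1#         ≡⟨ cong (_×ᵣ 1#) (ℕₚ.^-distribˡ-+-* p k k) ⟩
      (p ℕ.^ k ℕ.* p ℕ.^ k) ×ᵣ 1#     ≡⟨ cong (λ r → (r ℕ.* r) ×ᵣ 1#) q≡p^k ⟨
      (q ℕ.* q) ×ᵣ 1#                 ≡⟨ order-annihilates 1# ⟩
      0#                              ∎)
      where open ≡-Reasoning

    p≥3 : 3 ℕ.≤ p
    p≥3 = ℕₚ.≤∧≢⇒< (ℕ.nonTrivial⇒n>1 _ {{prime⇒nonTrivial p-prime}}) (p≢2 ∘ sym)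

    p-odd : ¬ (2 ∣ p)
    p-odd 2∣p with prime⇒irreducible p-prime 2∣p
    ... | inj₂ 2≡p = p≢2 (sym 2≡p)

  3≤q : 3 ℕ.≤ q
  3≤q = subst (3 ℕ.≤_) (sym q≡p^k) (ℕₚ.≤-trans p≥3 (p≤p^ k k≥1))
    where
    p≤p^ : ∀ k → k ℕ.≥ 1 → p ℕ.≤ p ℕ.^ k
    p≤p^ (suc k) _ = ℕₚ.m≤m*n p (p ℕ.^ k) {{ℕₚ.m^n≢0 p k {{prime⇒nonZero p-prime}}}}

  2# : Carrier
  2# = 1# + 1#

  2#* : ∀ x → 2# * x ≡ x + x
  2#* x = trans (distribʳ x 1# 1#) (cong₂ _+_ (*-identityˡ x) (*-identityˡ x))

  private
    -- If 2 = 0 in the field, every odd multiple of 1 is 1. For the odd prime p this contradicts p·1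
    -- = 0.
    even-or-odd : ∀ m → (2 ∣ m) ⊎ (1# + 1# ≡ 0# → m ×ᵣ 1# ≡ 1#)
    even-or-odd zero = inj₁ (2 Div.∣0)
    even-or-odd (suc zero) = inj₂ (λ _ → +-identityʳ 1#)
    even-or-odd (suc (suc m)) with even-or-odd m
    ... | inj₁ d = inj₁ (Div.∣m∣n⇒∣m+n Div.∣-refl d)
    ... | inj₂ o = inj₂ (λ eq → trans (sym (+-assoc _ _ _))
                     (trans (cong₂ _+_ eq (o eq)) (+-identityˡ 1#)))

  2≢0 : 2# ≢ 0#
  2≢0 eq with even-or-odd p
  ... | inj₁ d = p-odd d
  ... | inj₂ o = 0≢1 (trans (sym p×1≡0) (o eq))

  private
    pow≡^ : ∀ x m → pow x m ≡ x ^ m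
    pow≡^ x zero = refl
    pow≡^ x (suc m) = cong (x *_) (pow≡^ x m)

    conj≡ : ∀ x → conj x ≡ x ^ q
    conj≡ x = pow≡^ x q

  conj-+ : ∀ x y → conj (x + y) ≡ conj x + conj y
  conj-+ x y rewrite conj≡ (x + y) | conj≡ x | conj≡ y =
    subst (λ r → (x + y) ^ r ≡ x ^ r + y ^ r) (sym q≡p^k)
      (Frobenius.frobenius-^+ p-prime p×1≡0 k x y)

  conj-* : ∀ x y → conj (x * y) ≡ conj x * conj y
  conj-* x y rewrite conj≡ (x * y) | conj≡ x | conj≡ y = ^-distrib-* x y q

  conj-conj : ∀ x → conj (conj x) ≡ x
  conj-conj x = begin
    pow (pow x q) q   ≡⟨ conj≡ (conj x) ⟩
    (pow x q) ^ q     ≡⟨ cong (_^ q) (conj≡ x) ⟩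
    (x ^ q) ^ q       ≡⟨ ^-assocʳ x q q ⟩
    x ^ (q ℕ.* q)     ≡⟨ fermat x ⟩
    x                 ∎
    where open ≡-Reasoning

  conj-0 : conj 0# ≡ 0#
  conj-0 = begin
    conj 0#                                ≡⟨ solve 1 (λ x → x := x :+ x :- x) refl (conj 0#) ⟩
    conj 0# + conj 0# + - conj 0#          ≡⟨ cong (_+ - conj 0#) (conj-+ 0# 0#) ⟨
    conj (0# + 0#) + - conj 0#             ≡⟨ cong (λ z → conj z + - conj 0#) (+-identityˡ 0#) ⟩
    conj 0# + - conj 0#                    ≡⟨ -‿inverseʳ _ ⟩
    0#                                     ∎
    where open ≡-Reasoning

  conj-1 : conj 1# ≡ 1#
  conj-1 = trans (conj≡ 1#) (1^ q)
    where
    1^ : ∀ m → 1# ^ m ≡ 1#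
    1^ zero = refl
    1^ (suc m) = trans (*-identityˡ _) (1^ m)

  conj-neg : ∀ x → conj (- x) ≡ - conj x
  conj-neg x = difference≡0 (begin
    conj (- x) + - (- conj x)   ≡⟨ solve 2 (λ a b → a :+ :- (:- b) := a :+ b) refl (conj (- x)) (conj x) ⟩
    conj (- x) + conj x         ≡⟨ conj-+ (- x) x ⟨
    conj (- x + x)              ≡⟨ cong conj (-‿inverseˡ x) ⟩
    conj 0#                     ≡⟨ conj-0 ⟩
    0#                          ∎)
    where open ≡-Reasoning

  conj≢0 : ∀ {x} → x ≢ 0# → conj x ≢ 0#
  conj≢0 {x} x≢0 eq = x≢0 (trans (sym (conj-conj x)) (trans (cong conj eq) conj-0))

  private
    element : Fin (q ℕ.* q) → Carrier
    element = Inverse.from enum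

    element-injective : Injective element
    element-injective = from-injective enum

    zeros : ∀ m → Vec Carrier m
    zeros m = Vec.replicate m 0#

    eval-zeros : ∀ m x → eval (zeros m) x ≡ x ^ m
    eval-zeros zero x = refl
    eval-zeros (suc m) x = trans (+-identityˡ _) (cong (x *_) (eval-zeros m x))

    -- Otherwise X^q - X would have q² roots.
    nonfixed : ∃ λ t → conj t ≢ t
    nonfixed with Finₚ.¬∀⟶∃¬ (q ℕ.* q) (λ i → conj (element i) ≡ element i)
                    (λ i → conj (element i) ≟ element i) (not-all q refl)
      where
      not-all : ∀ m → m ≡ q → ¬ (∀ i → conj (element i) ≡ element i)
      not-all zero refl _ = contradiction 3≤q λ ()
      not-all (suc zero) refl _ = contradiction 3≤q λ { (ℕ.s≤s ()) }
      not-all (suc (suc m)) refl all = contradiction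
        (root-bound (0# ∷ - 1# ∷ zeros m) element element-injective root)
        (ℕₚ.<⇒≱ (ℕₚ.m<m*n q q (ℕₚ.<-≤-trans (ℕ.s≤s (ℕ.s≤s ℕ.z≤n)) 3≤q)))
        where
        root : ∀ i → eval (0# ∷ - 1# ∷ zeros m) (element i) ≡ 0#
        root i = begin
          0# + x * (- 1# + x * eval (zeros m) x)  ≡⟨ cong (λ e → 0# + x * (- 1# + x * e)) (eval-zeros m x) ⟩
          0# + x * (- 1# + x * x ^ m)             ≡⟨ cong (λ o → 0# + x * o) (+-comm _ _) ⟩
          0# + x * (x * x ^ m + - 1#)             ≡⟨ +-identityˡ _ ⟩
          x * (x * x ^ m + - 1#)                  ≡⟨ solve 3 (λ x y o → x :* (y :+ :- o) := x :* y :+ :- (x :* o)) refl x (x * x ^ m) 1# ⟩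
          x ^ q + - (x * 1#)                      ≡⟨ cong₂ (λ a b → a + - b) (sym (conj≡ x)) (*-identityʳ x) ⟩
          conj x + - x                            ≡⟨ ≡⇒difference≡0 (all i) ⟩
          0#                                      ∎
          where
          open ≡-Reasoning
          x = element i
    ... | i , ¬fix = element i , ¬fix

  -- t - t̄ for some t outside GF(q), hence conj ω = -ω. Testing an identity at the scalars 1 and ω
  -- separates its part symmetric under conjugation from the antisymmetric one; this is used
  -- throughout.
  ω : Carrier
  ω = proj₁ nonfixed + - conj (proj₁ nonfixed)

  ω≢0 : ω ≢ 0#
  ω≢0 eq = proj₂ nonfixed (sym (difference≡0 eq))

  conj-ω : conj ω ≡ - ω
  conj-ω = begin
    conj (t + - conj t)           ≡⟨ conj-+ t (- conj t) ⟩
    conj t + conj (- conj t)      ≡⟨ cong (conj t +_) (conj-neg (conj t)) ⟩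
    conj t + - conj (conj t)      ≡⟨ cong (λ z → conj t + - z) (conj-conj t) ⟩
    conj t + - t                  ≡⟨ solve 2 (λ t u → u :+ :- t := :- (t :+ :- u)) refl t (conj t) ⟩
    - (t + - conj t)              ∎
    where
    open ≡-Reasoning
    t = proj₁ nonfixed

  Tr : Carrier → Carrier
  Tr x = x + conj x

  conj-Tr : ∀ x → conj (Tr x) ≡ Tr x
  conj-Tr x = trans (conj-+ x (conj x)) (trans (cong (conj x +_) (conj-conj x)) (+-comm _ _))

  conj-Trω : ∀ x → conj (ω * (x + - conj x)) ≡ ω * (x + - conj x)
  conj-Trω x = begin
    conj (ω * (x + - conj x))           ≡⟨ conj-* _ _ ⟩
    conj ω * conj (x + - conj x)        ≡⟨ cong₂ _*_ conj-ω (trans (conj-+ _ _) (cong (conj x +_) (trans (conj-neg _) (cong -_ (conj-conj x))))) ⟩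
    - ω * (conj x + - x)                ≡⟨ solve 3 (λ w x y → :- w :* (y :+ :- x) := w :* (x :+ :- y)) refl ω x (conj x) ⟩
    ω * (x + - conj x)                  ∎
    where open ≡-Reasoning

  cancel2 : ∀ {x} → x + x ≡ 0# → x ≡ 0#
  cancel2 {x} eq = zero-product 2≢0
    (trans (2#* x) eq)

  elems-unique : AllPairs _≢_ elems
  elems-unique = Uniqueₚ.map⁺ element-injective (Uniqueₚ.allFin⁺ (q ℕ.* q))

  -- x ↦ (Tr x, ω(x − x̄)) embeds F into two copies of the fixed field, which therefore has at least q elements.
  private
    fixed : List Carrier
    fixed = filter (λ x → conj x ≟ x) elems

    ∈-elems : ∀ x → x ∈ elems
    ∈-elems x = subst (_∈ elems) (Inverse.strictlyInverseʳ enum x) (∈-map⁺ element (∈-allFin (Inverse.to enum x)))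

    fixed-family : Family _≡_ InSubfield (length fixed)
    fixed-family = list-family sym (AllPairsₚ.filter⁺ (λ x → conj x ≟ x) elems-unique)
      (Allₚ.all-filter (λ x → conj x ≟ x) elems)

    position : ∀ {x} → conj x ≡ x → Fin (length fixed)
    position {x} fx = Any.index (∈-filter⁺ (λ x → conj x ≟ x) (∈-elems x) fx)

    position-injective : ∀ {x y} {fx : conj x ≡ x} {fy : conj y ≡ y} → position fx ≡ position fy → x ≡ y
    position-injective {x} {y} {fx} {fy} eq =
      trans (Anyₚ.lookup-index (∈-filter⁺ (λ x → conj x ≟ x) (∈-elems x) fx))
        (trans (cong (lookup fixed) eq)
          (sym (Anyₚ.lookup-index (∈-filter⁺ (λ x → conj x ≟ x) (∈-elems y) fy))))

    split : Carrier → Fin (length fixed) × Fin (length fixed)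
    split x = position (conj-Tr x) , position (conj-Trω x)

    split-injective : Injective split
    split-injective {x} {y} eq = cancelˡ 2≢0 (begin
      2# * x                                ≡⟨ double x ⟩
      Tr x + (x + - conj x)                 ≡⟨ cong₂ _+_ (position-injective (cong proj₁ eq))
                                                 (cancelˡ ω≢0 (position-injective (cong proj₂ eq))) ⟩
      Tr y + (y + - conj y)                 ≡⟨ double y ⟨
      2# * y                                ∎)
      where
      open ≡-Reasoning
      double : ∀ x → 2# * x ≡ Tr x + (x + - conj x)
      double x = trans (2#* x) (solve 2 (λ x y → x :+ x := x :+ y :+ (x :+ :- y)) refl x (conj x))

    q≤fixed : q ℕ.≤ length fixed
    q≤fixed = ℕₚ.≮⇒≥ (λ lt → ℕₚ.<⇒≱ (ℕₚ.*-mono-< lt lt)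
      (injection⇒≤ enum (fin ⊗ fin) split split-injective))

  -- In the counts GF(q) only indexes domains of maps, so q distinct fixed elements are what they
  -- draw on.
  scalar : Fin q → Carrier
  scalar i = Family.at fixed-family (Fin.inject≤ i q≤fixed)

  scalar-injective : Injective scalar
  scalar-injective eq = Finₚ.inject≤-injective q≤fixed q≤fixed _ _ (Family.at-injective fixed-family eq)

  conj-scalar : ∀ i → conj (scalar i) ≡ scalar i
  conj-scalar i = Family.satisfies fixed-family (Fin.inject≤ i q≤fixed)

-- The vector space F⁴ and counting in it

module Space (q : ℕ) (opp : OddPrimePower q) (F : FiniteField (q ℕ.* q)) where
  open Geometry F q public
  open QuadraticExtension q opp F public

  n N : ℕ
  n = q ℕ.* q
  N = n ℕ.* (n ℕ.* (n ℕ.* n))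

  infix 4 _≐_
  infixl 6 _⊕_
  infixr 7 _·_

  _≐_ : Vec4 → Vec4 → Set
  u ≐ v = ∀ i → u i ≡ v i

  _⊕_ : Vec4 → Vec4 → Vec4
  (u ⊕ v) i = u i + v i

  _·_ : Carrier → Vec4 → Vec4
  (a · u) i = a * u i

  ≐-refl : ∀ {u} → u ≐ u
  ≐-refl i = refl

  ≐-sym : ∀ {u v} → u ≐ v → v ≐ u
  ≐-sym e i = sym (e i)

  ≐-trans : ∀ {u v w} → u ≐ v → v ≐ w → u ≐ w
  ≐-trans e f i = trans (e i) (f i)

  ⊕-cancelʳ : ∀ {u v w z} → u ⊕ w ≐ v ⊕ z → w ≐ z → u ≐ v
  ⊕-cancelʳ {u} {v} {w} {z} e f i = begin
    u i                  ≡⟨ solve 2 (λ u w → u := u :+ w :- w) refl (u i) (w i) ⟩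
    u i + w i + - w i    ≡⟨ cong₂ (λ a b → a + - b) (e i) (f i) ⟩
    v i + z i + - z i    ≡⟨ solve 2 (λ u w → u :+ w :- w := u) refl (v i) (z i) ⟩
    v i                  ∎
    where open ≡-Reasoning

  ·-cancel : ∀ {a u v} → a ≢ 0# → a · u ≐ a · v → u ≐ v
  ·-cancel a≢0 e i = cancelˡ a≢0 (e i)

  ⊕-move : ∀ {u v w a b} → u ⊕ a · w ≐ v ⊕ b · w → v ≐ u ⊕ (a + - b) · w
  ⊕-move {u} {v} {w} {a} {b} e i = begin
    v i                             ≡⟨ solve 2 (λ v x → v := v :+ x :- x) refl (v i) (b * w i) ⟩
    v i + b * w i + - (b * w i)     ≡⟨ cong (_+ - (b * w i)) (e i) ⟨
    u i + a * w i + - (b * w i)     ≡⟨ solve 4 (λ u a b w → u :+ a :* w :- b :* w := u :+ (a :- b) :* w)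
                                         refl (u i) a b (w i) ⟩
    u i + (a + - b) * w i           ∎
    where open ≡-Reasoning

  tuple : Vec4 → Carrier × (Carrier × (Carrier × Carrier))
  tuple v = v f0 , v f1 , v f2 , v f3

  abstract
    tuples↔ : (Carrier × (Carrier × (Carrier × Carrier))) ↔ Fin N
    tuples↔ = enum ⊗ enum ⊗ enum ⊗ enum

  untuple : Carrier × (Carrier × (Carrier × Carrier)) → Vec4
  untuple (a , b , c , d) = vec4 a b c d

  tuple-cong : ∀ {u v} → u ≐ v → tuple u ≡ tuple v
  tuple-cong e = cong₂ _,_ (e f0) (cong₂ _,_ (e f1) (cong₂ _,_ (e f2) (e f3)))

  tuple-injective : ∀ {u v} → tuple u ≡ tuple v → u ≐ v
  tuple-injective e zero = cong proj₁ e
  tuple-injective e (suc zero) = cong (proj₁ ∘ proj₂) e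
  tuple-injective e (suc (suc zero)) = cong (proj₁ ∘ proj₂ ∘ proj₂) e
  tuple-injective e (suc (suc (suc zero))) = cong (proj₂ ∘ proj₂ ∘ proj₂) e

  -- Pigeonhole on the q⁸ vectors. It replaces rank arguments: it yields the vector representing a
  -- linear functional, and later the coordinates in the normal basis.
  vec-injective⇒surjective : (f : Vec4 → Vec4) →
    (∀ {u v} → f u ≐ f v → u ≐ v) → ∀ y → ∃ λ x → f x ≐ y
  vec-injective⇒surjective f f-inj y = decode (proj₁ x) ,
    tuple-injective (trans (sym (Inverse.strictlyInverseʳ tuples↔ _))
      (trans (cong (Inverse.from tuples↔) (proj₂ x)) (Inverse.strictlyInverseʳ tuples↔ (tuple y))))
    where
    decode : Fin N → Vec4
    decode = untuple ∘ Inverse.from tuples↔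
    g : Fin N → Fin N
    g = Inverse.to tuples↔ ∘ tuple ∘ f ∘ decode
    g-inj : Injective g
    g-inj {i} {j} eq = trans (sym (Inverse.strictlyInverseˡ tuples↔ i))
      (trans (cong (Inverse.to tuples↔) (tuple-cong (f-inj (tuple-injective (to-injective tuples↔ eq)))))
        (Inverse.strictlyInverseˡ tuples↔ j))
    x : ∃ λ i → g i ≡ Inverse.to tuples↔ (tuple y)
    x = injective⇒surjective g g-inj (Inverse.to tuples↔ (tuple y))

  -- Introduces q² - 1 as the `m` with n = 1 + m, so that the counts never subtract.
  nonzero-index : Σ ℕ λ m → (n ≡ suc m) × Σ (∀ x → x ≢ 0# → Fin m) λ f →
                  ∀ {x y} {x≢0 : x ≢ 0#} {y≢0 : y ≢ 0#} → f x x≢0 ≡ f y y≢0 → x ≡ y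
  nonzero-index = go enum
    where
    go : ∀ {n} → Carrier ↔ Fin n → Σ ℕ λ m → (n ≡ suc m) × Σ (∀ x → x ≢ 0# → Fin m) λ f →
         ∀ {x y} {x≢0 : x ≢ 0#} {y≢0 : y ≢ 0#} → f x x≢0 ≡ f y y≢0 → x ≡ y
    go {zero} α with () ← Inverse.to α 0#
    go {suc m} α = m , refl ,
      (λ x x≢0 → Fin.punchOut {i = Inverse.to α 0#} {j = Inverse.to α x} (x≢0 ∘ sym ∘ to-injective α)) ,
      λ {_} {_} {a} {b} eq → to-injective α
        (Finₚ.punchOut-injective (a ∘ sym ∘ to-injective α) (b ∘ sym ∘ to-injective α) eq)

  ε : Fin 4 → Vec4
  ε zero = vec4 1# 0# 0# 0#
  ε (suc zero) = vec4 0# 1# 0# 0#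
  ε (suc (suc zero)) = vec4 0# 0# 1# 0#
  ε (suc (suc (suc zero))) = vec4 0# 0# 0# 1#

  ε-span : ∀ x → x ≐ x f0 · ε f0 ⊕ x f1 · ε f1 ⊕ x f2 · ε f2 ⊕ x f3 · ε f3
  ε-span x zero = sym (begin
    x f0 * 1# + x f1 * 0# + x f2 * 0# + x f3 * 0#
      ≡⟨ cong₂ _+_ (cong₂ _+_ (cong₂ _+_ (*-identityʳ _) (zeroʳ _)) (zeroʳ _)) (zeroʳ _) ⟩
    x f0 + 0# + 0# + 0#  ≡⟨ trans (+-identityʳ _) (trans (+-identityʳ _) (+-identityʳ _)) ⟩
    x f0 ∎)
    where open ≡-Reasoning
  ε-span x (suc zero) = sym (begin
    x f0 * 0# + x f1 * 1# + x f2 * 0# + x f3 * 0#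
      ≡⟨ cong₂ _+_ (cong₂ _+_ (cong₂ _+_ (zeroʳ _) (*-identityʳ _)) (zeroʳ _)) (zeroʳ _) ⟩
    0# + x f1 + 0# + 0#  ≡⟨ trans (+-identityʳ _) (trans (+-identityʳ _) (+-identityˡ _)) ⟩
    x f1 ∎)
    where open ≡-Reasoning
  ε-span x (suc (suc zero)) = sym (begin
    x f0 * 0# + x f1 * 0# + x f2 * 1# + x f3 * 0#
      ≡⟨ cong₂ _+_ (cong₂ _+_ (cong₂ _+_ (zeroʳ _) (zeroʳ _)) (*-identityʳ _)) (zeroʳ _) ⟩
    0# + 0# + x f2 + 0#  ≡⟨ trans (+-identityʳ _) (trans (cong (_+ x f2) (+-identityˡ _)) (+-identityˡ _)) ⟩
    x f2 ∎)
    where open ≡-Reasoning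
  ε-span x (suc (suc (suc zero))) = sym (begin
    x f0 * 0# + x f1 * 0# + x f2 * 0# + x f3 * 1#
      ≡⟨ cong₂ _+_ (cong₂ _+_ (cong₂ _+_ (zeroʳ _) (zeroʳ _)) (zeroʳ _)) (*-identityʳ _) ⟩
    0# + 0# + 0# + x f3  ≡⟨ trans (cong (_+ x f3) (trans (+-identityʳ _) (+-identityʳ _))) (+-identityˡ _) ⟩
    x f3 ∎)
    where open ≡-Reasoning

  record Linear (f : Vec4 → Carrier) : Set where
    field
      f-cong : ∀ {u v} → u ≐ v → f u ≡ f v
      f-⊕ : ∀ u v → f (u ⊕ v) ≡ f u + f v
      f-· : ∀ a u → f (a · u) ≡ a * f u

    expand : ∀ x → f x ≡ x f0 * f (ε f0) + x f1 * f (ε f1) + x f2 * f (ε f2) + x f3 * f (ε f3)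
    expand x = trans (f-cong (ε-span x)) (trans (f-⊕ _ _) (cong₂ _+_ (trans (f-⊕ _ _)
      (cong₂ _+_ (trans (f-⊕ _ _) (cong₂ _+_ (f-· _ _) (f-· _ _))) (f-· _ _))) (f-· _ _)))

  linear-ext : ∀ {f g} → Linear f → Linear g → (∀ i → f (ε i) ≡ g (ε i)) → ∀ x → f x ≡ g x
  linear-ext {f} {g} F G e x = trans (Linear.expand F x) (trans
    (cong₂ _+_ (cong₂ _+_ (cong₂ _+_ (cong (x f0 *_) (e f0)) (cong (x f1 *_) (e f1)))
      (cong (x f2 *_) (e f2))) (cong (x f3 *_) (e f3)))
    (sym (Linear.expand G x)))

  -- (i, t, d) ↦ w i + κ t p + E d is at most two-to-one, because a line in the direction p
  -- carries at most two zeros of the form, and it misses all ℓ r + E d.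
  quadratic-cone-bound :
    ∀ {D M R : Set} {δ m ρ n′ a : ℕ} → D ↔ Fin δ → M ↔ Fin m → R ↔ Fin ρ →
    (K : Vec4 → Set) (p : Vec4) (E : D → Vec4) (κ : M → Carrier) (ℓ : R → Vec4)
    (w : Fin a → Vec4) (tg : Fin a → Fin n′) (β : Fin a → Carrier) (g : Carrier) →
    Injective κ → g ≢ 0# →
    (∀ i t → K (w i ⊕ κ t · p)) → (∀ r → K (ℓ r)) →
    (∀ {u v d d′} → K u → K v → u ⊕ E d ≐ v ⊕ E d′ → d ≡ d′) →
    (∀ {i j} → w i ≐ w j → tg i ≡ tg j → i ≡ j) →
    (∀ {r s} → ℓ r ≐ ℓ s → r ≡ s) →
    (∀ i t r → ¬ (w i ⊕ κ t · p ≐ ℓ r)) →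
    (∀ i j t t′ → w j ≐ w i ⊕ (κ t + - κ t′) · p → (κ t + - κ t′) * (β i + (κ t + - κ t′) * g) ≡ 0#) →
    a ℕ.* (m ℕ.* δ) ℕ.+ (ρ ℕ.* (δ ℕ.* n′)) ℕ.* 2 ℕ.≤ (N ℕ.* n′) ℕ.* 2
  quadratic-cone-bound {D} {M} {R} {a = a} Δ μ ϱ K p E κ ℓ w tg β g κ-inj g≢0 K-w K-ℓ sep w-inj ℓ-inj miss quad =
    two-to-one (fin ⊗ μ ⊗ Δ) (ϱ ⊗ Δ ⊗ fin) (tuples↔ ⊗ fin) f h two h-inj disj
    where
    T = Carrier × (Carrier × (Carrier × Carrier))
    f : Fin a × (M × D) → T × Fin _
    f (i , t , d) = tuple ((w i ⊕ κ t · p) ⊕ E d) , tg i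
    h : R × (D × Fin _) → T × Fin _
    h (r , d , x) = tuple (ℓ r ⊕ E d) , x
    peel : ∀ {u v d d′} → K u → K v → u ⊕ E d ≐ v ⊕ E d′ → (d ≡ d′) × (u ≐ v)
    peel {d = d} {d′} ku kv e with refl ← sep {d = d} {d′} ku kv e = refl , ⊕-cancelʳ {w = E d} e ≐-refl
    -- Two distinct points of a fibre have the same `d`, and their vectors `w` differ by τ p with τ
    -- ≠ 0. By `quad` this τ is the root of β + τ g, and since g ≠ 0 there is only one such root;
    -- hence at most one further point.
    second : ∀ {i t d j t′ d′} → f (i , t , d) ≡ f (j , t′ , d′) → (i , t , d) ≢ (j , t′ , d′) →
             (d ≡ d′) × (w j ≐ w i ⊕ (κ t + - κ t′) · p) × (β i + (κ t + - κ t′) * g ≡ 0#)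
    second {i} {t} {d} {j} {t′} {d′} eq ne
      with peel {d = d} {d′} (K-w i t) (K-w j t′) (tuple-injective (cong proj₁ eq))
    ... | refl , e with (κ t + - κ t′) ≟ 0#
    ...   | no τ≢0 = refl , ⊕-move e , zero-product τ≢0 (quad i j t t′ (⊕-move e))
    ...   | yes τ≡0 with refl ← κ-inj (difference≡0 τ≡0) =
      ⊥-elim (ne (cong (_, t , d) (w-inj (⊕-cancelʳ {w = κ t · p} e ≐-refl) (cong proj₂ eq))))
    two : AtMostTwo f
    two {i , t , d} {j , t′ , d′} {k , t″ , d″} e₁ e₂ n₁ n₂
      with second {i} {t} {d} {j} {t′} {d′} e₁ n₁ | second {i} {t} {d} {k} {t″} {d″} e₂ n₂
    ... | refl , wj , root₁ | refl , wk , root₂ with κ-inj κ≡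
      where
      open ≡-Reasoning
      κ≡ : κ t′ ≡ κ t″
      κ≡ = begin
        κ t′                     ≡⟨ solve 2 (λ x y → y := x :- (x :- y)) refl (κ t) (κ t′) ⟩
        κ t + - (κ t + - κ t′)   ≡⟨ cong (λ z → κ t + - z) (cancelˡ g≢0 (begin
          g * (κ t + - κ t′)     ≡⟨ solve 3 (λ b g τ → g :* τ := b :+ τ :* g :- b) refl (β i) g (κ t + - κ t′) ⟩
          β i + (κ t + - κ t′) * g + - β i  ≡⟨ cong (_+ - β i) (trans root₁ (sym root₂)) ⟩
          β i + (κ t + - κ t″) * g + - β i  ≡⟨ solve 3 (λ b g τ → b :+ τ :* g :- b := g :* τ) refl (β i) g (κ t + - κ t″) ⟩
          g * (κ t + - κ t″)     ∎)) ⟩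
        κ t + - (κ t + - κ t″)   ≡⟨ solve 2 (λ x y → x :- (x :- y) := y) refl (κ t) (κ t″) ⟩
        κ t″                     ∎
    ... | refl = cong (_, t′ , d) (w-inj (≐-trans wj (≐-sym wk)) (trans (sym (cong proj₂ e₁)) (cong proj₂ e₂)))
    h-inj : Injective h
    h-inj {r , d , x} {s , d′ , y} eq
      with peel {d = d} {d′} (K-ℓ r) (K-ℓ s) (tuple-injective (cong proj₁ eq)) | cong proj₂ eq
    ... | refl , e | refl = cong (_, d , x) (ℓ-inj e)
    disj : ∀ x y → f x ≢ h y
    disj (i , t , d) (r , d′ , x) eq =
      miss i t r (proj₂ (peel {d = d} {d′} (K-w i t) (K-ℓ r) (tuple-injective (cong proj₁ eq))))

-- A symmetric and a Hermitian form, and the GF(q)-quadratic form `G`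

module Forms (q : ℕ) (opp : OddPrimePower q) (F : FiniteField (q ℕ.* q)) where
  open Space q opp F public

  -- Only h is assumed nondegenerate; nondegeneracy of B is part of what is to be shown.
  record FormPair : Set where
    field
      B h : Vec4 → Vec4 → Carrier
      B-cong : ∀ {u u′ v v′} → u ≐ u′ → v ≐ v′ → B u v ≡ B u′ v′
      B-⊕ˡ : ∀ u v w → B (u ⊕ v) w ≡ B u w + B v w
      B-·ˡ : ∀ a u w → B (a · u) w ≡ a * B u w
      B-sym : ∀ u v → B u v ≡ B v u
      h-cong : ∀ {u u′ v v′} → u ≐ u′ → v ≐ v′ → h u v ≡ h u′ v′
      h-⊕ˡ : ∀ u v w → h (u ⊕ v) w ≡ h u w + h v w
      h-·ˡ : ∀ a u w → h (a · u) w ≡ a * h u w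
      h-conj : ∀ u v → h v u ≡ conj (h u v)
      h-nondegenerate : ∀ x → (∀ y → h y x ≡ 0#) → IsZero x

  module FormTheory (forms : FormPair) where
    open FormPair forms public

    B-⊕ʳ : ∀ w u v → B w (u ⊕ v) ≡ B w u + B w v
    B-⊕ʳ w u v = trans (B-sym _ _) (trans (B-⊕ˡ u v w) (cong₂ _+_ (B-sym u w) (B-sym v w)))

    B-·ʳ : ∀ a w u → B w (a · u) ≡ a * B w u
    B-·ʳ a w u = trans (B-sym _ _) (trans (B-·ˡ a u w) (cong (a *_) (B-sym u w)))

    h-⊕ʳ : ∀ w u v → h w (u ⊕ v) ≡ h w u + h w v
    h-⊕ʳ w u v = trans (h-conj (u ⊕ v) w) (trans (cong conj (h-⊕ˡ u v w))
      (trans (conj-+ _ _) (sym (cong₂ _+_ (h-conj u w) (h-conj v w)))))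

    h-·ʳ : ∀ a w u → h w (a · u) ≡ conj a * h w u
    h-·ʳ a w u = trans (h-conj (a · u) w) (trans (cong conj (h-·ˡ a u w))
      (trans (conj-* _ _) (cong (conj a *_) (sym (h-conj u w)))))

    conj-H : ∀ u → conj (h u u) ≡ h u u
    conj-H u = sym (h-conj u u)

    h-flip : ∀ {u v a} → h u v ≡ a → h v u ≡ conj a
    h-flip {u} {v} eq = trans (h-conj u v) (cong conj eq)

    h-flip0 : ∀ {u v} → h u v ≡ 0# → h v u ≡ 0#
    h-flip0 eq = trans (h-flip eq) conj-0

    h-flip1 : ∀ {u v} → h u v ≡ 1# → h v u ≡ 1#
    h-flip1 eq = trans (h-flip eq) conj-1

    h-linear : ∀ v → Linear (λ u → h u v)
    h-linear v = record { f-cong = λ e → h-cong e ≐-refl ; f-⊕ = λ u w → h-⊕ˡ u w v ; f-· = λ a u → h-·ˡ a u v }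

    B-linear : ∀ v → Linear (λ u → B u v)
    B-linear v = record { f-cong = λ e → B-cong e ≐-refl ; f-⊕ = λ u w → B-⊕ˡ u w v ; f-· = λ a u → B-·ˡ a u v }

    h-separates : ∀ {u v} → (∀ x → h x u ≡ h x v) → u ≐ v
    h-separates {u} {v} e i = difference≡0 (trans
      (solve 2 (λ u v → u :- v := u :+ con (ℤ.- pos 1) :* v) refl (u i) (v i))
      (h-nondegenerate (u ⊕ minus · v) zero-on i))
      where
      minus : Carrier
      -- The solver literal -1 denotes exactly this term.
      minus = - (1# + 0#)
      zero-on : ∀ y → h y (u ⊕ minus · v) ≡ 0#
      zero-on y = begin
        h y (u ⊕ minus · v)             ≡⟨ h-⊕ʳ y u (minus · v) ⟩
        h y u + h y (minus · v)         ≡⟨ cong₂ _+_ (e y) (h-·ʳ minus y v) ⟩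
        h y v + conj minus * h y v      ≡⟨ cong (λ z → h y v + z * h y v) (trans (conj-neg _)
                                              (cong -_ (trans (cong conj (+-identityʳ 1#)) (trans conj-1 (sym (+-identityʳ 1#)))))) ⟩
        h y v + minus * h y v           ≡⟨ solve 1 (λ x → x :+ con (ℤ.- pos 1) :* x := con (pos 0)) refl (h y v) ⟩
        0#                              ∎
        where open ≡-Reasoning

    h-separates-ε : ∀ {u v} → (∀ i → h (ε i) u ≡ h (ε i) v) → u ≐ v
    h-separates-ε {u} {v} e = h-separates (linear-ext (h-linear u) (h-linear v) e)

    -- An injective map of the finite set of vectors to itself is onto.
    represent : ∀ {f} → Linear f → ∃ λ c → ∀ x → h x c ≡ f x
    represent {f} lin = proj₁ c , linear-ext (h-linear (proj₁ c)) lin (proj₂ c)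
      where
      c = vec-injective⇒surjective (λ v i → h (ε i) v) (λ {u} {v} → h-separates-ε {u} {v}) (λ i → f (ε i))

    G : Vec4 → Carrier
    G u = (h u u + h u u) + - Tr (B u u)

    G-cong : ∀ {u v} → u ≐ v → G u ≡ G v
    G-cong e = cong₂ (λ a b → (a + a) + - Tr b) (h-cong e e) (B-cong e e)

    Q-⊕· : ∀ u t v → B (u ⊕ t · v) (u ⊕ t · v) ≡ B u u + t * ((B u v + B u v) + t * B v v)
    Q-⊕· u t v
      rewrite B-⊕ˡ u (t · v) (u ⊕ t · v) | B-·ˡ t v (u ⊕ t · v) | B-⊕ʳ u u (t · v) | B-⊕ʳ v u (t · v)
            | B-·ʳ t u v | B-·ʳ t v v | B-sym v u =
      solve 4 (λ uu uv vv t → uu :+ t :* uv :+ t :* (uv :+ t :* vv) := uu :+ t :* (uv :+ uv :+ t :* vv))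
        refl (B u u) (B u v) (B v v) t

    H-⊕· : ∀ u t v → h (u ⊕ t · v) (u ⊕ t · v) ≡
           h u u + (conj t * h u v + t * h v u) + t * conj t * h v v
    H-⊕· u t v
      rewrite h-⊕ˡ u (t · v) (u ⊕ t · v) | h-·ˡ t v (u ⊕ t · v) | h-⊕ʳ u u (t · v) | h-⊕ʳ v u (t · v)
            | h-·ʳ t u v | h-·ʳ t v v =
      solve 6 (λ uu uv vu vv t t̄ → uu :+ t̄ :* uv :+ t :* (vu :+ t̄ :* vv)
          := uu :+ (t̄ :* uv :+ t :* vu) :+ t :* t̄ :* vv)
        refl (h u u) (h u v) (h v u) (h v v) t (conj t)

    Q-· : ∀ t v → B (t · v) (t · v) ≡ t * t * B v v
    Q-· t v = trans (B-·ˡ t v (t · v)) (trans (cong (t *_) (B-·ʳ t v v)) (sym (*-assoc _ _ _)))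

    H-· : ∀ t v → h (t · v) (t · v) ≡ t * conj t * h v v
    H-· t v = trans (h-·ˡ t v (t · v)) (trans (cong (t *_) (h-·ʳ t v v)) (sym (*-assoc _ _ _)))

    -- The polar form of `G`. The expansion that follows requires t in GF(q), since `G` is not
    -- quadratic over F.
    GB : Vec4 → Vec4 → Carrier
    GB u v = (h u v + h v u + (h u v + h v u)) + - Tr (B u v + B u v)

    G-⊕· : ∀ u t v → conj t ≡ t → G (u ⊕ t · v) ≡ G u + t * (GB u v + t * G v)
    G-⊕· u t v real = begin
      G (u ⊕ t · v)
        ≡⟨ cong₂ (λ a b → (a + a) + - Tr b) (H-⊕· u t v) (Q-⊕· u t v) ⟩
      (X + X) + - (Y + conj Y)
        ≡⟨ cong (λ z → (X + X) + - (Y + z)) conjY ⟩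
      (X + X) + - (Y + (conj uu + t * ((conj uv + conj uv) + t * conj vv)))
        ≡⟨ cong (λ z → let X = h u u + (z * h u v + t * h v u) + t * z * h v v in
                 (X + X) + - (Y + (conj uu + t * ((conj uv + conj uv) + t * conj vv)))) real ⟩
      _ ≡⟨ solve 11 (λ t huu huv hvu hvv uu uv vv uu′ uv′ vv′ →
             let X = huu :+ (t :* huv :+ t :* hvu) :+ t :* t :* hvv in
             (X :+ X) :- ((uu :+ t :* ((uv :+ uv) :+ t :* vv)) :+ (uu′ :+ t :* ((uv′ :+ uv′) :+ t :* vv′)))
             := ((huu :+ huu) :- (uu :+ uu′)) :+ t :* (((huv :+ hvu :+ (huv :+ hvu)) :- ((uv :+ uv) :+ (uv′ :+ uv′)))
                :+ t :* ((hvv :+ hvv) :- (vv :+ vv′))))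
             refl t (h u u) (h u v) (h v u) (h v v) uu uv vv (conj uu) (conj uv) (conj vv) ⟩
      G u + t * ((h u v + h v u + (h u v + h v u)) + - ((uv + uv) + (conj uv + conj uv)) + t * G v)
        ≡⟨ cong (λ z → G u + t * ((h u v + h v u + (h u v + h v u)) + - ((uv + uv) + z) + t * G v)) (conj-+ uv uv) ⟨
      G u + t * (GB u v + t * G v) ∎
      where
      open ≡-Reasoning
      uu = B u u
      uv = B u v
      vv = B v v
      X = h u u + (conj t * h u v + t * h v u) + t * conj t * h v v
      Y = uu + t * ((uv + uv) + t * vv)
      conjY : conj Y ≡ conj uu + t * ((conj uv + conj uv) + t * conj vv)
      conjY = trans (conj-+ _ _) (cong (conj uu +_) (trans (conj-* _ _) (cong₂ _*_ real
        (trans (conj-+ _ _) (cong₂ _+_ (conj-+ _ _) (trans (conj-* _ _) (cong (_* conj vv) real)))))))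

    G-· : ∀ t v → conj t ≡ t → G (t · v) ≡ t * t * G v
    G-· t v real = begin
      G (t · v)
        ≡⟨ cong₂ (λ a b → (a + a) + - Tr b) (H-· t v) (Q-· t v) ⟩
      (t * conj t * h v v + t * conj t * h v v) + - (t * t * B v v + conj (t * t * B v v))
        ≡⟨ cong₂ (λ a b → (t * a * h v v + t * a * h v v) + - (t * t * B v v + b)) real
             (trans (conj-* _ _) (cong (_* conj (B v v)) (trans (conj-* _ _) (cong₂ _*_ real real)))) ⟩
      (t * t * h v v + t * t * h v v) + - (t * t * B v v + t * t * conj (B v v))
        ≡⟨ solve 4 (λ t hv b b′ → (t :* t :* hv :+ t :* t :* hv) :- (t :* t :* b :+ t :* t :* b′)
             := t :* t :* ((hv :+ hv) :- (b :+ b′))) refl t (h v v) (B v v) (conj (B v v)) ⟩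
      t * t * G v ∎
      where open ≡-Reasoning

-- The intersection within the common tangent plane

module Tangency (q : ℕ) (opp : OddPrimePower q) (F : FiniteField (q ℕ.* q))
    (forms : Forms.FormPair q opp F) (P : Geometry.Vec4 F q) where
  open Forms q opp F public
  open FormTheory forms public

  h-⊕·ˡ : ∀ u a v w → h (u ⊕ a · v) w ≡ h u w + a * h v w
  h-⊕·ˡ u a v w = trans (h-⊕ˡ u (a · v) w) (cong (h u w +_) (h-·ˡ a v w))

  B-⊕·ˡ : ∀ u a v w → B (u ⊕ a · v) w ≡ B u w + a * B v w
  B-⊕·ˡ u a v w = trans (B-⊕ˡ u (a · v) w) (cong (B u w +_) (B-·ˡ a v w))

  square≡0 : ∀ {t g} → g ≢ 0# → t * t * g ≡ 0# → t ≡ 0#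
  square≡0 {t} g≢0 eq with integral {t * t} eq
  ... | inj₂ g≡0 = contradiction g≡0 g≢0
  ... | inj₁ tt≡0 with integral {t} tt≡0
  ...   | inj₁ e = e
  ...   | inj₂ e = e

  nonzero⇒h≢0 : ∀ {c} → ¬ IsZero c → ∃ λ i → h (ε i) c ≢ 0#
  nonzero⇒h≢0 {c} c≢0 = Finₚ.¬∀⟶∃¬ 4 (λ i → h (ε i) c ≡ 0#) (λ i → h (ε i) c ≟ 0#)
    (λ all → c≢0 (h-nondegenerate c (λ y → trans (Linear.expand (h-linear c) y) (begin
      y f0 * h (ε f0) c + y f1 * h (ε f1) c + y f2 * h (ε f2) c + y f3 * h (ε f3) c
        ≡⟨ trans (+0* (all f3)) (trans (+0* (all f2)) (+0* (all f1))) ⟩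
      y f0 * h (ε f0) c ≡⟨ cong (y f0 *_) (all f0) ⟩
      y f0 * 0# ≡⟨ zeroʳ _ ⟩
      0# ∎))))
    where open ≡-Reasoning

  module TangentCount
    (HP : h P P ≡ 0#) (QP : B P P ≡ 0#) (BP : ∀ x → B x P ≡ h x P)
    (R₀ : Vec4) (hR₀P : h R₀ P ≡ 1#) where

    -- v is a multiple of P. Since h(P,R₀) = 1 the coefficient must be h(v,R₀), which makes the
    -- condition decidable.
    OnP : Vec4 → Set
    OnP v = v ≐ h v R₀ · P

    hPR₀ : h P R₀ ≡ 1#
    hPR₀ = h-flip1 hR₀P

    onP-bound : ∀ {a} → Family _≐_ (λ v → ¬ IsZero v × OnP v) a → a ℕ.+ 1 ℕ.≤ n
    onP-bound {a} fam = injection⇒≤ (fin ⊞ ⊤↔Fin1) enum f f-inj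
      where
      open Family fam
      f : Fin a ⊎ ⊤ → Carrier
      f (inj₁ i) = h (at i) R₀
      f (inj₂ _) = 0#
      f≢0 : ∀ i → h (at i) R₀ ≢ 0#
      f≢0 i eq = proj₁ (satisfies i) λ j →
        trans (proj₂ (satisfies i) j) (trans (cong (_* P j) eq) (zeroˡ _))
      f-inj : Injective f
      f-inj {inj₁ i} {inj₁ j} eq = cong inj₁ (at-injective λ k →
        trans (proj₂ (satisfies i) k) (trans (cong (_* P k) eq) (sym (proj₂ (satisfies j) k))))
      f-inj {inj₁ i} {inj₂ _} eq = contradiction eq (f≢0 i)
      f-inj {inj₂ _} {inj₁ j} eq = contradiction (sym eq) (f≢0 j)
      f-inj {inj₂ _} {inj₂ _} eq = refl

    -- A line in direction p carries at most two zeros of Q, because Q(p) ≠ 0. In the plane spanned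
    -- by P and p one has Q(xP + yp) = y² Q(p), so its only zeros are multiples of P, which are
    -- excluded; its n² vectors are the missed ones. Multiples of R₀ complement the tangent plane.
    tangent-bound : ∀ {a} → Family _≐_ (λ v → B v v ≡ 0# × h v P ≡ 0# × ¬ OnP v) a →
      ∀ p → h p P ≡ 0# → B p p ≢ 0# →
      a ℕ.* (n ℕ.* n) ℕ.+ ((n ℕ.* n) ℕ.* (n ℕ.* 1)) ℕ.* 2 ℕ.≤ (N ℕ.* 1) ℕ.* 2
    tangent-bound {a} fam p hpP Qp≢0 =
      quadratic-cone-bound enum enum (enum ⊗ enum)
        (λ u → h u P ≡ 0#) p (_· R₀) (λ t → t) ℓ at (λ _ → zero) (λ i → B (at i) p + B (at i) p) (B p p)
        (λ e → e) Qp≢0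
        (λ i t → trans (h-⊕·ˡ (at i) t p P) (trans (+0* hpP) (hvP i)))
        Kℓ
        (λ {u} {v} {d} {d′} ku kv e → trans (sym (0+*1 ku hR₀P)) (trans (sym (h-⊕·ˡ u d R₀ P))
          (trans (h-cong e ≐-refl) (trans (h-⊕·ˡ v d′ R₀ P) (0+*1 kv hR₀P)))))
        (λ e _ → at-injective e)
        (λ {r} {s} → ℓ-inj {r} {s})
        miss
        quad
      where
      open Family fam
      Qv : ∀ i → B (at i) (at i) ≡ 0#
      Qv i = proj₁ (satisfies i)
      hvP : ∀ i → h (at i) P ≡ 0#
      hvP i = proj₁ (proj₂ (satisfies i))
      ℓ : Carrier × Carrier → Vec4
      ℓ (x , y) = x · P ⊕ y · p
      BPp : B P p ≡ 0#
      BPp = trans (B-sym P p) (trans (BP p) hpP)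
      Kℓ : ∀ r → h (ℓ r) P ≡ 0#
      Kℓ (x , y) = trans (h-⊕·ˡ (x · P) y p P) (trans (+0* hpP)
        (trans (h-·ˡ x P P) (*0 HP)))
      Bℓp : ∀ x y → B (ℓ (x , y)) p ≡ B p p * y
      Bℓp x y = trans (B-⊕·ˡ (x · P) y p p) (trans (cong (_+ y * B p p)
        (trans (B-·ˡ x P p) (*0 BPp))) (trans (+-identityˡ _) (*-comm _ _)))
      ℓ-inj : ∀ {r s} → ℓ r ≐ ℓ s → r ≡ s
      ℓ-inj {x , y} {x′ , y′} e = cong₂ _,_ x≡x′ y≡y′
        where
        y≡y′ : y ≡ y′
        y≡y′ = cancelˡ Qp≢0 (trans (sym (Bℓp x y)) (trans (B-cong e ≐-refl) (Bℓp x′ y′)))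
        xP : x · P ≐ x′ · P
        xP = ⊕-cancelʳ {w = y · p} {z = y′ · p} e (λ i → cong (_* p i) y≡y′)
        coefficient : ∀ x → h (x · P) R₀ ≡ x
        coefficient x = trans (h-·ˡ x P R₀) (trans (cong (x *_) hPR₀) (*-identityʳ x))
        x≡x′ : x ≡ x′
        x≡x′ = trans (sym (coefficient x)) (trans (h-cong xP ≐-refl) (coefficient x′))
      miss : ∀ i t r → ¬ (at i ⊕ t · p ≐ ℓ r)
      miss i t (x , y) e = proj₂ (proj₂ (satisfies i)) on
        where
        v = at i
        v≐ : v ≐ x · P ⊕ (y + - t) · p
        v≐ = ⊕-move {x · P} {v} {p} {y} {t} (≐-sym {v ⊕ t · p} {ℓ (x , y)} e)
        τ≡0 : y + - t ≡ 0#
        τ≡0 = square≡0 Qp≢0 (begin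
          (y + - t) * (y + - t) * B p p
            ≡⟨ solve 3 (λ o τ g → τ :* τ :* g := o :+ τ :* (o :+ o :+ τ :* g) :- (o :+ τ :* (o :+ o))) refl 0# (y + - t) (B p p) ⟩
          0# + τ * ((0# + 0#) + τ * B p p) + - (0# + τ * (0# + 0#))
            ≡⟨ cong₂ (λ a b → a + τ * ((b + b) + τ * B p p) + - (0# + τ * (0# + 0#)))
                 (trans (trans (Q-· x P) (cong (x * x *_) QP)) (zeroʳ _)) (trans (B-·ˡ x P p) (*0 BPp)) ⟨
          B (x · P) (x · P) + τ * ((B (x · P) p + B (x · P) p) + τ * B p p) + - (0# + τ * (0# + 0#))
            ≡⟨ cong (_+ - (0# + τ * (0# + 0#))) (Q-⊕· (x · P) τ p) ⟨
          B (x · P ⊕ τ · p) (x · P ⊕ τ · p) + - (0# + τ * (0# + 0#))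
            ≡⟨ cong (_+ - (0# + τ * (0# + 0#))) (trans (sym (B-cong v≐ v≐)) (Qv i)) ⟩
          0# + - (0# + τ * (0# + 0#))
            ≡⟨ solve 1 (λ τ → con (pos 0) :- (con (pos 0) :+ τ :* (con (pos 0) :+ con (pos 0))) := con (pos 0)) refl τ ⟩
          0# ∎)
          where
          open ≡-Reasoning
          τ = y + - t
        v≐xP : v ≐ x · P
        v≐xP j = trans (v≐ j) (trans (cong (λ τ → x * P j + τ * p j) τ≡0)
          (trans (cong (x * P j +_) (zeroˡ _)) (+-identityʳ _)))
        on : OnP v
        on j = trans (v≐xP j) (cong (_* P j) (sym (trans (h-cong v≐xP ≐-refl)
          (trans (h-·ˡ x P R₀) (trans (cong (x *_) hPR₀) (*-identityʳ x))))))
      quad : ∀ i j t t′ → at j ≐ at i ⊕ (t + - t′) · p →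
             (t + - t′) * ((B (at i) p + B (at i) p) + (t + - t′) * B p p) ≡ 0#
      quad i j t t′ e = begin
        τ * ((B (at i) p + B (at i) p) + τ * B p p)                       ≡⟨ +-identityˡ _ ⟨
        0# + τ * ((B (at i) p + B (at i) p) + τ * B p p)                  ≡⟨ cong (_+ τ * ((B (at i) p + B (at i) p) + τ * B p p)) (Qv i) ⟨
        B (at i) (at i) + τ * ((B (at i) p + B (at i) p) + τ * B p p)     ≡⟨ Q-⊕· (at i) τ p ⟨
        B (at i ⊕ τ · p) (at i ⊕ τ · p)                                   ≡⟨ B-cong e e ⟨
        B (at j) (at j)                                                   ≡⟨ Qv j ⟩
        0#                                                                ∎
        where
        open ≡-Reasoning
        τ = t + - t′

-- Points off the tangent plane: singular points and projection from a point R

module AffineCount (q : ℕ) (opp : OddPrimePower q) (F : FiniteField (q ℕ.* q))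
    (forms : Forms.FormPair q opp F) (P : Geometry.Vec4 F q) where
  open Tangency q opp F forms P public

  -- Points off the tangent plane, normalised by h(v,P) = 1; the tag remembers the scalar factor.
  record Chart (a m : ℕ) : Set where
    field
      pt : Fin a → Vec4
      tg : Fin a → Fin m
      pt-injective : ∀ {i j} → pt i ≐ pt j → tg i ≡ tg j → i ≡ j
      pt-P : ∀ i → h (pt i) P ≡ 1#
      pt-H : ∀ i → h (pt i) (pt i) ≡ 0#
      pt-Q : ∀ i → B (pt i) (pt i) ≡ 0#

  chart : ∀ {a} → Family _≐_ (λ v → h v v ≡ 0# × B v v ≡ 0# × h v P ≢ 0#) a →
          ∃ λ m → (n ≡ suc m) × Chart a m
  chart {a} fam = m , proj₁ (proj₂ nonzero-index) , record
    { pt = λ i → s i · at i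
    ; tg = λ i → index (h (at i) P) (hP≢0 i)
    ; pt-injective = λ {i} {j} e t → at-injective (back i j e (index-inj t))
    ; pt-P = λ i → trans (h-·ˡ (s i) (at i) P) (recip-* (hP≢0 i))
    ; pt-H = λ i → trans (H-· (s i) (at i)) (*0 (proj₁ (satisfies i)))
    ; pt-Q = λ i → trans (Q-· (s i) (at i)) (*0 (proj₁ (proj₂ (satisfies i))))
    }
    where
    open Family fam
    m = proj₁ nonzero-index
    index = proj₁ (proj₂ (proj₂ nonzero-index))
    index-inj : ∀ {x y} {x≢0 : x ≢ 0#} {y≢0 : y ≢ 0#} → index x x≢0 ≡ index y y≢0 → x ≡ y
    index-inj = proj₂ (proj₂ (proj₂ nonzero-index))
    hP≢0 : ∀ i → h (at i) P ≢ 0#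
    hP≢0 i = proj₂ (proj₂ (satisfies i))
    s : Fin a → Carrier
    s i = recip (hP≢0 i)
    back : ∀ i j → s i · at i ≐ s j · at j → h (at i) P ≡ h (at j) P → at i ≐ at j
    back i j e f = ·-cancel (recip≢0 (hP≢0 i)) (λ k → trans (e k) (cong (_* at j k) (sym s≡)))
      where
      s≡ : s i ≡ s j
      s≡ = cancelˡ (hP≢0 i) (trans (*-recip (hP≢0 i)) (trans (sym (*-recip (hP≢0 j))) (cong (_* s j) (sym f))))

  -- Vectors on which both forms induce the same functional form a GF(q)-subspace that meets
  -- its ω-multiple trivially.
  singular-bound : ∀ {a m} (ch : Chart a m) → let open Chart ch in
    (R₀ : Vec4) → h R₀ P ≡ 1# → (∀ i x → h x (pt i) ≡ B x (pt i)) →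
    (a ℕ.* a) ℕ.* n ℕ.≤ N ℕ.* (m ℕ.* m)
  singular-bound {a} {m} ch R₀ hR₀P same =
    injection⇒≤ ((fin ⊗ fin) ⊗ enum) (tuples↔ ⊗ fin ⊗ fin) f f-inj
    where
    open Chart ch
    f : (Fin a × Fin a) × Carrier → (Carrier × (Carrier × (Carrier × Carrier))) × (Fin m × Fin m)
    f ((i , j) , t) = tuple ((pt i ⊕ ω · pt j) ⊕ t · R₀) , tg i , tg j
    hfP : ∀ i j t → h ((pt i ⊕ ω · pt j) ⊕ t · R₀) P ≡ (1# + ω) + t
    hfP i j t = trans (h-⊕·ˡ _ t R₀ P) (cong₂ _+_
      (trans (h-⊕·ˡ (pt i) ω (pt j) P) (cong₂ _+_ (pt-P i) (trans (cong (ω *_) (pt-P j)) (*-identityʳ ω))))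
      (trans (cong (t *_) hR₀P) (*-identityʳ t)))
    f-inj : Injective f
    f-inj {(i , j) , t} {(i′ , j′) , t′} eq = cong₂ _,_ (cong₂ _,_ i≡ j≡) t≡
      where
      open ≡-Reasoning
      e₀ : (pt i ⊕ ω · pt j) ⊕ t · R₀ ≐ (pt i′ ⊕ ω · pt j′) ⊕ t′ · R₀
      e₀ = tuple-injective (cong proj₁ eq)
      t≡ : t ≡ t′
      t≡ = begin
        t                           ≡⟨ solve 2 (λ o t → t := o :+ t :- o) refl (1# + ω) t ⟩
        (1# + ω) + t + - (1# + ω)   ≡⟨ cong (_+ - (1# + ω)) (trans (sym (hfP i j t)) (trans (h-cong e₀ ≐-refl) (hfP i′ j′ t′))) ⟩
        (1# + ω) + t′ + - (1# + ω)  ≡⟨ solve 2 (λ o t → o :+ t :- o := t) refl (1# + ω) t′ ⟩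
        t′                          ∎
      e : pt i ⊕ ω · pt j ≐ pt i′ ⊕ ω · pt j′
      e = ⊕-cancelʳ {w = t · R₀} {z = t′ · R₀} e₀ (λ k → cong (_* R₀ k) t≡)
      hx : ∀ x k l → h x (pt k ⊕ ω · pt l) ≡ h x (pt k) + - ω * h x (pt l)
      hx x k l = trans (h-⊕ʳ x (pt k) (ω · pt l)) (cong (h x (pt k) +_)
        (trans (h-·ʳ ω x (pt l)) (cong (_* h x (pt l)) conj-ω)))
      Bx : ∀ x k l → B x (pt k ⊕ ω · pt l) ≡ h x (pt k) + ω * h x (pt l)
      Bx x k l = trans (B-⊕ʳ x (pt k) (ω · pt l)) (cong₂ _+_ (sym (same k x))
        (trans (B-·ʳ ω x (pt l)) (cong (ω *_) (sym (same l x)))))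
      -- h is conjugate-linear in its second argument and B is linear there, so the ω-terms have
      -- opposite signs and the sum of the two forms isolates `pt k`.
      double : ∀ x k l → h x (pt k ⊕ ω · pt l) + B x (pt k ⊕ ω · pt l) ≡ 2# * h x (pt k)
      double x k l = begin
        h x (pt k ⊕ ω · pt l) + B x (pt k ⊕ ω · pt l)  ≡⟨ cong₂ _+_ (hx x k l) (Bx x k l) ⟩
        (h x (pt k) + - ω * h x (pt l)) + (h x (pt k) + ω * h x (pt l))
          ≡⟨ solve 3 (λ a o b → (a :+ :- o :* b) :+ (a :+ o :* b) := a :+ a) refl (h x (pt k)) ω (h x (pt l)) ⟩
        h x (pt k) + h x (pt k)                        ≡⟨ 2#* (h x (pt k)) ⟨
        2# * h x (pt k)                                ∎
      pti : pt i ≐ pt i′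
      pti = h-separates (λ x → cancelˡ 2≢0 (trans (sym (double x i j))
        (trans (cong₂ _+_ (h-cong ≐-refl e) (B-cong ≐-refl e)) (double x i′ j′))))
      i≡ : i ≡ i′
      i≡ = pt-injective pti (cong (proj₁ ∘ proj₂) eq)
      ptj : pt j ≐ pt j′
      ptj = ·-cancel ω≢0 (⊕-cancelʳ {ω · pt j} {ω · pt j′} {pt i} {pt i′}
        (λ k → trans (+-comm _ _) (trans (e k) (+-comm _ _))) pti)
      j≡ : j ≡ j′
      j≡ = pt-injective ptj (cong (proj₂ ∘ proj₂) eq)

  -- `c` represents through h the difference of the two polar functionals at R. It is orthogonal to
  -- P and R, and it is zero exactly when R is singular: it is the gradient at R of the affine
  -- quadric.
  module Nonsingular
    (HP : h P P ≡ 0#) (QP : B P P ≡ 0#) (BP : ∀ x → B x P ≡ h x P)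
    (R : Vec4) (hRP : h R P ≡ 1#) (HR : h R R ≡ 0#) (QR : B R R ≡ 0#)
    (c : Vec4) (hc : ∀ x → h x c ≡ B x R + - h x R) where

    hPR : h P R ≡ 1#
    hPR = h-flip1 hRP

    BPR : B P R ≡ 1#
    BPR = trans (B-sym P R) (trans (BP R) hRP)

    hPc : h P c ≡ 0#
    hPc = trans (hc P) (trans (cong₂ (λ a b → a + - b) BPR hPR) (-‿inverseʳ 1#))

    hRc : h R c ≡ 0#
    hRc = trans (hc R) (trans (cong₂ (λ a b → a + - b) QR HR) (-‿inverseʳ 0#))

    BxR : ∀ x → B x R ≡ h x c + h x R
    BxR x = trans (solve 2 (λ b k → b := b :- k :+ k) refl (B x R) (h x R)) (cong (_+ h x R) (sym (hc x)))

    -- The h-orthogonal projection onto W, the orthogonal space of the hyperbolic pair P, R.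
    proj : Vec4 → Vec4
    proj x = (x ⊕ (- h x P) · R) ⊕ (- h x R) · P

    proj-P : ∀ x → h (proj x) P ≡ 0#
    proj-P x = begin
      h (proj x) P                                   ≡⟨ trans (h-⊕·ˡ _ (- h x R) P P) (+0* HP) ⟩
      h (x ⊕ (- h x P) · R) P                        ≡⟨ h-⊕·ˡ x (- h x P) R P ⟩
      h x P + - h x P * h R P                        ≡⟨ cong (λ z → h x P + - h x P * z) hRP ⟩
      h x P + - h x P * 1#                           ≡⟨ cong (h x P +_) (*-identityʳ _) ⟩
      h x P + - h x P                                ≡⟨ -‿inverseʳ _ ⟩
      0#                                             ∎
      where open ≡-Reasoning

    proj-R : ∀ x → h (proj x) R ≡ 0#
    proj-R x = begin
      h (proj x) R                                   ≡⟨ h-⊕·ˡ _ (- h x R) P R ⟩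
      h (x ⊕ (- h x P) · R) R + - h x R * h P R      ≡⟨ cong₂ (λ a b → a + - h x R * b) (trans (h-⊕·ˡ x (- h x P) R R) (+0* HR)) hPR ⟩
      h x R + - h x R * 1#                           ≡⟨ cong (h x R +_) (*-identityʳ _) ⟩
      h x R + - h x R                                ≡⟨ -‿inverseʳ _ ⟩
      0#                                             ∎
      where open ≡-Reasoning

    proj-⊥ : ∀ {z} → h P z ≡ 0# → h R z ≡ 0# → ∀ x → h (proj x) z ≡ h x z
    proj-⊥ {z} hPz hRz x = trans (h-⊕·ˡ _ (- h x R) P z) (trans (+0* hPz)
      (trans (h-⊕·ˡ x (- h x P) R z) (+0* hRz)))

    proj-c : ∀ x → h (proj x) c ≡ h x c
    proj-c = proj-⊥ hPc hRc

    module _ {x : Vec4} (hxP : h x P ≡ 1#) (Hx : h x x ≡ 0#) (Qx : B x x ≡ 0#) where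
      private
        open ≡-Reasoning
        s = - h x P
        t = h x R
        u = x ⊕ s · R
        s≡ : s ≡ - 1#
        s≡ = cong -_ hxP
        conj-s : conj s ≡ - 1#
        conj-s = trans (cong conj s≡) (trans (conj-neg 1#) (cong -_ conj-1))
        huP : h u P ≡ 0#
        huP = trans (h-⊕·ˡ x s R P) (trans (cong₂ (λ a b → a + b * h R P) hxP s≡)
          (trans (cong (λ z → 1# + - 1# * z) hRP) (trans (cong (1# +_) (*-identityʳ _)) (-‿inverseʳ 1#))))

      proj-H : h (proj x) (proj x) ≡ - Tr (h x R)
      proj-H = begin
        h (proj x) (proj x)
          ≡⟨ H-⊕· u (- t) P ⟩
        h u u + (conj (- t) * h u P + - t * h P u) + - t * conj (- t) * h P P
          ≡⟨ trans (+0* HP) (trans (cong (h u u +_) (trans (cong₂ (λ a b → conj (- t) * a + - t * b) huP (h-flip0 huP))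
               (trans (cong₂ _+_ (zeroʳ _) (zeroʳ _)) (+-identityˡ 0#)))) (+-identityʳ _)) ⟩
        h u u
          ≡⟨ H-⊕· x s R ⟩
        h x x + (conj s * t + s * h R x) + s * conj s * h R R
          ≡⟨ trans (+0* HR) (trans (cong (_+ (conj s * t + s * h R x)) Hx) (+-identityˡ _)) ⟩
        conj s * t + s * h R x
          ≡⟨ cong₂ _+_ (cong (_* t) conj-s) (cong₂ _*_ s≡ (h-conj x R)) ⟩
        - 1# * t + - 1# * conj t
          ≡⟨ solve 3 (λ o t t̄ → :- o :* t :+ :- o :* t̄ := :- (o :* (t :+ t̄))) refl 1# t (conj t) ⟩
        - (1# * Tr t)
          ≡⟨ cong -_ (*-identityˡ _) ⟩
        - Tr t ∎

      proj-Q : B (proj x) (proj x) ≡ - (B x R + B x R)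
      proj-Q = begin
        B (proj x) (proj x)
          ≡⟨ Q-⊕· u (- t) P ⟩
        B u u + - t * ((B u P + B u P) + - t * B P P)
          ≡⟨ cong (λ z → B u u + - t * z) (trans (+0* QP) (trans (cong (λ z → z + z) (trans (BP u) huP)) (+-identityˡ 0#))) ⟩
        B u u + - t * 0#
          ≡⟨ +0* refl ⟩
        B u u
          ≡⟨ Q-⊕· x s R ⟩
        B x x + s * ((B x R + B x R) + s * B R R)
          ≡⟨ cong₂ (λ a b → a + s * b) Qx (+0* QR) ⟩
        0# + s * (B x R + B x R)
          ≡⟨ trans (+-identityˡ _) (cong (_* (B x R + B x R)) s≡) ⟩
        - 1# * (B x R + B x R)
          ≡⟨ solve 2 (λ o b → :- o :* b := :- (o :* b)) refl 1# (B x R + B x R) ⟩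
        - (1# * (B x R + B x R))
          ≡⟨ cong -_ (*-identityˡ _) ⟩
        - (B x R + B x R) ∎

      -- The equation of the affine quadric with origin at R. The two values -Tr h(x,R) and -2B(x,R)
      -- are combined in `G`; substituting B(x,R) = h(x,c) + h(x,R) cancels h(x,R) and leaves the
      -- linear part 2 Tr h(·,c).
      proj-G : G (proj x) ≡ Tr (h (proj x) c) + Tr (h (proj x) c)
      proj-G = begin
        G (proj x)
          ≡⟨ cong₂ (λ a b → (a + a) + - Tr b) proj-H (trans proj-Q (cong (λ z → - (z + z)) (BxR x))) ⟩
        (- Tr t + - Tr t) + - Tr (- ((y + t) + (y + t)))
          ≡⟨ cong (λ z → (- Tr t + - Tr t) + - (- ((y + t) + (y + t)) + z))
               (trans (conj-neg _) (cong -_ (trans (conj-+ _ _) (cong₂ _+_ (conj-+ y t) (conj-+ y t))))) ⟩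
        (- (t + conj t) + - (t + conj t)) + - (- ((y + t) + (y + t)) + - ((conj y + conj t) + (conj y + conj t)))
          ≡⟨ solve 4 (λ t t̄ y ȳ → (:- (t :+ t̄) :+ :- (t :+ t̄)) :+ :- (:- ((y :+ t) :+ (y :+ t)) :+ :- ((ȳ :+ t̄) :+ (ȳ :+ t̄)))
               := (y :+ ȳ) :+ (y :+ ȳ)) refl t (conj t) y (conj y) ⟩
        Tr y + Tr y
          ≡⟨ cong (λ z → Tr z + Tr z) (proj-c x) ⟨
        Tr (h (proj x) c) + Tr (h (proj x) c) ∎
        where y = h x c

    -- The coordinate dropped by the projection is recoverable: Q(proj x) gives B(x,R), the value
    -- h(x,c) survives the projection, and their difference is h(x,R).
    proj-injective : ∀ {x y} → h x P ≡ 1# → h x x ≡ 0# → B x x ≡ 0# → h y P ≡ 1# → h y y ≡ 0# → B y y ≡ 0# →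
                     proj x ≐ proj y → x ≐ y
    proj-injective {x} {y} xP Hx Qx yP Hy Qy e =
      ⊕-cancelʳ {x} {y} (⊕-cancelʳ {w = (- h x R) · P} e (λ i → cong (λ z → - z * P i) t≡))
        (λ i → cong (λ z → - z * R i) (trans xP (sym yP)))
      where
      open ≡-Reasoning
      B≡ : B x R ≡ B y R
      B≡ = cancelˡ 2≢0 (begin
        2# * B x R                     ≡⟨ twice (B x R) ⟩
        - (- (B x R + B x R))          ≡⟨ cong -_ (proj-Q xP Hx Qx) ⟨
        - B (proj x) (proj x)          ≡⟨ cong -_ (B-cong e e) ⟩
        - B (proj y) (proj y)          ≡⟨ cong -_ (proj-Q yP Hy Qy) ⟩
        - (- (B y R + B y R))          ≡⟨ twice (B y R) ⟨
        2# * B y R                     ∎)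
        where
        twice : ∀ b → 2# * b ≡ - (- (b + b))
        twice b = trans (2#* b) (solve 1 (λ b → b := :- (:- b)) refl (b + b))
      c≡ : h x c ≡ h y c
      c≡ = trans (sym (proj-c x)) (trans (h-cong e ≐-refl) (proj-c y))
      t≡ : h x R ≡ h y R
      t≡ = begin
        h x R              ≡⟨ solve 2 (λ c r → r := c :+ r :- c) refl (h x c) (h x R) ⟩
        h x c + h x R + - h x c ≡⟨ cong₂ (λ a b → a + - b) (trans (sym (BxR x)) (trans B≡ (BxR y))) c≡ ⟩
        h y c + h y R + - h y c ≡⟨ solve 2 (λ c r → c :+ r :- c := r) refl (h y c) (h y R) ⟩
        h y R              ∎

-- Counting the affine quadric from a nonsingular point

module NonsingularCount (q : ℕ) (opp : OddPrimePower q) (F : FiniteField (q ℕ.* q))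
    (forms : Forms.FormPair q opp F) (P : Geometry.Vec4 F q) where
  open AffineCount q opp F forms P public

  module Transversal
    (HP : h P P ≡ 0#) (QP : B P P ≡ 0#) (BP : ∀ x → B x P ≡ h x P)
    (R : Vec4) (hRP : h R P ≡ 1#) (HR : h R R ≡ 0#) (QR : B R R ≡ 0#)
    (c : Vec4) (hc : ∀ x → h x c ≡ B x R + - h x R)
    (e : Vec4) (heP : h e P ≡ 0#) (heR : h e R ≡ 0#) (hec : h e c ≡ 1#) where
    open Nonsingular HP QP BP R hRP HR QR c hc public

    D : Set
    D = Carrier × (Carrier × Fin q)

    D↔ : D ↔ Fin (n ℕ.* (n ℕ.* q))
    D↔ = enum ⊗ enum ⊗ fin

    -- Translations that turn counts in the trace-zero hyperplane K of W into counts in F⁴: K has q³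
    -- elements and `D` has q⁵. P and R complement W, and GF(q)-multiples of e complement K in W.
    E : D → Vec4
    E (x , y , s) = (x · P ⊕ y · R) ⊕ scalar s · e

    hE : ∀ x y s z → h (E (x , y , s)) z ≡ (x * h P z + y * h R z) + scalar s * h e z
    hE x y s z = trans (h-⊕·ˡ _ (scalar s) e z) (cong (_+ scalar s * h e z)
      (trans (h-⊕·ˡ (x · P) y R z) (cong (_+ y * h R z) (h-·ˡ x P z))))

    hE-R : ∀ x y s → h (E (x , y , s)) R ≡ x
    hE-R x y s = trans (hE x y s R) (trans (+0* heR) (trans (+0* HR) (trans (cong (x *_) hPR) (*-identityʳ x))))

    hE-P : ∀ x y s → h (E (x , y , s)) P ≡ y
    hE-P x y s = trans (hE x y s P) (trans (+0* heP)
      (0+*1 (*0 HP) hRP))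

    hE-c : ∀ x y s → h (E (x , y , s)) c ≡ scalar s
    hE-c x y s = trans (hE x y s c) (0+*1 (trans (+0* hRc) (*0 hPc)) hec)

    Tr-h-⊕E : ∀ u x y s → Tr (h (u ⊕ E (x , y , s)) c) ≡ Tr (h u c) + 2# * scalar s
    Tr-h-⊕E u x y s = begin
      Tr (h (u ⊕ E (x , y , s)) c)        ≡⟨ cong Tr (trans (h-⊕ˡ u _ c) (cong (h u c +_) (hE-c x y s))) ⟩
      (k + r) + conj (k + r)              ≡⟨ cong ((k + r) +_) (trans (conj-+ k r) (cong (conj k +_) (conj-scalar s))) ⟩
      (k + r) + (conj k + r)              ≡⟨ solve 3 (λ k k̄ r → (k :+ r) :+ (k̄ :+ r) := (k :+ k̄) :+ (r :+ r)) refl k (conj k) r ⟩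
      Tr k + (r + r)                      ≡⟨ cong (Tr k +_) (2#* r) ⟨
      Tr k + 2# * r                       ∎
      where
      open ≡-Reasoning
      k = h u c
      r = scalar s

    -- The coefficients of P and R are read off by h(·,R) and h(·,P). For that of e only the trace
    -- of h(·,c) is available, because u and v are controlled by their traces alone; it suffices as
    -- s is in GF(q) and 2 ≠ 0.
    E-separates : ∀ {u v} d d′ → h u P ≡ 0# → h v P ≡ 0# → h u R ≡ 0# → h v R ≡ 0# →
                  Tr (h u c) ≡ Tr (h v c) → u ⊕ E d ≐ v ⊕ E d′ → d ≡ d′
    E-separates {u} {v} (x , y , s) (x′ , y′ , s′) uP vP uR vR uv eq =
      cong₂ _,_ x≡ (cong₂ _,_ y≡ (scalar-injective s≡))
      where
      along : ∀ {u z d a} → h u z ≡ 0# → h (E d) z ≡ a → h (u ⊕ E d) z ≡ a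
      along {u} {z} {d} p r = trans (h-⊕ˡ u (E d) z) (trans (cong₂ _+_ p r) (+-identityˡ _))
      x≡ : x ≡ x′
      x≡ = trans (sym (along uR (hE-R x y s))) (trans (h-cong eq ≐-refl) (along vR (hE-R x′ y′ s′)))
      y≡ : y ≡ y′
      y≡ = trans (sym (along uP (hE-P x y s))) (trans (h-cong eq ≐-refl) (along vP (hE-P x′ y′ s′)))
      s≡ : scalar s ≡ scalar s′
      s≡ = cancelˡ 2≢0 (begin
        2# * scalar s                                     ≡⟨ solve 2 (λ a b → b := a :+ b :- a) refl (Tr (h u c)) (2# * scalar s) ⟩
        Tr (h u c) + 2# * scalar s + - Tr (h u c)         ≡⟨ cong₂ (λ a b → a + - b) (trans (sym (Tr-h-⊕E u x y s))
                                                               (trans (cong Tr (h-cong eq ≐-refl)) (Tr-h-⊕E v x′ y′ s′))) uv ⟩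
        Tr (h v c) + 2# * scalar s′ + - Tr (h v c)        ≡⟨ solve 2 (λ a b → a :+ b :- a := b) refl (Tr (h v c)) (2# * scalar s′) ⟩
        2# * scalar s′                                    ∎)
        where open ≡-Reasoning

    module Bounds {a m : ℕ} (ch : Chart a m) where
      open Chart ch

      w : Fin a → Vec4
      w i = proj (pt i)

      w-injective : ∀ {i j} → w i ≐ w j → tg i ≡ tg j → i ≡ j
      w-injective {i} {j} eq =
        pt-injective (proj-injective (pt-P i) (pt-H i) (pt-Q i) (pt-P j) (pt-H j) (pt-Q j) eq)

      tr : Fin a → Carrier
      tr i = Tr (h (w i) c)

      w-G : ∀ i → G (w i) ≡ tr i + tr i
      w-G i = proj-G (pt-P i) (pt-H i) (pt-Q i)

      -- Every GF(q)-line through the origin of W on which the trace does not vanish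
      -- carries at most one candidate.
      secant-bound : ∀ {b} → Family _≡_ (λ i → tr i ≢ 0#) b → b ℕ.* (n ℕ.* (n ℕ.* q)) ℕ.≤ N ℕ.* m
      secant-bound {b} fam = injection⇒≤ (fin ⊗ D↔) (tuples↔ ⊗ fin) f f-inj
        where
        open Family fam
        s : Fin b → Carrier
        s j = recip (satisfies j)
        u : Fin b → Vec4
        u j = s j · w (at j)
        conj-s : ∀ j → conj (s j) ≡ s j
        conj-s j = cancelˡ (satisfies j) (begin
          tr (at j) * conj (s j)            ≡⟨ cong (_* conj (s j)) (conj-Tr _) ⟨
          conj (tr (at j)) * conj (s j)     ≡⟨ conj-* _ _ ⟨
          conj (tr (at j) * s j)            ≡⟨ cong conj (*-recip (satisfies j)) ⟩
          conj 1#                           ≡⟨ conj-1 ⟩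
          1#                                ≡⟨ *-recip (satisfies j) ⟨
          tr (at j) * s j                   ∎)
          where open ≡-Reasoning
        hu : ∀ j z → h (w (at j)) z ≡ 0# → h (u j) z ≡ 0#
        hu j z p = trans (h-·ˡ (s j) (w (at j)) z) (*0 p)
        Tr-u : ∀ j → Tr (h (u j) c) ≡ 1#
        Tr-u j = begin
          Tr (h (u j) c)                         ≡⟨ cong Tr (h-·ˡ (s j) (w (at j)) c) ⟩
          s j * k + conj (s j * k)               ≡⟨ cong (s j * k +_) (trans (conj-* _ _) (cong (_* conj k) (conj-s j))) ⟩
          s j * k + s j * conj k                 ≡⟨ distribˡ _ _ _ ⟨
          s j * tr (at j)                        ≡⟨ recip-* (satisfies j) ⟩
          1#                                     ∎
          where
          open ≡-Reasoning
          k = h (w (at j)) c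
        -- With G(w) = 2 tr and u = w / tr, the scalar is recovered from the normalised vector as tr
        -- = 2 / G(u). So the line determines its candidate.
        G-u : ∀ j → tr (at j) * G (u j) ≡ 2#
        G-u j = begin
          tr (at j) * G (u j)                            ≡⟨ cong (tr (at j) *_) (trans (G-· (s j) (w (at j)) (conj-s j)) (cong (s j * s j *_) (w-G (at j)))) ⟩
          tr (at j) * (s j * s j * (tr (at j) + tr (at j))) ≡⟨ solve 2 (λ t s → t :* (s :* s :* (t :+ t)) := (t :* s) :* (t :* s) :+ (t :* s) :* (t :* s)) refl (tr (at j)) (s j) ⟩
          (tr (at j) * s j) * (tr (at j) * s j) + (tr (at j) * s j) * (tr (at j) * s j) ≡⟨ cong (λ z → z * z + z * z) (*-recip (satisfies j)) ⟩
          1# * 1# + 1# * 1#                              ≡⟨ cong₂ _+_ (*-identityˡ 1#) (*-identityˡ 1#) ⟩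
          2#                                             ∎
          where open ≡-Reasoning
        f : Fin b × D → (Carrier × (Carrier × (Carrier × Carrier))) × Fin m
        f (j , d) = tuple (u j ⊕ E d) , tg (at j)
        f-inj : Injective f
        f-inj {j , d} {j′ , d′} eq = cong₂ _,_ (at-injective (w-injective w≐ (cong proj₂ eq))) d≡
          where
          e₀ : u j ⊕ E d ≐ u j′ ⊕ E d′
          e₀ = tuple-injective (cong proj₁ eq)
          d≡ : d ≡ d′
          d≡ = E-separates d d′ (hu j P (proj-P _)) (hu j′ P (proj-P _)) (hu j R (proj-R _)) (hu j′ R (proj-R _))
            (trans (Tr-u j) (sym (Tr-u j′))) e₀
          u≐ : u j ≐ u j′
          u≐ = ⊕-cancelʳ {w = E d} {z = E d′} e₀ (λ i → cong (λ d → E d i) d≡)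
          G≢0 : G (u j) ≢ 0#
          G≢0 p = 2≢0 (trans (sym (G-u j)) (*0 p))
          tr≡ : tr (at j) ≡ tr (at j′)
          tr≡ = cancelˡ G≢0 (trans (*-comm _ _) (trans (G-u j) (trans (sym (G-u j′))
            (trans (cong (tr (at j′) *_) (sym (G-cong u≐))) (*-comm _ _)))))
          w≡ : ∀ j k → w (at j) k ≡ tr (at j) * u j k
          w≡ j k = sym (trans (sym (*-assoc _ _ _)) (trans (cong (_* w (at j) k) (*-recip (satisfies j))) (*-identityˡ _)))
          w≐ : w (at j) ≐ w (at j′)
          w≐ k = trans (w≡ j k) (trans (cong₂ _*_ tr≡ (u≐ k)) (sym (w≡ j′ k)))

      -- By injectivity of the projection at most one normalised point has projection 0, and the
      -- tags distinguish at most m vectors over it.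
      centre-bound : ∀ {b} → Family _≡_ (λ i → IsZero (w i)) b → b ℕ.≤ m
      centre-bound fam = Finₚ.injective⇒≤ {f = tg ∘ at}
        (λ eq → at-injective (w-injective (λ k → trans (satisfies _ k) (sym (satisfies _ k))) eq))
        where open Family fam

      InK : Vec4 → Set
      InK u = (h u P ≡ 0#) × (h u R ≡ 0#) × (Tr (h u c) ≡ 0#)

      -- On K the equation becomes G(w) = 0, a quadratic cone over GF(q). The line of p through the
      -- origin meets it only in 0, as G(rp) = r² G(p), and 0 is excluded; its q vectors are the
      -- missed ones and supply the subtracted term.
      tangent-hyperplane-bound : ∀ {b} → Family _≡_ (λ i → tr i ≡ 0# × ¬ IsZero (w i)) b →
        ∀ p → InK p → G p ≢ 0# →
        b ℕ.* (q ℕ.* (n ℕ.* (n ℕ.* q))) ℕ.+ (q ℕ.* ((n ℕ.* (n ℕ.* q)) ℕ.* m)) ℕ.* 2 ℕ.≤ (N ℕ.* m) ℕ.* 2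
      tangent-hyperplane-bound {b} fam p (pP , pR , pc) Gp≢0 =
        quadratic-cone-bound D↔ fin fin InK p E scalar (λ r → scalar r · p)
          (w ∘ at) (tg ∘ at) (λ i → GB (w (at i)) p) (G p)
          scalar-injective Gp≢0 Kw Kℓ
          (λ {u} {v} {d} {d′} (uP , uR , uc) (vP , vR , vc) → E-separates d d′ uP vP uR vR (trans uc (sym vc)))
          (λ e t → at-injective (w-injective e t))
          ℓ-inj miss quad
        where
        open Family fam
        Tr-· : ∀ r z → Tr (scalar r * z) ≡ scalar r * Tr z
        Tr-· r z = trans (cong (scalar r * z +_) (trans (conj-* _ _) (cong (_* conj z) (conj-scalar r)))) (sym (distribˡ _ _ _))
        Tr-+ : ∀ x y → Tr (x + y) ≡ Tr x + Tr y
        Tr-+ x y = trans (cong ((x + y) +_) (conj-+ x y))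
          (solve 4 (λ x y x̄ ȳ → (x :+ y) :+ (x̄ :+ ȳ) := (x :+ x̄) :+ (y :+ ȳ)) refl x y (conj x) (conj y))
        Kℓ : ∀ r → InK (scalar r · p)
        Kℓ r = trans (h-·ˡ _ p P) (*0 pP) ,
               trans (h-·ˡ _ p R) (*0 pR) ,
               trans (cong Tr (h-·ˡ _ p c)) (trans (Tr-· r _) (*0 pc))
        Kw : ∀ i t → InK (w (at i) ⊕ scalar t · p)
        Kw i t = trans (h-⊕ˡ _ _ P) (trans (cong₂ _+_ (proj-P _) (proj₁ (Kℓ t))) (+-identityˡ _)) ,
                 trans (h-⊕ˡ _ _ R) (trans (cong₂ _+_ (proj-R _) (proj₁ (proj₂ (Kℓ t)))) (+-identityˡ _)) ,
                 trans (cong Tr (h-⊕ˡ _ _ c)) (trans (Tr-+ _ _)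
                   (trans (cong₂ _+_ (proj₁ (satisfies i)) (proj₂ (proj₂ (Kℓ t)))) (+-identityˡ _)))
        Gw : ∀ i → G (w (at i)) ≡ 0#
        Gw i = trans (w-G (at i)) (trans (cong (λ z → z + z) (proj₁ (satisfies i))) (+-identityˡ 0#))
        conj-τ : ∀ t t′ → conj (scalar t + - scalar t′) ≡ scalar t + - scalar t′
        conj-τ t t′ = trans (conj-+ _ _) (cong₂ _+_ (conj-scalar t) (trans (conj-neg _) (cong -_ (conj-scalar t′))))
        G0 : ∀ {u} → IsZero u → G u ≡ 0#
        G0 {u} z = trans (G-cong {u} {0# · u} (λ i → trans (z i) (sym (zeroˡ _))))
          (trans (G-· 0# u conj-0) (trans (cong (_* G u) (zeroˡ 0#)) (zeroˡ _)))
        on-line : ∀ {v} t t′ → v ≐ (scalar t + - scalar t′) · p → G v ≡ 0# → scalar t + - scalar t′ ≡ 0#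
        on-line t t′ v≐ Gv = square≡0 Gp≢0 (trans (sym (G-· _ p (conj-τ t t′))) (trans (sym (G-cong v≐)) Gv))
        ℓ-inj : ∀ {r s} → scalar r · p ≐ scalar s · p → r ≡ s
        ℓ-inj {r} {s} eq = scalar-injective (difference≡0 (on-line {λ _ → 0#} r s
          (λ i → sym (trans (distribʳ (p i) _ _) (trans (cong (_+ - scalar s * p i) (eq i))
            (solve 2 (λ s x → s :* x :+ :- s :* x := con (pos 0)) refl (scalar s) (p i))))) (G0 (λ _ → refl))))
        miss : ∀ i t r → ¬ (w (at i) ⊕ scalar t · p ≐ scalar r · p)
        miss i t r eq = proj₂ (satisfies i) (λ k → trans (w≐ k) (trans (cong (_* p k) (on-line r t w≐ (Gw i))) (zeroˡ _)))
          where
          w≐ : w (at i) ≐ (scalar r + - scalar t) · p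
          w≐ k = begin
            w (at i) k                                       ≡⟨ solve 2 (λ a b → a := a :+ b :- b) refl (w (at i) k) (scalar t * p k) ⟩
            w (at i) k + scalar t * p k + - (scalar t * p k) ≡⟨ cong (_+ - (scalar t * p k)) (eq k) ⟩
            scalar r * p k + - (scalar t * p k)              ≡⟨ solve 3 (λ r t x → r :* x :- t :* x := (r :- t) :* x) refl (scalar r) (scalar t) (p k) ⟩
            (scalar r + - scalar t) * p k                    ∎
            where open ≡-Reasoning
        quad : ∀ i j t t′ → w (at j) ≐ w (at i) ⊕ (scalar t + - scalar t′) · p →
               (scalar t + - scalar t′) * (GB (w (at i)) p + (scalar t + - scalar t′) * G p) ≡ 0#
        quad i j t t′ eq = begin
          τ * (GB (w (at i)) p + τ * G p)                  ≡⟨ +-identityˡ _ ⟨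
          0# + τ * (GB (w (at i)) p + τ * G p)             ≡⟨ cong (_+ τ * (GB (w (at i)) p + τ * G p)) (Gw i) ⟨
          G (w (at i)) + τ * (GB (w (at i)) p + τ * G p)   ≡⟨ G-⊕· (w (at i)) τ p (conj-τ t t′) ⟨
          G (w (at i) ⊕ τ · p)                             ≡⟨ G-cong eq ⟨
          G (w (at j))                                     ≡⟨ Gw j ⟩
          0#                                               ∎
          where
          open ≡-Reasoning
          τ = scalar t + - scalar t′

-- Numerical estimates

module Estimates (q m : ℕ) (3≤q : 3 ℕ.≤ q) (q²≡1+m : q ℕ.* q ≡ suc m) where
  open import Data.Nat using (_+_; _*_; _≤_; _^_; _∸_)
  open +-*-Solver

  private
    n = q * q
    -- q³ points, each counted with its q² - 1 vectors.
    c = q * (q * q) * m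

    0<m : 0 ℕ.< m
    0<m = ℕ.s≤s⁻¹ (subst (2 ≤_) q²≡1+m (ℕₚ.≤-trans (ℕ.s≤s (ℕ.s≤s ℕ.z≤n)) (ℕₚ.*-mono-≤ 3≤q 3≤q)))

    instance
      q≢0 : ℕ.NonZero q
      q≢0 = ℕ.>-nonZero (ℕₚ.<-≤-trans ℕ.z<s 3≤q)
      m≢0 : ℕ.NonZero m
      m≢0 = ℕ.>-nonZero 0<m
      n≢0 : ℕ.NonZero n
      n≢0 = ℕₚ.m*n≢0 q q

    3nm≤c : 3 * (n * m) ≤ c
    3nm≤c = subst (3 * (n * m) ≤_) (sym (ℕₚ.*-assoc q n m)) (ℕₚ.*-monoˡ-≤ (n * m) 3≤q)

  tangent-estimate : ∀ {a} → a * (n * n) + ((n * n) * (n * 1)) * 2 ≤ ((n * (n * (n * n))) * 1) * 2 → a ≤ 2 * (n * m)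
  tangent-estimate {a} le = ℕₚ.*-cancelʳ-≤ a (2 * (n * m)) (n * n) {{ℕₚ.m*n≢0 n n}}
    (ℕₚ.+-cancelʳ-≤ (((n * n) * (n * 1)) * 2) _ _ (ℕₚ.≤-trans le (ℕₚ.≤-reflexive (begin
      ((n * (n * (n * n))) * 1) * 2
        -- One of the four factors n is opened as 1 + m; its 1 yields the term 2n³ that cancels.
        ≡⟨ cong (λ k → ((n * (n * (n * k))) * 1) * 2) q²≡1+m ⟩
      ((n * (n * (n * suc m))) * 1) * 2
        ≡⟨ solve 2 (λ n m → ((n :* (n :* (n :* (con 1 :+ m)))) :* con 1) :* con 2
             := (con 2 :* (n :* m)) :* (n :* n) :+ ((n :* n) :* (n :* con 1)) :* con 2) refl n m ⟩
      (2 * (n * m)) * (n * n) + ((n * n) * (n * 1)) * 2 ∎))))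
    where open ≡-Reasoning

  singular-estimate : ∀ {a} → (a * a) * n ≤ (n * (n * (n * n))) * (m * m) → a ≤ c
  singular-estimate {a} le = ℕₚ.≮⇒≥ λ c<a → ℕₚ.<⇒≱ (ℕₚ.*-monoˡ-< n (ℕₚ.*-mono-< c<a c<a))
    (ℕₚ.≤-trans le (ℕₚ.≤-reflexive (solve 2 (λ q m →
      let n = q :* q; c = q :* (q :* q) :* m in
      (n :* (n :* (n :* n))) :* (m :* m) := (c :* c) :* n) refl q m)))

  secant-estimate : ∀ {b} → b * (n * (n * q)) ≤ (n * (n * (n * n))) * m → b ≤ c
  secant-estimate {b} le = ℕₚ.*-cancelʳ-≤ b c (n * (n * q)) {{ℕₚ.m*n≢0 n (n * q) {{n≢0}} {{ℕₚ.m*n≢0 n q}}}}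
    (ℕₚ.≤-trans le (ℕₚ.≤-reflexive (solve 2 (λ q m →
      let n = q :* q in
      (n :* (n :* (n :* n))) :* m := (q :* (q :* q) :* m) :* (n :* (n :* q))) refl q m)))

  hyperplane-estimate : ∀ {b} →
    b * (q * (n * (n * q))) + (q * ((n * (n * q)) * m)) * 2 ≤ ((n * (n * (n * n))) * m) * 2 →
    b + 2 * m ≤ 2 * (n * m)
  hyperplane-estimate {b} le = ℕₚ.*-cancelʳ-≤ (b + 2 * m) (2 * (n * m)) (q * (n * (n * q)))
    {{ℕₚ.m*n≢0 q _ {{q≢0}} {{ℕₚ.m*n≢0 n (n * q) {{n≢0}} {{ℕₚ.m*n≢0 n q}}}}}}
    (subst₂ _≤_
      (solve 3 (λ q m b → let n = q :* q in
        b :* (q :* (n :* (n :* q))) :+ (q :* ((n :* (n :* q)) :* m)) :* con 2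
        := (b :+ con 2 :* m) :* (q :* (n :* (n :* q)))) refl q m b)
      (solve 2 (λ q m → let n = q :* q in
        ((n :* (n :* (n :* n))) :* m) :* con 2 := (con 2 :* (n :* m)) :* (q :* (n :* (n :* q)))) refl q m)
      le)

  -- In the tangent plane lie at most m vectors on P and 2q²m others; all remaining ones are counted
  -- by `a`. The resulting bound 2q³ - q² per scalar is written additively because subtraction of
  -- naturals truncates.
  affine-estimate : ∀ {a₀ a₁ a} →
    (2 * q ^ 3 + q ^ 2 + 1) * (q ^ 2 ∸ 1) ≡ (a₀ + a₁) + a → a₀ + 1 ≤ n → a₁ ≤ 2 * (n * m) →
    2 * c ≤ n * m + a
  affine-estimate {a₀} {a₁} {a} total le₀ le₁ = ℕₚ.+-cancelʳ-≤ (n * m + m) _ _ (begin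
    2 * c + (n * m + m)
      ≡⟨ solve 2 (λ q m → con 2 :* (q :* (q :* q) :* m) :+ (q :* q :* m :+ m)
           := (con 2 :* q :^ 3 :+ q :^ 2 :+ con 1) :* m) refl q m ⟩
    (2 * q ^ 3 + q ^ 2 + 1) * m
      ≡⟨ cong (λ k → (2 * q ^ 3 + q ^ 2 + 1) * (k ∸ 1)) (trans (cong (q *_) (ℕₚ.*-identityʳ q)) q²≡1+m) ⟨
    (2 * q ^ 3 + q ^ 2 + 1) * (q ^ 2 ∸ 1)
      ≡⟨ total ⟩
    (a₀ + a₁) + a
      ≤⟨ ℕₚ.+-monoˡ-≤ a (ℕₚ.+-mono-≤ a₀≤m le₁) ⟩
    (m + 2 * (n * m)) + a
      ≡⟨ solve 3 (λ n m a → (m :+ con 2 :* (n :* m)) :+ a := n :* m :+ a :+ (n :* m :+ m)) refl n m a ⟩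
    n * m + a + (n * m + m) ∎)
    where
    open ℕₚ.≤-Reasoning
    a₀≤m : a₀ ≤ m
    a₀≤m = ℕ.s≤s⁻¹ (subst₂ _≤_ (ℕₚ.+-comm a₀ 1) q²≡1+m le₀)

  singular-contradiction : ∀ {a} → 2 * c ≤ n * m + a → a ≤ c → ⊥
  singular-contradiction {a} le₁ le₂ = ℕₚ.<⇒≱ {n * m} {c}
    (ℕₚ.<-≤-trans (subst (n * m ℕ.<_) (ℕₚ.*-comm (n * m) 3) (ℕₚ.m<m*n (n * m) 3 {{ℕₚ.m*n≢0 n m}} (ℕ.s≤s (ℕ.s≤s ℕ.z≤n)))) 3nm≤c)
    (ℕₚ.+-cancelʳ-≤ c c (n * m) (ℕₚ.≤-trans (ℕₚ.≤-reflexive (cong (c +_) (sym (ℕₚ.+-identityʳ c))))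
      (ℕₚ.≤-trans le₁ (ℕₚ.+-monoʳ-≤ (n * m) le₂))))

  -- Divided by m this says 2q³ - q² ≤ q³ + 1 + (2q² - 2), against 3q² ≤ q³. For q = 3 the latter is
  -- an equality, and the contradiction rests on a single point: the missed line contributes -2 and
  -- the point R contributes +1.
  nonsingular-contradiction : ∀ {a b b₀ b₁} → 2 * c ≤ n * m + a → a ≡ (b₀ + b₁) + b →
    b ≤ c → b₀ ≤ m → b₁ + 2 * m ≤ 2 * (n * m) → ⊥
  nonsingular-contradiction {a} {b} {b₀} {b₁} le eq le-b le₀ le₁ = ℕₚ.<⇒≱ 0<m (ℕₚ.+-cancelʳ-≤ (2 * c) m 0 (begin
    m + 2 * c
      ≤⟨ ℕₚ.+-monoʳ-≤ m le ⟩
    m + (n * m + a)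
      ≡⟨ cong (λ z → m + (n * m + z)) eq ⟩
    m + (n * m + ((b₀ + b₁) + b))
      ≤⟨ ℕₚ.+-monoʳ-≤ m (ℕₚ.+-monoʳ-≤ (n * m) (ℕₚ.+-mono-≤ (ℕₚ.+-monoˡ-≤ b₁ le₀) le-b)) ⟩
    m + (n * m + ((m + b₁) + c))
      ≡⟨ solve 4 (λ m nm b c → m :+ (nm :+ ((m :+ b) :+ c)) := (b :+ con 2 :* m) :+ (nm :+ c)) refl m (n * m) b₁ c ⟩
    (b₁ + 2 * m) + (n * m + c)
      ≤⟨ ℕₚ.+-monoˡ-≤ (n * m + c) le₁ ⟩
    2 * (n * m) + (n * m + c)
      ≡⟨ solve 2 (λ nm c → con 2 :* nm :+ (nm :+ c) := con 3 :* nm :+ c) refl (n * m) c ⟩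
    3 * (n * m) + c
      ≤⟨ ℕₚ.+-monoˡ-≤ c 3nm≤c ⟩
    c + c
      ≡⟨ cong (c +_) (ℕₚ.+-identityʳ c) ⟨
    2 * c ∎))
    where open ℕₚ.≤-Reasoning

family-map : {X : Set} {_≈_ : X → X → Set} {Pr Pr′ : X → Set} {a : ℕ} → (∀ {x} → Pr x → Pr′ x) →
             Family _≈_ Pr a → Family _≈_ Pr′ a
family-map f fam = record { at = at ; at-injective = at-injective ; satisfies = λ i → f (satisfies i) }
  where open Family fam

-- A nonsingular point at which `G` vanishes on the tangent hyperplane

module FrameExistence (q : ℕ) (opp : OddPrimePower q) (F : FiniteField (q ℕ.* q))
    (forms : Forms.FormPair q opp F) (P : Geometry.Vec4 F q) where
  open NonsingularCount q opp F forms P public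

  -- All that the count hands on to the algebra: the hypothesis on |H ∩ Q| has been converted into
  -- `vanish`, and `hec` records that c is nonzero.
  record Frame : Set where
    field
      R c e : Vec4
      hRP : h R P ≡ 1#
      HR : h R R ≡ 0#
      QR : B R R ≡ 0#
      hc : ∀ x → h x c ≡ B x R + - h x R
      heP : h e P ≡ 0#
      heR : h e R ≡ 0#
      hec : h e c ≡ 1#
      vanish : ∀ p → h p P ≡ 0# → h p R ≡ 0# → Tr (h p c) ≡ 0# → G p ≡ 0#

  module _ (HP : h P P ≡ 0#) (QP : B P P ≡ 0#) (BP : ∀ x → B x P ≡ h x P)
    {a m : ℕ} (n≡1+m : n ≡ suc m) (ch : Chart a m)
    (many : 2 ℕ.* (q ℕ.* (q ℕ.* q) ℕ.* m) ℕ.≤ n ℕ.* m ℕ.+ a) where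
    open Chart ch
    open Estimates q m 3≤q n≡1+m

    everything : Family {Fin a} _≡_ (λ _ → ⊤) a
    everything = record { at = λ i → i ; at-injective = λ e → e ; satisfies = λ _ → tt }

    frame-at : ∀ i → (∃ λ j → h (ε j) (pt i) ≢ B (ε j) (pt i)) → Frame
    frame-at i (j , differ) = record
      { R = R ; c = c ; e = e ; hRP = pt-P i ; HR = pt-H i ; QR = pt-Q i ; hc = hc
      ; heP = heP ; heR = heR ; hec = hec ; vanish = vanish }
      where
      R = pt i
      lin : Linear (λ x → B x R + - h x R)
      lin = record
        { f-cong = λ e → cong₂ (λ a b → a + - b) (B-cong e ≐-refl) (h-cong e ≐-refl)
        ; f-⊕ = λ u v → trans (cong₂ (λ a b → a + - b) (B-⊕ˡ u v R) (h-⊕ˡ u v R))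
            (solve 4 (λ a b c d → a :+ b :- (c :+ d) := (a :- c) :+ (b :- d)) refl (B u R) (B v R) (h u R) (h v R))
        ; f-· = λ t u → trans (cong₂ (λ a b → a + - b) (B-·ˡ t u R) (h-·ˡ t u R))
            (solve 3 (λ t a b → t :* a :- t :* b := t :* (a :- b)) refl t (B u R) (h u R)) }
      c = proj₁ (represent lin)
      hc : ∀ x → h x c ≡ B x R + - h x R
      hc = proj₂ (represent lin)
      open Nonsingular HP QP BP R (pt-P i) (pt-H i) (pt-Q i) c hc using (proj; proj-P; proj-R; proj-c)
      k≢0 : h (ε j) c ≢ 0#
      k≢0 eq = differ (sym (difference≡0 (trans (sym (hc (ε j))) eq)))
      -- Projecting to W preserves h(·,c), so the basis vector on which the two functionals differ
      -- can be normalised to h(e,c) = 1.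
      e = recip k≢0 · proj (ε j)
      scaled0 : ∀ {z} → h (proj (ε j)) z ≡ 0# → h e z ≡ 0#
      scaled0 {z} eq = trans (h-·ˡ _ _ z) (*0 eq)
      heP : h e P ≡ 0#
      heP = scaled0 (proj-P (ε j))
      heR : h e R ≡ 0#
      heR = scaled0 (proj-R (ε j))
      hec : h e c ≡ 1#
      hec = trans (h-·ˡ _ _ c) (trans (cong (recip k≢0 *_) (proj-c (ε j))) (recip-* k≢0))
      open Transversal HP QP BP R (pt-P i) (pt-H i) (pt-Q i) c hc e heP heR hec using (module Bounds)
      open Bounds ch
      vanish : ∀ p → h p P ≡ 0# → h p R ≡ 0# → Tr (h p c) ≡ 0# → G p ≡ 0#
      vanish p pP pR pc = decidable-stable (G p ≟ 0#) λ Gp≢0 → absurd Gp≢0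
        (family-split sym (λ i → tr i ≟ 0#) everything)
        where
        absurd : G p ≢ 0# → (Σ ℕ λ b₀ → Σ ℕ λ b → (a ≡ b₀ ℕ.+ b) ×
          Family _≡_ (λ i → ⊤ × tr i ≡ 0#) b₀ × Family _≡_ (λ i → ⊤ × ¬ (tr i ≡ 0#)) b) → ⊥
        absurd Gp≢0 (b₀ , b , eq , Z₀ , Z₁) = absurd′ (family-split sym (λ i → isZero? (w i)) Z₀)
          where
          absurd′ : (Σ ℕ λ b′ → Σ ℕ λ b″ → (b₀ ≡ b′ ℕ.+ b″) ×
            Family _≡_ (λ i → (⊤ × tr i ≡ 0#) × IsZero (w i)) b′ ×
            Family _≡_ (λ i → (⊤ × tr i ≡ 0#) × ¬ IsZero (w i)) b″) → ⊥
          absurd′ (b′ , b″ , eq′ , Z′ , Z″) = nonsingular-contradiction many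
            (trans eq (cong (ℕ._+ b) eq′))
            (secant-estimate {b} (secant-bound (family-map proj₂ Z₁)))
            (centre-bound (family-map proj₂ Z′))
            (hyperplane-estimate {b″} (tangent-hyperplane-bound (family-map (λ x → proj₂ (proj₁ x) , proj₂ x) Z″) p (pP , pR , pc) Gp≢0))

    some-frame : ∀ R₀ → h R₀ P ≡ 1# → Frame
    some-frame R₀ hR₀P = frame-at (proj₁ nonsingular)
      (Finₚ.¬∀⟶∃¬ 4 _ (λ j → h (ε j) (pt (proj₁ nonsingular)) ≟ B (ε j) (pt (proj₁ nonsingular))) (proj₂ nonsingular))
      where
      Same : Fin a → Set
      Same i = ∀ j → h (ε j) (pt i) ≡ B (ε j) (pt i)
      nonsingular : ∃ λ i → ¬ Same i
      nonsingular = Finₚ.¬∀⟶∃¬ a Same (λ i → Finₚ.all? (λ j → h (ε j) (pt i) ≟ B (ε j) (pt i)))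
        (λ all → singular-contradiction many (singular-estimate {a} (singular-bound ch R₀ hR₀P
          (λ i → linear-ext (h-linear (pt i)) (B-linear (pt i)) (all i)))))

  frame : ¬ IsZero P → h P P ≡ 0# → B P P ≡ 0# → (∀ x → B x P ≡ h x P) →
          ¬ (∀ w → h w P ≡ 0# → B w w ≡ 0#) → ∀ {L} →
          Family _≐_ (λ v → ¬ IsZero v × h v v ≡ 0# × B v v ≡ 0#) L →
          L ≡ (2 ℕ.* q ℕ.^ 3 ℕ.+ q ℕ.^ 2 ℕ.+ 1) ℕ.* (q ℕ.^ 2 ℕ.∸ 1) → Frame
  frame P≢0 HP QP BP not-plane {L} Z total = go (family-split ≐-sym (λ v → h v P ≟ 0#) Z)
    where
    k≢0 = proj₂ (nonzero⇒h≢0 P≢0)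
    R₀ : Vec4
    R₀ = recip k≢0 · ε (proj₁ (nonzero⇒h≢0 P≢0))
    hR₀P : h R₀ P ≡ 1#
    hR₀P = trans (h-·ˡ _ _ P) (recip-* k≢0)
    open TangentCount HP QP BP R₀ hR₀P
    Pr : Vec4 → Set
    Pr v = ¬ IsZero v × h v v ≡ 0# × B v v ≡ 0#
    go : (Σ ℕ λ b → Σ ℕ λ a → (L ≡ b ℕ.+ a) × Family _≐_ (λ v → Pr v × h v P ≡ 0#) b ×
          Family _≐_ (λ v → Pr v × ¬ (h v P ≡ 0#)) a) → Frame
    go (b , a , eq , Z₀ , Z₁) = go′
      (chart (family-map (λ x → proj₁ (proj₂ (proj₁ x)) , proj₂ (proj₂ (proj₁ x)) , proj₂ x) Z₁))
      (family-split ≐-sym (λ v → Finₚ.all? (λ i → v i ≟ (h v R₀ · P) i)) Z₀)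
      where
      go′ : (∃ λ m → (n ≡ suc m) × Chart a m) →
            (Σ ℕ λ b₀ → Σ ℕ λ b₁ → (b ≡ b₀ ℕ.+ b₁) × Family _≐_ (λ v → (Pr v × h v P ≡ 0#) × OnP v) b₀ ×
             Family _≐_ (λ v → (Pr v × h v P ≡ 0#) × ¬ OnP v) b₁) → Frame
      go′ (m , n≡1+m , ch) (b₀ , b₁ , eq′ , Y₀ , Y₁) =
        some-frame HP QP BP n≡1+m ch
          (affine-estimate (trans (sym total) (trans eq (cong (ℕ._+ a) eq′)))
            (onP-bound (family-map (λ x → proj₁ (proj₁ (proj₁ x)) , proj₂ x) Y₀)) few)
          R₀ hR₀P
        where
        open Estimates q m 3≤q n≡1+m
        -- No p with Q(p) ≠ 0 is chosen in advance: if the bound failed, each p in the tangent plane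
        -- would have Q(p) = 0, which `not-plane` forbids.
        few : b₁ ℕ.≤ 2 ℕ.* (n ℕ.* m)
        few = decidable-stable (b₁ ℕₚ.≤? 2 ℕ.* (n ℕ.* m)) λ too-many → not-plane λ p pP →
          decidable-stable (B p p ≟ 0#) λ Qp≢0 → too-many (tangent-estimate {b₁} (tangent-bound
            (family-map (λ x → proj₂ (proj₂ (proj₁ (proj₁ x))) , proj₂ (proj₁ x) , proj₂ x) Y₁) p pP Qp≢0))

-- A basis in which both forms have the same Gram matrix

module NormalForm (q : ℕ) (opp : OddPrimePower q) (F : FiniteField (q ℕ.* q))
    (forms : Forms.FormPair q opp F) (P : Geometry.Vec4 F q) where
  open FrameExistence q opp F forms P public

  half : Carrier
  half = recip 2≢0

  half+half : half + half ≡ 1#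
  half+half = trans (sym (2#* half)) (*-recip 2≢0)

  conj-half : conj half ≡ half
  conj-half = cancelˡ 2≢0 (begin
    2# * conj half        ≡⟨ cong (_* conj half) (trans (conj-+ 1# 1#) (cong₂ _+_ conj-1 conj-1)) ⟨
    conj 2# * conj half   ≡⟨ conj-* 2# half ⟨
    conj (2# * half)      ≡⟨ cong conj (*-recip 2≢0) ⟩
    conj 1#               ≡⟨ conj-1 ⟩
    1#                    ≡⟨ *-recip 2≢0 ⟨
    2# * half             ∎)
    where open ≡-Reasoning

  halves : ∀ x → half * x + half * x ≡ x
  halves x = trans (sym (distribʳ x half half)) (trans (cong (_* x) half+half) (*-identityˡ x))

  conj-ω*ω : conj (ω * ω) ≡ ω * ω
  conj-ω*ω = trans (conj-* ω ω) (trans (cong₂ _*_ conj-ω conj-ω)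
    (solve 1 (λ w → :- w :* :- w := w :* w) refl ω))

  ω⁻¹ : Carrier
  ω⁻¹ = recip ω≢0

  sum-difference : ∀ {x y} → x + y ≡ 0# → x + - y ≡ 0# → x ≡ 0# × y ≡ 0#
  sum-difference {x} {y} s d = x≡0 , trans (sym (+-identityˡ y)) (trans (cong (_+ y) (sym x≡0)) s)
    where
    x≡0 : x ≡ 0#
    x≡0 = cancel2 (trans (solve 2 (λ x y → x :+ x := (x :+ y) :+ (x :- y)) refl x y)
      (trans (cong₂ _+_ s d) (+-identityˡ 0#)))

  record NormalBasis : Set where
    field
      v₁ v₂ v₃ v₄ : Vec4
      h₁₁ : h v₁ v₁ ≡ 0#
      h₁₂ : h v₁ v₂ ≡ 0#
      h₁₃ : h v₁ v₃ ≡ 1#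
      h₁₄ : h v₁ v₄ ≡ 0#
      h₂₂ : h v₂ v₂ ≡ 0#
      h₂₃ : h v₂ v₃ ≡ 0#
      h₂₄ : h v₂ v₄ ≡ - 1#
      h₃₃ : h v₃ v₃ ≡ 0#
      h₃₄ : h v₃ v₄ ≡ 0#
      h₄₄ : h v₄ v₄ ≡ 0#
      B₁₁ : B v₁ v₁ ≡ 0#
      B₁₂ : B v₁ v₂ ≡ 0#
      B₁₃ : B v₁ v₃ ≡ 1#
      B₁₄ : B v₁ v₄ ≡ 0#
      B₂₂ : B v₂ v₂ ≡ 0#
      B₂₃ : B v₂ v₃ ≡ 0#
      B₂₄ : B v₂ v₄ ≡ - 1#
      B₃₃ : B v₃ v₃ ≡ 0#
      B₃₄ : B v₃ v₄ ≡ 0#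
      B₄₄ : B v₄ v₄ ≡ 0#

  module Construction
    (HP : h P P ≡ 0#) (QP : B P P ≡ 0#) (BP : ∀ x → B x P ≡ h x P) (fr : Frame) where
    open Frame fr
    open Nonsingular HP QP BP R hRP HR QR c hc

    hcP : h c P ≡ 0#
    hcP = h-flip0 hPc

    hcR : h c R ≡ 0#
    hcR = h-flip0 hRc

    BcP : B c P ≡ 0#
    BcP = trans (BP c) hcP

    conj0 : ∀ {x} → x ≡ 0# → conj x ≡ 0#
    conj0 e = trans (cong conj e) conj-0

    module _ {w : Vec4} (wP : h w P ≡ 0#) (wR : h w R ≡ 0#) (wc : h w c ≡ 0#) where
      private
        open ≡-Reasoning
        H = h w w
        b = B w w
        b̄ = conj b
        scaled : ∀ t {z} → h w z ≡ 0# → h (t · w) z ≡ 0#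
        scaled t {z} e = trans (h-·ˡ t w z) (*0 e)
        G-scaled : ∀ t → (t * conj t * H + t * conj t * H) + - (t * t * b + conj (t * t) * b̄) ≡ 0#
        G-scaled t = begin
          (t * conj t * H + t * conj t * H) + - (t * t * b + conj (t * t) * b̄)
            ≡⟨ cong₂ (λ x y → (x + x) + - y) (H-· t w) (cong₂ _+_ (Q-· t w) (trans (cong conj (Q-· t w)) (conj-* _ _))) ⟨
          G (t · w)
            ≡⟨ vanish (t · w) (scaled t wP) (scaled t wR)
                 (trans (cong₂ _+_ (scaled t wc) (conj0 (scaled t wc))) (+-identityˡ 0#)) ⟩
          0# ∎
        at-1 : (H + H) + - (b + b̄) ≡ 0#
        at-1 = vanish w wP wR (trans (cong₂ _+_ wc (conj0 wc)) (+-identityˡ 0#))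
        at-ω : (H + H) + (b + b̄) ≡ 0#
        at-ω = zero-product (*≢0 ω≢0 ω≢0) (begin
          ω * ω * ((H + H) + (b + b̄))
            ≡⟨ solve 4 (λ w H b b̄ → w :* w :* ((H :+ H) :+ (b :+ b̄))
                 := :- ((w :* :- w :* H :+ w :* :- w :* H) :- (w :* w :* b :+ w :* w :* b̄))) refl ω H b b̄ ⟩
          - ((ω * - ω * H + ω * - ω * H) + - (ω * ω * b + ω * ω * b̄))
            ≡⟨ cong₂ (λ x y → - ((ω * x * H + ω * x * H) + - (ω * ω * b + y * b̄))) conj-ω conj-ω*ω ⟨
          - ((ω * conj ω * H + ω * conj ω * H) + - (ω * ω * b + conj (ω * ω) * b̄))
            ≡⟨ cong -_ (G-scaled ω) ⟩
          - 0#
            ≡⟨ -0≡0 ⟩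
          0# ∎)
        H+H : (H + H ≡ 0#) × (b + b̄ ≡ 0#)
        H+H = sum-difference at-ω at-1
        at-1+ω : (1# + ω) * (1# + ω) * b + conj ((1# + ω) * (1# + ω)) * b̄ ≡ 0#
        at-1+ω = begin
          Y                          ≡⟨ solve 2 (λ x y → y := x :- (x :- y)) refl (X + X) Y ⟩
          (X + X) + - ((X + X) + - Y) ≡⟨ cong₂ (λ x y → x + - y) (trans (cong (λ z → z + z) (*0 (cancel2 (proj₁ H+H)))) (+-identityˡ 0#)) (G-scaled (1# + ω)) ⟩
          0# + - 0#                  ≡⟨ -‿inverseʳ 0# ⟩
          0#                         ∎
          where
          X = (1# + ω) * conj (1# + ω) * H
          Y = (1# + ω) * (1# + ω) * b + conj ((1# + ω) * (1# + ω)) * b̄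
        imaginary : b + - b̄ ≡ 0#
        imaginary = zero-product ω≢0 (cancel2 (begin
          ω * (b + - b̄) + ω * (b + - b̄)
            ≡⟨ *-identityˡ _ ⟨
          1# * (ω * (b + - b̄) + ω * (b + - b̄))
            ≡⟨ solve 4 (λ o w b b̄ → o :* (w :* (b :- b̄) :+ w :* (b :- b̄))
                 := (o :+ w) :* (o :+ w) :* b :+ (o :- w) :* (o :- w) :* b̄ :- (o :* o :+ w :* w) :* (b :+ b̄))
                 refl 1# ω b b̄ ⟩
          (1# + ω) * (1# + ω) * b + (1# + - ω) * (1# + - ω) * b̄ + - ((1# * 1# + ω * ω) * (b + b̄))
            ≡⟨ cong (λ z → (1# + ω) * (1# + ω) * b + z * b̄ + - ((1# * 1# + ω * ω) * (b + b̄)))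
                 (trans (conj-* _ _) (cong (λ z → z * z) (trans (conj-+ 1# ω) (cong₂ _+_ conj-1 conj-ω)))) ⟨
          (1# + ω) * (1# + ω) * b + conj ((1# + ω) * (1# + ω)) * b̄ + - ((1# * 1# + ω * ω) * (b + b̄))
            ≡⟨ cong₂ (λ x y → x + - y) at-1+ω (*0 (proj₂ H+H)) ⟩
          0# + - 0#
            ≡⟨ -‿inverseʳ 0# ⟩
          0# ∎))

      -- The hypotheses on w are stable under all scalars of F, so `G` vanishes on every multiple.
      -- With b = B(w,w), the multiple 1 gives 2h(w,w) = Tr b, the multiple ω gives 2h(w,w) = -Tr b,
      -- and 1 + ω then gives b = b̄.
      isotropic : h w w ≡ 0# × B w w ≡ 0#
      isotropic = cancel2 (proj₁ H+H) , proj₁ (sum-difference (proj₂ H+H) imaginary)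

    Ker : Vec4 → Set
    Ker w = (h w P ≡ 0#) × (h w R ≡ 0#) × (h w c ≡ 0#)

    ker-⊕· : ∀ {u v} t → Ker u → Ker v → Ker (u ⊕ t · v)
    ker-⊕· {u} {v} t (uP , uR , uc) (vP , vR , vc) = along uP vP , along uR vR , along uc vc
      where
      along : ∀ {z} → h u z ≡ 0# → h v z ≡ 0# → h (u ⊕ t · v) z ≡ 0#
      along {z} p r = trans (h-⊕·ˡ u t v z) (trans (+0* r) p)

    -- h vanishes on u + t v for every t in F; taking t = 1 and t = ω separates h(u,v) from h(v,u).
    ker-orthogonal : ∀ {u v} → Ker u → Ker v → h u v ≡ 0#
    ker-orthogonal {u} {v} ku kv = proj₁ (sum-difference
      (trans (cong₂ _+_ (sym (trans (cong (_* h u v) conj-1) (*-identityˡ _))) (sym (*-identityˡ _))) (polar 1#))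
      (zero-product ω≢0 (begin
        ω * (h u v + - h v u)
          ≡⟨ solve 3 (λ w a b → w :* (a :- b) := :- (:- w :* a :+ w :* b)) refl ω (h u v) (h v u) ⟩
        - (- ω * h u v + ω * h v u)
          ≡⟨ cong (λ z → - (z * h u v + ω * h v u)) conj-ω ⟨
        - (conj ω * h u v + ω * h v u)
          ≡⟨ cong -_ (polar ω) ⟩
        - 0#
          ≡⟨ -0≡0 ⟩
        0# ∎)))
      where
      open ≡-Reasoning
      H0 : ∀ {w} → Ker w → h w w ≡ 0#
      H0 (a , b , c) = proj₁ (isotropic a b c)
      polar : ∀ t → conj t * h u v + t * h v u ≡ 0#
      polar t = begin
        conj t * h u v + t * h v u                                           ≡⟨ +-identityˡ _ ⟨
        0# + (conj t * h u v + t * h v u)                                    ≡⟨ cong (_+ (conj t * h u v + t * h v u)) (H0 ku) ⟨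
        h u u + (conj t * h u v + t * h v u)                                 ≡⟨ +0* (H0 kv) ⟨
        h u u + (conj t * h u v + t * h v u) + t * conj t * h v v            ≡⟨ H-⊕· u t v ⟨
        h (u ⊕ t · v) (u ⊕ t · v)                                            ≡⟨ H0 (ker-⊕· t ku kv) ⟩
        0#                                                                   ∎

    -- Otherwise c^⊥ ∩ W is totally isotropic and orthogonal to P, R and c, hence zero,
    -- and the three vectors P, R, c span the space.
    Hc : h c c ≡ 0#
    Hc = decidable-stable (h c c ≟ 0#) λ k≢0 → spanning k≢0
      where
      module _ (k≢0 : h c c ≢ 0#) where
        coefficient : Vec4 → Carrier
        coefficient v = - (h v c * recip k≢0)
        pr : Vec4 → Vec4
        pr v = proj v ⊕ coefficient v · c
        pr-ker : ∀ v → Ker (pr v)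
        pr-ker v = trans (h-⊕·ˡ _ _ c P) (trans (+0* hcP) (proj-P v)) ,
                   trans (h-⊕·ˡ _ _ c R) (trans (+0* hcR) (proj-R v)) ,
                   trans (h-⊕·ˡ _ _ c c) (begin
                     h (proj v) c + - (h v c * recip k≢0) * h c c
                       ≡⟨ cong (_+ - (h v c * recip k≢0) * h c c) (proj-c v) ⟩
                     h v c + - (h v c * recip k≢0) * h c c
                       ≡⟨ solve 3 (λ a i k → a :+ :- (a :* i) :* k := a :- a :* (i :* k)) refl (h v c) (recip k≢0) (h c c) ⟩
                     h v c + - (h v c * (recip k≢0 * h c c))
                       ≡⟨ cong (λ z → h v c + - (h v c * z)) (recip-* k≢0) ⟩
                     h v c + - (h v c * 1#)
                       ≡⟨ cong (λ z → h v c + - z) (*-identityʳ _) ⟩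
                     h v c + - h v c
                       ≡⟨ -‿inverseʳ _ ⟩
                     0# ∎)
          where open ≡-Reasoning
        ker-zero : ∀ {u} → Ker u → IsZero u
        ker-zero {u} ku@(uP , uR , uc) = h-nondegenerate u λ y → begin
          h y u                         ≡⟨ proj-⊥ (h-flip0 uP) (h-flip0 uR) y ⟨
          h (proj y) u                  ≡⟨ +0* (h-flip0 uc) ⟨
          h (proj y) u + coefficient y * h c u ≡⟨ h-⊕·ˡ (proj y) (coefficient y) c u ⟨
          h (pr y) u                    ≡⟨ ker-orthogonal (pr-ker y) ku ⟩
          0#                            ∎
          where open ≡-Reasoning
        -- Once `Ker` is trivial, three functionals embed q⁸ vectors into q⁶ triples.
        values : Carrier × (Carrier × (Carrier × Carrier)) → Carrier × (Carrier × Carrier)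
        values t = h (untuple t) P , h (untuple t) R , h (untuple t) c
        values-injective : Injective values
        values-injective {s} {t} eq = tuple-cong {untuple s} {untuple t} u≐v
          where
          u = untuple s
          v = untuple t
          P≡ = cong proj₁ eq
          R≡ = cong (proj₁ ∘ proj₂) eq
          c≡ = cong (proj₂ ∘ proj₂) eq
          u≐v : u ≐ v
          u≐v = ⊕-cancelʳ {u} {v} (⊕-cancelʳ {w = (- h u R) · P} (⊕-cancelʳ {w = coefficient u · c} {z = coefficient v · c}
            (λ i → trans (ker-zero (pr-ker u) i) (sym (ker-zero (pr-ker v) i)))
            (λ i → cong (λ z → - (z * recip k≢0) * c i) c≡))
            (λ i → cong (λ z → - z * P i) R≡))
            (λ i → cong (λ z → - z * R i) P≡)
        spanning : ⊥
        spanning = ℕₚ.<⇒≱ (subst (n ℕ.* (n ℕ.* n) ℕ.<_) (ℕₚ.*-comm (n ℕ.* (n ℕ.* n)) n)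
          (ℕₚ.m<m*n (n ℕ.* (n ℕ.* n)) n {{ℕₚ.m*n≢0 n (n ℕ.* n) {{nz}} {{ℕₚ.m*n≢0 n n {{nz}} {{nz}}}}}} 1<n))
          (injection⇒≤ tuples↔ (enum ⊗ enum ⊗ enum) values values-injective)
          where
          1<n : 1 ℕ.< n
          1<n = ℕₚ.<-≤-trans (ℕ.s≤s (ℕ.s≤s ℕ.z≤n)) (ℕₚ.*-mono-≤ 3≤q 3≤q)
          nz : ℕ.NonZero n
          nz = ℕ.>-nonZero (ℕₚ.<-trans ℕ.z<s 1<n)

    Qc : B c c ≡ 0#
    Qc = proj₂ (isotropic hcP hcR Hc)

    BcR : B c R ≡ 0#
    BcR = trans (BxR c) (trans (cong₂ _+_ Hc hcR) (+-identityˡ 0#))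

    shift : ∀ u s z → h c z ≡ 0# → h (u ⊕ s · c) z ≡ h u z
    shift u s z p = trans (h-⊕·ˡ u s c z) (+0* p)

    H-shift : ∀ {u} s → h u c ≡ 1# → h (u ⊕ s · c) (u ⊕ s · c) ≡ h u u + Tr s
    H-shift {u} s uc = begin
      h (u ⊕ s · c) (u ⊕ s · c)                                 ≡⟨ H-⊕· u s c ⟩
      h u u + (conj s * h u c + s * h c u) + s * conj s * h c c ≡⟨ +0* Hc ⟩
      h u u + (conj s * h u c + s * h c u)                      ≡⟨ cong₂ (λ a b → h u u + (conj s * a + s * b)) uc (h-flip1 uc) ⟩
      h u u + (conj s * 1# + s * 1#)                            ≡⟨ cong (h u u +_) (trans (cong₂ _+_ (*-identityʳ _) (*-identityʳ _)) (+-comm _ _)) ⟩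
      h u u + Tr s                                              ∎
      where open ≡-Reasoning

    -- Since h(e,c) = 1 and h(c,c) = 0, adding s c changes h(e,e) by Tr s; this s removes it.
    e₁ : Vec4
    e₁ = e ⊕ (- (half * h e e)) · c

    e₁P : h e₁ P ≡ 0#
    e₁P = trans (shift e _ P hcP) heP

    e₁R : h e₁ R ≡ 0#
    e₁R = trans (shift e _ R hcR) heR

    e₁c : h e₁ c ≡ 1#
    e₁c = trans (shift e _ c Hc) hec

    He₁ : h e₁ e₁ ≡ 0#
    He₁ = trans (H-shift (- (half * h e e)) hec) (begin
      h e e + (- (half * h e e) + conj (- (half * h e e)))
        ≡⟨ cong (λ z → h e e + (- (half * h e e) + z)) (trans (conj-neg _) (cong -_ (trans (conj-* _ _) (cong₂ _*_ conj-half (conj-H e))))) ⟩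
      h e e + (- (half * h e e) + - (half * h e e))
        ≡⟨ solve 2 (λ a b → a :+ (:- b :+ :- b) := a :- (b :+ b)) refl (h e e) (half * h e e) ⟩
      h e e + - (half * h e e + half * h e e)
        ≡⟨ cong (λ z → h e e + - z) (halves (h e e)) ⟩
      h e e + - h e e
        ≡⟨ -‿inverseʳ _ ⟩
      0# ∎)
      where open ≡-Reasoning

    private
      Q₁ = B e₁ e₁
      β = B e₁ c

    -- G vanishes on ω e₁ + x c for every x.
    pencil : ∀ x → let A = ω * ω * Q₁ + x * ((ω * β + ω * β) + x * 0#) in
             ((conj x * ω + x * - ω) + (conj x * ω + x * - ω)) + - (A + conj A) ≡ 0#
    pencil x = begin
      (X + X) + - (A + conj A)
        ≡⟨ cong₂ (λ a b → (a + a) + - Tr b) H≡ Q≡ ⟨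
      G w
        ≡⟨ vanish w (trans (shift _ x P hcP) (trans (h-·ˡ ω e₁ P) (*0 e₁P)))
             (trans (shift _ x R hcR) (trans (h-·ˡ ω e₁ R) (*0 e₁R)))
             (trans (cong₂ _+_ wc (trans (cong conj wc) conj-ω)) (-‿inverseʳ ω)) ⟩
      0# ∎
      where
      open ≡-Reasoning
      X = conj x * ω + x * - ω
      A = ω * ω * Q₁ + x * ((ω * β + ω * β) + x * 0#)
      w = ω · e₁ ⊕ x · c
      ωe₁c : h (ω · e₁) c ≡ ω
      ωe₁c = trans (h-·ˡ ω e₁ c) (trans (cong (ω *_) e₁c) (*-identityʳ ω))
      wc : h w c ≡ ω
      wc = trans (shift _ x c Hc) ωe₁c
      H≡ : h w w ≡ X
      H≡ = begin
        h w w ≡⟨ H-⊕· (ω · e₁) x c ⟩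
        h (ω · e₁) (ω · e₁) + (conj x * h (ω · e₁) c + x * h c (ω · e₁)) + x * conj x * h c c
          ≡⟨ +0* Hc ⟩
        h (ω · e₁) (ω · e₁) + (conj x * h (ω · e₁) c + x * h c (ω · e₁))
          ≡⟨ cong₂ _+_ (trans (H-· ω e₁) (*0 He₁)) (cong₂ (λ a b → conj x * a + x * b) ωe₁c (trans (h-flip ωe₁c) conj-ω)) ⟩
        0# + X ≡⟨ +-identityˡ X ⟩
        X ∎
      Q≡ : B w w ≡ A
      Q≡ = trans (Q-⊕· (ω · e₁) x c) (cong₂ _+_ (Q-· ω e₁)
        (cong₂ (λ a b → x * ((a + a) + x * b)) (B-·ˡ ω e₁ c) Qc))

    pencil′ : ∀ x → ((conj x * ω + x * - ω) + (conj x * ω + x * - ω)) +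
              - ((ω * ω * Q₁ + x * (ω * β + ω * β)) + (ω * ω * conj Q₁ + conj x * (- ω * conj β + - ω * conj β))) ≡ 0#
    pencil′ x = trans (cong (λ z → X + - z) (sym (cong₂ _+_ A≡ (trans (cong conj A≡) conjA)))) (pencil x)
      where
      X = (conj x * ω + x * - ω) + (conj x * ω + x * - ω)
      A≡ : ω * ω * Q₁ + x * ((ω * β + ω * β) + x * 0#) ≡ ω * ω * Q₁ + x * (ω * β + ω * β)
      A≡ = cong (λ z → ω * ω * Q₁ + x * z) (+0* refl)
      ωβ : conj (ω * β) ≡ - ω * conj β
      ωβ = trans (conj-* _ _) (cong (_* conj β) conj-ω)
      conjA : conj (ω * ω * Q₁ + x * (ω * β + ω * β)) ≡ ω * ω * conj Q₁ + conj x * (- ω * conj β + - ω * conj β)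
      conjA = trans (conj-+ _ _) (cong₂ _+_ (trans (conj-* _ _) (cong (_* conj Q₁) conj-ω*ω))
        (trans (conj-* _ _) (cong (conj x *_) (trans (conj-+ _ _) (cong₂ _+_ ωβ ωβ)))))

    -- The pencil identity at x = 0, divided by -ω².
    Tr-Q₁ : Tr Q₁ ≡ 0#
    Tr-Q₁ = zero-product (*≢0 ω≢0 ω≢0) (begin
      ω * ω * (Q₁ + conj Q₁)
        ≡⟨ solve 5 (λ w k k̄ b b̄ → let x = con (pos 0) in w :* w :* (k :+ k̄) :=
             :- (((x :* w :+ x :* :- w) :+ (x :* w :+ x :* :- w)) :- ((w :* w :* k :+ x :* (w :* b :+ w :* b)) :+ (w :* w :* k̄ :+ x :* (:- w :* b̄ :+ :- w :* b̄)))))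
             refl ω Q₁ (conj Q₁) β (conj β) ⟩
      - lhs 0#
        ≡⟨ cong (λ x̄ → - lhs x̄) conj-0 ⟨
      - lhs (conj 0#)
        ≡⟨ cong -_ (pencil′ 0#) ⟩
      - 0#
        ≡⟨ -0≡0 ⟩
      0# ∎)
      where
      open ≡-Reasoning
      lhs : Carrier → Carrier
      lhs x̄ = ((x̄ * ω + 0# * - ω) + (x̄ * ω + 0# * - ω)) +
              - ((ω * ω * Q₁ + 0# * (ω * β + ω * β)) + (ω * ω * conj Q₁ + x̄ * (- ω * conj β + - ω * conj β)))

    -- The pencil identity after its constant term has gone: what is left is linear in x and x̄ with
    -- an overall factor 2ω. Its instances at 1 and ω give B(e₁,c) = -1.
    balance : ∀ x → conj x * (1# + conj β) + - (x * (1# + β)) ≡ 0#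
    balance x = zero-product ω≢0 (cancel2 (begin
      ω * (x̄ * (1# + β̄) + - (x * (1# + β))) + ω * (x̄ * (1# + β̄) + - (x * (1# + β)))
        ≡⟨ solve 6 (λ o w x x̄ b b̄ → w :* (x̄ :* (o :+ b̄) :- x :* (o :+ b)) :+ w :* (x̄ :* (o :+ b̄) :- x :* (o :+ b))
             := ((x̄ :* (w :* o) :+ x :* :- (w :* o)) :+ (x̄ :* (w :* o) :+ x :* :- (w :* o)))
                :- (x :* (w :* b :+ w :* b) :+ x̄ :* (:- w :* b̄ :+ :- w :* b̄))) refl 1# ω x x̄ β β̄ ⟩
      X (ω * 1#) + - (x * (ω * β + ω * β) + x̄ * (- ω * β̄ + - ω * β̄))
        ≡⟨ cong (λ z → X z + - (x * (ω * β + ω * β) + x̄ * (- ω * β̄ + - ω * β̄))) (*-identityʳ ω) ⟩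
      X ω + - (x * (ω * β + ω * β) + x̄ * (- ω * β̄ + - ω * β̄))
        ≡⟨ solve 6 (λ X w a b k k̄ → X :- (a :+ b) := X :- ((w :* w :* k :+ a) :+ (w :* w :* k̄ :+ b)) :+ w :* w :* (k :+ k̄))
             refl (X ω) ω (x * (ω * β + ω * β)) (x̄ * (- ω * β̄ + - ω * β̄)) Q₁ (conj Q₁) ⟩
      X ω + - ((ω * ω * Q₁ + x * (ω * β + ω * β)) + (ω * ω * conj Q₁ + x̄ * (- ω * β̄ + - ω * β̄))) + ω * ω * Tr Q₁
        ≡⟨ trans (+0* Tr-Q₁) (pencil′ x) ⟩
      0# ∎))
      where
      open ≡-Reasoning
      x̄ = conj x
      β̄ = conj β
      X : Carrier → Carrier
      X w = (x̄ * w + x * - w) + (x̄ * w + x * - w)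

    1+β : 1# + β ≡ 0#
    1+β = proj₂ (sum-difference plus minus)
      where
      open ≡-Reasoning
      minus : (1# + conj β) + - (1# + β) ≡ 0#
      minus = trans (cong₂ (λ a b → a + - b) (sym (trans (cong (_* (1# + conj β)) conj-1) (*-identityˡ _))) (sym (*-identityˡ _))) (balance 1#)
      plus : (1# + conj β) + (1# + β) ≡ 0#
      plus = zero-product ω≢0 (begin
        ω * ((1# + conj β) + (1# + β))
          ≡⟨ solve 3 (λ w a b → w :* (a :+ b) := :- (:- w :* a :- w :* b)) refl ω (1# + conj β) (1# + β) ⟩
        - (- ω * (1# + conj β) + - (ω * (1# + β)))
          ≡⟨ cong (λ z → - (z * (1# + conj β) + - (ω * (1# + β)))) conj-ω ⟨
        - (conj ω * (1# + conj β) + - (ω * (1# + β)))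
          ≡⟨ cong -_ (balance ω) ⟩
        - 0#
          ≡⟨ -0≡0 ⟩
        0# ∎)

    β≡-1 : β ≡ - 1#
    β≡-1 = difference≡0 (trans (solve 2 (λ o b → b :- :- o := o :+ b) refl 1# β) 1+β)

    -- Q₁ has trace 0, so this shift along c keeps h(e₁,e₁) = 0, while B(e₁,e₁) changes by Q₁
    -- B(e₁,c) = -Q₁ and vanishes.
    e₂ : Vec4
    e₂ = e₁ ⊕ (half * Q₁) · c

    e₂P : h e₂ P ≡ 0#
    e₂P = trans (shift e₁ _ P hcP) e₁P

    e₂R : h e₂ R ≡ 0#
    e₂R = trans (shift e₁ _ R hcR) e₁R

    e₂c : h e₂ c ≡ 1#
    e₂c = trans (shift e₁ _ c Hc) e₁c

    He₂ : h e₂ e₂ ≡ 0#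
    He₂ = trans (H-shift (half * Q₁) e₁c) (trans (cong₂ _+_ He₁ (trans
      (cong (half * Q₁ +_) (trans (conj-* _ _) (cong (_* conj Q₁) conj-half)))
      (trans (sym (distribˡ half Q₁ (conj Q₁))) (*0 Tr-Q₁)))) (+-identityˡ 0#))

    Qe₂ : B e₂ e₂ ≡ 0#
    Qe₂ = begin
      B e₂ e₂                                    ≡⟨ Q-⊕· e₁ (half * Q₁) c ⟩
      Q₁ + half * Q₁ * ((β + β) + half * Q₁ * B c c) ≡⟨ cong (λ z → Q₁ + half * Q₁ * z) (trans (+0* Qc) (cong (λ z → z + z) β≡-1)) ⟩
      Q₁ + half * Q₁ * (- 1# + - 1#)             ≡⟨ solve 3 (λ k s o → k :+ s :* (:- o :+ :- o) := k :- o :* (s :+ s)) refl Q₁ (half * Q₁) 1# ⟩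
      Q₁ + - (1# * (half * Q₁ + half * Q₁))      ≡⟨ cong (λ z → Q₁ + - z) (trans (*-identityˡ _) (halves Q₁)) ⟩
      Q₁ + - Q₁                                  ≡⟨ -‿inverseʳ _ ⟩
      0#                                         ∎
      where open ≡-Reasoning

    Be₂c : B e₂ c ≡ - 1#
    Be₂c = trans (B-⊕·ˡ e₁ _ c c) (trans (+0* Qc) β≡-1)

    Be₂R : B e₂ R ≡ 1#
    Be₂R = trans (BxR e₂) (trans (cong₂ _+_ e₂c e₂R) (+-identityʳ 1#))

    Be₂P : B e₂ P ≡ 0#
    Be₂P = trans (BP e₂) e₂P

    h-⊕·ʳ : ∀ z u t v → h z (u ⊕ t · v) ≡ h z u + conj t * h z v
    h-⊕·ʳ z u t v = trans (h-⊕ʳ z u (t · v)) (cong (h z u +_) (h-·ʳ t z v))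

    B-⊕·ʳ : ∀ z u t v → B z (u ⊕ t · v) ≡ B z u + t * B z v
    B-⊕·ʳ z u t v = trans (B-⊕ʳ z u (t · v)) (cong (B z u +_) (B-·ʳ t z v))

    +0*≡ : ∀ {x y a b} → x ≡ b → y ≡ 0# → x + a * y ≡ b
    +0*≡ p r = trans (+0* r) p

    normalBasis : NormalBasis
    normalBasis = record
      -- On (c, e₃) the forms are h = 1 and B = -1; the factors ω⁻¹ and ω multiply h by ω̄/ω = -1
      -- and leave B alone, so both become -1. On (R, e₂) they are h = 0 and B = 1; replacing R by R
      -- + c/2 makes both 1/2, and subtracting P/2 from e₂ makes both 0.
      { v₁ = P ; v₂ = ω⁻¹ · c ; v₃ = v₃ ; v₄ = ω · e₃
      ; h₁₁ = HP
      ; h₁₂ = trans (h-·ʳ ω⁻¹ P c) (*0 hPc)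
      ; h₁₃ = trans (h-⊕·ʳ P R half c) (+0*≡ hPR hPc)
      ; h₁₄ = trans (h-·ʳ ω P e₃) (*0 (trans (h-⊕·ʳ P e₂ (- half) P) (+0*≡ (h-flip0 e₂P) HP)))
      ; h₂₂ = trans (H-· ω⁻¹ c) (*0 Hc)
      ; h₂₃ = trans (h-·ˡ ω⁻¹ c v₃) (*0 (trans (h-⊕·ʳ c R half c) (+0*≡ hcR Hc)))
      ; h₂₄ = trans (h-·ˡ ω⁻¹ c (ω · e₃)) (trans (cong (ω⁻¹ *_) (trans (h-·ʳ ω c e₃)
          (cong₂ _*_ conj-ω (trans (h-⊕·ʳ c e₂ (- half) P) (+0*≡ (h-flip1 e₂c) hcP)))))
          (trans (solve 3 (λ i w o → i :* (:- w :* o) := :- (i :* w :* o)) refl ω⁻¹ ω 1#)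
            (cong -_ (trans (cong (_* 1#) (recip-* ω≢0)) (*-identityˡ 1#)))))
      ; h₃₃ = trans (H-⊕· R half c) (+0*≡ (trans (cong₂ _+_ HR (trans (cong₂ _+_ (*0 hRc) (*0 hcR)) (+-identityˡ 0#))) (+-identityˡ 0#)) Hc)
      ; h₃₄ = trans (h-·ʳ ω v₃ e₃) (*0 (trans (h-⊕·ʳ v₃ e₂ (- half) P) h₃₄))
      ; h₄₄ = trans (H-· ω e₃) (*0 (trans (H-⊕· e₂ (- half) P) (+0*≡ (trans (cong₂ _+_ He₂ (trans (cong₂ _+_ (*0 e₂P) (*0 (h-flip0 e₂P))) (+-identityˡ 0#))) (+-identityˡ 0#)) HP)))
      ; B₁₁ = QP
      ; B₁₂ = trans (B-·ʳ ω⁻¹ P c) (*0 BPc)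
      ; B₁₃ = trans (B-⊕·ʳ P R half c) (+0*≡ BPR BPc)
      ; B₁₄ = trans (B-·ʳ ω P e₃) (*0 (trans (B-⊕·ʳ P e₂ (- half) P) (+0*≡ (trans (B-sym P e₂) Be₂P) QP)))
      ; B₂₂ = trans (Q-· ω⁻¹ c) (*0 Qc)
      ; B₂₃ = trans (B-·ˡ ω⁻¹ c v₃) (*0 (trans (B-⊕·ʳ c R half c) (+0*≡ BcR Qc)))
      ; B₂₄ = trans (B-·ˡ ω⁻¹ c (ω · e₃)) (trans (cong (ω⁻¹ *_) (trans (B-·ʳ ω c e₃)
          (cong (ω *_) (trans (B-⊕·ʳ c e₂ (- half) P) (+0*≡ (trans (B-sym c e₂) Be₂c) BcP)))))
          (trans (solve 3 (λ i w o → i :* (w :* :- o) := :- (i :* w :* o)) refl ω⁻¹ ω 1#)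
            (cong -_ (trans (cong (_* 1#) (recip-* ω≢0)) (*-identityˡ 1#)))))
      ; B₃₃ = trans (Q-⊕· R half c) (trans (cong₂ _+_ QR (*0 (+0*≡ (trans (cong₂ _+_ BRc BRc) (+-identityˡ 0#)) Qc))) (+-identityˡ 0#))
      ; B₃₄ = trans (B-·ʳ ω v₃ e₃) (*0 (trans (B-⊕·ʳ v₃ e₂ (- half) P) B₃₄))
      ; B₄₄ = trans (Q-· ω e₃) (*0 (trans (Q-⊕· e₂ (- half) P) (trans (cong₂ _+_ Qe₂ (*0 (+0*≡ (trans (cong₂ _+_ Be₂P Be₂P) (+-identityˡ 0#)) QP))) (+-identityˡ 0#))))
      }
      where
      open ≡-Reasoning
      v₃ = R ⊕ half · c
      e₃ = e₂ ⊕ (- half) · P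
      BPc : B P c ≡ 0#
      BPc = trans (B-sym P c) BcP
      BRc : B R c ≡ 0#
      BRc = trans (B-sym R c) BcR
      h₃₄ : h v₃ e₂ + conj (- half) * h v₃ P ≡ 0#
      h₃₄ = begin
        h v₃ e₂ + conj (- half) * h v₃ P
          ≡⟨ cong₂ (λ a b → a + conj (- half) * b) (trans (h-⊕·ˡ R half c e₂) (0+*1 (h-flip0 e₂R) (h-flip1 e₂c)))
               (trans (h-⊕·ˡ R half c P) (+0*≡ hRP hcP)) ⟩
        half + conj (- half) * 1#
          ≡⟨ cong (half +_) (trans (*-identityʳ _) (trans (conj-neg half) (cong -_ conj-half))) ⟩
        half + - half
          ≡⟨ -‿inverseʳ half ⟩
        0# ∎
      B₃₄ : B v₃ e₂ + - half * B v₃ P ≡ 0#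
      B₃₄ = begin
        B v₃ e₂ + - half * B v₃ P
          ≡⟨ cong₂ (λ a b → a + - half * b)
               (trans (B-⊕·ˡ R half c e₂) (cong₂ (λ a b → a + half * b) (trans (B-sym R e₂) Be₂R) (trans (B-sym c e₂) Be₂c)))
               (trans (B-⊕·ˡ R half c P) (+0*≡ (trans (BP R) hRP) BcP)) ⟩
        (1# + half * - 1#) + - half * 1#
          ≡⟨ solve 2 (λ o k → (o :+ k :* :- o) :+ :- k :* o := o :- o :* (k :+ k)) refl 1# half ⟩
        1# + - (1# * (half + half))
          ≡⟨ cong (λ z → 1# + - z) (trans (*-identityˡ _) half+half) ⟩
        1# + - 1#
          ≡⟨ -‿inverseʳ 1# ⟩
        0# ∎

-- From matrices and the list of vectors to forms and families

module MatrixForms (q : ℕ) (opp : OddPrimePower q) (F : FiniteField (q ℕ.* q)) where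
  open Forms q opp F public

  sum4-cong : ∀ {f g} → (∀ i → f i ≡ g i) → sum4 f ≡ sum4 g
  sum4-cong e = cong₂ _+_ (cong₂ _+_ (cong₂ _+_ (e f0) (e f1)) (e f2)) (e f3)

  sum4-+ : ∀ f g → sum4 (λ i → f i + g i) ≡ sum4 f + sum4 g
  sum4-+ f g = solve 8 (λ a b c d a′ b′ c′ d′ →
      (a :+ a′) :+ (b :+ b′) :+ (c :+ c′) :+ (d :+ d′) := (a :+ b :+ c :+ d) :+ (a′ :+ b′ :+ c′ :+ d′))
    refl (f f0) (f f1) (f f2) (f f3) (g f0) (g f1) (g f2) (g f3)

  sum4-* : ∀ a f → sum4 (λ i → a * f i) ≡ a * sum4 f
  sum4-* a f = solve 5 (λ k a b c d → k :* a :+ k :* b :+ k :* c :+ k :* d := k :* (a :+ b :+ c :+ d))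
    refl a (f f0) (f f1) (f f2) (f f3)

  sum4-swap : ∀ (f : Fin 4 → Fin 4 → Carrier) → sum4 (λ i → sum4 (f i)) ≡ sum4 (λ j → sum4 (λ i → f i j))
  sum4-swap f = trans (cong (_+ sum4 (f f3)) (trans (cong (_+ sum4 (f f2)) (sym (sum4-+ (f f0) (f f1))))
    (sym (sum4-+ (λ j → f f0 j + f f1 j) (f f2))))) (sym (sum4-+ (λ j → f f0 j + f f1 j + f f2 j) (f f3)))

  sum4-conj : ∀ f → conj (sum4 f) ≡ sum4 (λ i → conj (f i))
  sum4-conj f = trans (conj-+ _ _) (cong (_+ conj (f f3)) (trans (conj-+ _ _) (cong (_+ conj (f f2)) (conj-+ _ _))))

  sum4-ε : ∀ k (f : Fin 4 → Carrier) → sum4 (λ i → f i * ε k i) ≡ f k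
  sum4-ε zero f = trans (solve 5 (λ a b c d o → let z = con (pos 0) in a :* o :+ b :* z :+ c :* z :+ d :* z := a :* o)
    refl (f f0) (f f1) (f f2) (f f3) 1#) (*-identityʳ _)
  sum4-ε (suc zero) f = trans (solve 5 (λ a b c d o → let z = con (pos 0) in a :* z :+ b :* o :+ c :* z :+ d :* z := b :* o)
    refl (f f0) (f f1) (f f2) (f f3) 1#) (*-identityʳ _)
  sum4-ε (suc (suc zero)) f = trans (solve 5 (λ a b c d o → let z = con (pos 0) in a :* z :+ b :* z :+ c :* o :+ d :* z := c :* o)
    refl (f f0) (f f1) (f f2) (f f3) 1#) (*-identityʳ _)
  sum4-ε (suc (suc (suc zero))) f = trans (solve 5 (λ a b c d o → let z = con (pos 0) in a :* z :+ b :* z :+ c :* z :+ d :* o := d :* o)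
    refl (f f0) (f f1) (f f2) (f f3) 1#) (*-identityʳ _)

  -- The two forms differ only by the conjugation of the second argument.
  private
    form : Matrix → Vec4 → Vec4 → Carrier
    form A x y = sum4 λ i → sum4 λ j → x i * A i j * y j

    form-cong : ∀ A {x x′ y y′} → x ≐ x′ → y ≐ y′ → form A x y ≡ form A x′ y′
    form-cong A e f = sum4-cong λ i → sum4-cong λ j → cong₂ (λ a b → a * A i j * b) (e i) (f j)

    form-⊕ˡ : ∀ A u v y → form A (u ⊕ v) y ≡ form A u y + form A v y
    form-⊕ˡ A u v y = trans (sum4-cong λ i → trans (sum4-cong λ j →
        solve 4 (λ u v a y → (u :+ v) :* a :* y := u :* a :* y :+ v :* a :* y) refl (u i) (v i) (A i j) (y j))
        (sum4-+ (λ j → u i * A i j * y j) (λ j → v i * A i j * y j)))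
      (sum4-+ (λ i → sum4 λ j → u i * A i j * y j) (λ i → sum4 λ j → v i * A i j * y j))

    form-·ˡ : ∀ A t u y → form A (t · u) y ≡ t * form A u y
    form-·ˡ A t u y = trans (sum4-cong λ i → trans (sum4-cong λ j →
        solve 4 (λ t u a y → t :* u :* a :* y := t :* (u :* a :* y)) refl t (u i) (A i j) (y j))
        (sum4-* t (λ j → u i * A i j * y j))) (sum4-* t (λ i → sum4 λ j → u i * A i j * y j))

  bil-sym : ∀ {S} → IsSymmetricMatrix S → ∀ u v → bil S u v ≡ bil S v u
  bil-sym {S} S-sym u v = trans (sum4-swap λ i j → u i * S i j * v j) (sum4-cong λ j → sum4-cong λ i →
    trans (cong (λ a → u i * a * v j) (S-sym i j))
      (solve 3 (λ u a v → u :* a :* v := v :* a :* u) refl (u i) (S j i) (v j)))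

  herm-conj : ∀ {A} → IsHermitianMatrix A → ∀ u v → herm A v u ≡ conj (herm A u v)
  herm-conj {A} A-herm u v = sym (trans (sum4-conj λ i → sum4 λ j → t i j) (trans (sum4-cong λ i → sum4-conj (t i))
    (trans (sum4-swap λ i j → conj (t i j)) (sum4-cong λ j → sum4-cong λ i → begin
      conj (u i * A i j * conj (v j))               ≡⟨ trans (conj-* _ _) (cong (_* conj (conj (v j))) (conj-* _ _)) ⟩
      conj (u i) * conj (A i j) * conj (conj (v j)) ≡⟨ cong₂ (λ a b → conj (u i) * a * b) (sym (A-herm i j)) (conj-conj (v j)) ⟩
      conj (u i) * A j i * v j                      ≡⟨ solve 3 (λ u a v → u :* a :* v := v :* a :* u) refl (conj (u i)) (A j i) (v j) ⟩
      v j * A j i * conj (u i)                      ∎))))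
    where
    open ≡-Reasoning
    t : Fin 4 → Fin 4 → Carrier
    t i j = u i * A i j * conj (v j)

  bil-ε : ∀ S i j → bil S (ε i) (ε j) ≡ S i j
  bil-ε S i j = begin
    sum4 (λ k → sum4 λ l → ε i k * S k l * ε j l)  ≡⟨ sum4-cong (λ k → sum4-ε j (λ l → ε i k * S k l)) ⟩
    sum4 (λ k → ε i k * S k j)                     ≡⟨ sum4-cong (λ k → *-comm (ε i k) (S k j)) ⟩
    sum4 (λ k → S k j * ε i k)                     ≡⟨ sum4-ε i (λ k → S k j) ⟩
    S i j                                          ∎
    where open ≡-Reasoning

  formPair : (A S : Matrix) → IsHermitianMatrix A → NonDegH A → IsSymmetricMatrix S → Carrier → FormPair
  formPair A S A-herm A-nondeg S-sym s = record
    { B = λ u v → s * bil S u v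
    ; h = herm A
    ; B-cong = λ e f → cong (s *_) (form-cong S e f)
    ; B-⊕ˡ = λ u v w → trans (cong (s *_) (form-⊕ˡ S u v w)) (distribˡ s _ _)
    ; B-·ˡ = λ a u w → trans (cong (s *_) (form-·ˡ S a u w))
        (solve 3 (λ s a b → s :* (a :* b) := a :* (s :* b)) refl s a (bil S u w))
    ; B-sym = λ u v → cong (s *_) (bil-sym {S} S-sym u v)
    ; h-cong = λ e f → form-cong A e (λ i → cong conj (f i))
    ; h-⊕ˡ = λ u v w → form-⊕ˡ A u v (λ i → conj (w i))
    ; h-·ˡ = λ a u w → form-·ˡ A a u (λ i → conj (w i))
    ; h-conj = herm-conj {A} A-herm
    ; h-nondegenerate = A-nondeg
    }

  bil-linear : ∀ S v → Linear (λ u → bil S u v)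
  bil-linear S v = record { f-cong = λ e → form-cong S {y = v} e ≐-refl ; f-⊕ = λ u w → form-⊕ˡ S u w v ; f-· = λ a u → form-·ˡ S a u v }

  -- y - (g(y)/g(y₀)) y₀ lies in the kernel of g, hence in that of f; so f is determined by its
  -- value at y₀ in the same way as g.
  same-kernel⇒proportional : ∀ {f g} → Linear f → Linear g → SamePlane f g → ∀ y₀ → g y₀ ≢ 0# →
    ∃ λ s → (s ≢ 0#) × (∀ y → g y ≡ s * f y)
  same-kernel⇒proportional {f} {g} F G same y₀ g≢0 = s , *≢0 g≢0 (recip≢0 f≢0) , λ y → sym (begin
    s * f y                                ≡⟨ cong (s *_) (fy y) ⟩
    g y₀ * recip f≢0 * (t y * f y₀)        ≡⟨ solve 4 (λ g i t f → g :* i :* (t :* f) := (g :* t) :* (i :* f)) refl (g y₀) (recip f≢0) (t y) (f y₀) ⟩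
    (g y₀ * t y) * (recip f≢0 * f y₀)      ≡⟨ cong ((g y₀ * t y) *_) (recip-* f≢0) ⟩
    (g y₀ * t y) * 1#                      ≡⟨ *-identityʳ _ ⟩
    g y₀ * t y                             ≡⟨ trans (*-comm _ _) (gt y) ⟩
    g y                                    ∎)
    where
    open ≡-Reasoning
    module F = Linear F
    module G = Linear G
    f≢0 : f y₀ ≢ 0#
    f≢0 e = g≢0 (Equivalence.to (same y₀) e)
    s = g y₀ * recip f≢0
    t : Vec4 → Carrier
    t y = g y * recip g≢0
    gt : ∀ y → t y * g y₀ ≡ g y
    gt y = trans (*-assoc _ _ _) (trans (cong (g y *_) (recip-* g≢0)) (*-identityʳ _))
    z : Vec4 → Vec4
    z y = y ⊕ (- t y) · y₀
    gz : ∀ y → g (z y) ≡ 0#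
    gz y = begin
      g (z y)                  ≡⟨ trans (G.f-⊕ y _) (cong (g y +_) (G.f-· (- t y) y₀)) ⟩
      g y + - t y * g y₀       ≡⟨ solve 3 (λ a t b → a :+ :- t :* b := a :- t :* b) refl (g y) (t y) (g y₀) ⟩
      g y + - (t y * g y₀)     ≡⟨ cong (λ x → g y + - x) (gt y) ⟩
      g y + - g y              ≡⟨ -‿inverseʳ _ ⟩
      0#                       ∎
    fy : ∀ y → f y ≡ t y * f y₀
    fy y = difference≡0 (begin
      f y + - (t y * f y₀)     ≡⟨ solve 3 (λ a t b → a :- t :* b := a :+ :- t :* b) refl (f y) (t y) (f y₀) ⟩
      f y + - t y * f y₀       ≡⟨ trans (F.f-⊕ y _) (cong (f y +_) (F.f-· (- t y) y₀)) ⟨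
      f (z y)                  ≡⟨ Equivalence.from (same (z y)) (gz y) ⟩
      0#                       ∎)

  private
    Apart : Vec4 → Vec4 → Set
    Apart u v = ¬ (u ≐ v)

    all-concatMap : ∀ {Pr : Vec4 → Set} (f : Carrier → List Vec4) xs → (∀ a → All Pr (f a)) → All Pr (concatMap f xs)
    all-concatMap f xs p = Allₚ.concat⁺ (Allₚ.map⁺ (All.universal p xs))

    -- Coordinate k records the block a vector comes from, so vectors from different blocks differ
    -- there.
    apart-concatMap : (k : Fin 4) (f : Carrier → List Vec4) → (∀ a → AllPairs Apart (f a)) →
      (∀ a → All (λ v → v k ≡ a) (f a)) → ∀ {xs} → AllPairs _≢_ xs → AllPairs Apart (concatMap f xs)
    apart-concatMap k f apart key {xs} distinct = AllPairsₚ.concat⁺ (Allₚ.map⁺ (All.universal apart xs))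
      (AllPairsₚ.map⁺ (AllPairs.map (λ {a} {b} a≢b → All.map (λ ua → All.map
        (λ vb u≐v → a≢b (trans (sym ua) (trans (u≐v k) vb))) (key b)) (key a)) distinct))

  allVecs-apart : AllPairs Apart allVecs
  allVecs-apart = apart-concatMap f0 _
    (λ a → apart-concatMap f1 _
      (λ b → apart-concatMap f2 _
        (λ c → AllPairsₚ.map⁺ (AllPairs.map (λ d≢d′ e → d≢d′ (e f3)) elems-unique))
        (λ c → Allₚ.map⁺ (All.universal (λ _ → refl) elems)) elems-unique)
      (λ b → all-concatMap _ elems λ c → Allₚ.map⁺ (All.universal (λ _ → refl) elems)) elems-unique)
    (λ a → all-concatMap _ elems λ b → all-concatMap _ elems λ c → Allₚ.map⁺ (All.universal (λ _ → refl) elems))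
    elems-unique

  intersection-family : ∀ A S →
    Family _≐_ (λ v → ¬ IsZero v × Hform A v ≡ 0# × Qform S v ≡ 0#) (countHQVectors A S)
  intersection-family A S = list-family ≐-sym (AllPairsₚ.filter⁺ P? allVecs-apart) (Allₚ.all-filter P? allVecs)
    where
    P? : ∀ v → Dec (¬ IsZero v × Hform A v ≡ 0# × Qform S v ≡ 0#)
    P? v = ¬? (isZero? v) ×-dec (Hform A v ≟ 0#) ×-dec (Qform S v ≟ 0#)

-- Irreducibility and the tangent plane

module Conclusion (q : ℕ) (opp : OddPrimePower q) (F : FiniteField (q ℕ.* q))
    (A S : Geometry.Matrix F q) (s : FiniteField.Carrier F) (s≢0 : s ≢ FiniteField.0# F)
    (forms : Forms.FormPair q opp F)
    (B≡ : ∀ u v → Forms.FormPair.B forms u v ≡ FiniteField._*_ F s (Geometry.bil F q S u v))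
    (h≡ : ∀ u v → Forms.FormPair.h forms u v ≡ Geometry.herm F q A u v)
    (P : Geometry.Vec4 F q) where

  open NormalForm q opp F forms P
  open MatrixForms q opp F using (same-kernel⇒proportional; bil-ε)

  Q⇒bil : ∀ u v → B u v ≡ 0# → bil S u v ≡ 0#
  Q⇒bil u v e = zero-product s≢0 (trans (sym (B≡ u v)) e)

  bil⇒Q : ∀ u v → bil S u v ≡ 0# → B u v ≡ 0#
  bil⇒Q u v e = trans (B≡ u v) (*0 e)

  -- If Q vanished on the tangent plane, it would split off the linear form h(·, P).
  plane⇒reducible : (R₀ : Vec4) → h R₀ P ≡ 1# →
                    (∀ w → h w P ≡ 0# → B w w ≡ 0#) → Reducible S
  plane⇒reducible R₀ hR₀P plane = (λ i → recip s≢0 * ℓ (ε i)) , (λ j → m (ε j)) , λ i j → cancelˡ s≢0 (begin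
    s * (S i j + S i j)
      ≡⟨ cong (λ z → s * (z + z)) (bil-ε S i j) ⟨
    s * (bil S (ε i) (ε j) + bil S (ε i) (ε j))
      ≡⟨ distribˡ s _ _ ⟩
    s * bil S (ε i) (ε j) + s * bil S (ε i) (ε j)
      ≡⟨ cong (λ z → z + z) (B≡ (ε i) (ε j)) ⟨
    B (ε i) (ε j) + B (ε i) (ε j)
      ≡⟨ factor (ε i) (ε j) ⟩
    ℓ (ε i) * m (ε j) + ℓ (ε j) * m (ε i)
      ≡⟨ *-identityˡ _ ⟨
    1# * (ℓ (ε i) * m (ε j) + ℓ (ε j) * m (ε i))
      ≡⟨ cong (_* (ℓ (ε i) * m (ε j) + ℓ (ε j) * m (ε i))) (*-recip s≢0) ⟨
    s * recip s≢0 * (ℓ (ε i) * m (ε j) + ℓ (ε j) * m (ε i))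
      ≡⟨ solve 6 (λ s i a b c d → s :* i :* (a :* b :+ c :* d) := s :* (i :* a :* b :+ i :* c :* d))
           refl s (recip s≢0) (ℓ (ε i)) (m (ε j)) (ℓ (ε j)) (m (ε i)) ⟩
    s * (recip s≢0 * ℓ (ε i) * m (ε j) + recip s≢0 * ℓ (ε j) * m (ε i)) ∎)
    where
    open ≡-Reasoning
    ℓ m : Vec4 → Carrier
    ℓ x = h x P
    -- The second linear factor, read off from B(π u, π v) = 0. In ℓ(u) m(v) + ℓ(v) m(u) the term in
    -- B(R₀,R₀) must occur twice, which fixes its coefficient here.
    m x = (B x R₀ + B x R₀) + - (B R₀ R₀ * ℓ x)
    π : Vec4 → Vec4
    π x = x ⊕ (- ℓ x) · R₀
    π-tangent : ∀ x → h (π x) P ≡ 0#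
    π-tangent x = trans (h-⊕·ˡ x (- ℓ x) R₀ P) (trans (cong (λ z → ℓ x + - ℓ x * z) hR₀P)
      (trans (cong (ℓ x +_) (*-identityʳ _)) (-‿inverseʳ _)))
    polar : ∀ {u v} → h u P ≡ 0# → h v P ≡ 0# → B u v ≡ 0#
    polar {u} {v} uP vP = cancel2 (begin
      B u v + B u v                                    ≡⟨ +0* (plane v vP) ⟨
      (B u v + B u v) + 1# * B v v                     ≡⟨ *-identityˡ _ ⟨
      1# * ((B u v + B u v) + 1# * B v v)              ≡⟨ +-identityˡ _ ⟨
      0# + 1# * ((B u v + B u v) + 1# * B v v)         ≡⟨ cong (_+ 1# * ((B u v + B u v) + 1# * B v v)) (plane u uP) ⟨
      B u u + 1# * ((B u v + B u v) + 1# * B v v)      ≡⟨ Q-⊕· u 1# v ⟨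
      B (u ⊕ 1# · v) (u ⊕ 1# · v)                      ≡⟨ plane _ (trans (h-⊕·ˡ u 1# v P) (trans (+0* vP) uP)) ⟩
      0#                                               ∎)
    expansion : ∀ u v → B (π u) (π v) ≡ (B u v + - ℓ v * B u R₀) + - ℓ u * (B v R₀ + - ℓ v * B R₀ R₀)
    expansion u v = begin
      B (π u) (π v)                         ≡⟨ B-⊕·ˡ u (- ℓ u) R₀ (π v) ⟩
      B u (π v) + - ℓ u * B R₀ (π v)        ≡⟨ cong₂ (λ a b → a + - ℓ u * b) (rhs u) (trans (rhs R₀) (cong (_+ - ℓ v * B R₀ R₀) (B-sym R₀ v))) ⟩
      (B u v + - ℓ v * B u R₀) + - ℓ u * (B v R₀ + - ℓ v * B R₀ R₀) ∎
      where
      rhs : ∀ z → B z (π v) ≡ B z v + - ℓ v * B z R₀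
      rhs z = trans (B-⊕ʳ z v _) (cong (B z v +_) (B-·ʳ (- ℓ v) z R₀))
    factor : ∀ u v → B u v + B u v ≡ ℓ u * m v + ℓ v * m u
    factor u v = begin
      B u v + B u v
        ≡⟨ solve 6 (λ b lu lv bu bv r → let x = (b :+ :- lv :* bu) :+ :- lu :* (bv :+ :- lv :* r) in
             b :+ b := (x :+ x) :+ (lu :* ((bv :+ bv) :- r :* lv) :+ lv :* ((bu :+ bu) :- r :* lu)))
             refl (B u v) (ℓ u) (ℓ v) (B u R₀) (B v R₀) (B R₀ R₀) ⟩
      (X + X) + (ℓ u * m v + ℓ v * m u)
        ≡⟨ cong (λ z → (z + z) + (ℓ u * m v + ℓ v * m u)) (trans (sym (expansion u v)) (polar (π-tangent u) (π-tangent v))) ⟩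
      (0# + 0#) + (ℓ u * m v + ℓ v * m u)
        ≡⟨ trans (cong (_+ (ℓ u * m v + ℓ v * m u)) (+-identityˡ 0#)) (+-identityˡ _) ⟩
      ℓ u * m v + ℓ v * m u ∎
      where X = (B u v + - ℓ v * B u R₀) + - ℓ u * (B v R₀ + - ℓ v * B R₀ R₀)

  -- Normal coordinates: hyperbolicity and commuting polarities

  module FromBasis (basis : NormalBasis) where
    open NormalBasis basis

    comb : Vec4 → Vec4
    comb x = ((x f0 · v₁ ⊕ x f1 · v₂) ⊕ x f2 · v₃) ⊕ x f3 · v₄

    M : Matrix
    M i zero = v₁ i
    M i (suc zero) = v₂ i
    M i (suc (suc zero)) = v₃ i
    M i (suc (suc (suc zero))) = v₄ i

    mv≐comb : ∀ x → mv M x ≐ comb x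
    mv≐comb x i = cong₂ _+_ (cong₂ _+_ (cong₂ _+_ (*-comm _ _) (*-comm _ _)) (*-comm _ _)) (*-comm _ _)

    mv-cong : ∀ {x y} → x ≐ y → mv M x ≐ mv M y
    mv-cong e i = cong₂ _+_ (cong₂ _+_ (cong₂ _+_ (cong (M i f0 *_) (e f0)) (cong (M i f1 *_) (e f1)))
      (cong (M i f2 *_) (e f2))) (cong (M i f3 *_) (e f3))

    -1-flip : ∀ {u v} → h u v ≡ - 1# → h v u ≡ - 1#
    -1-flip e = trans (h-flip e) (trans (conj-neg 1#) (cong -_ conj-1))

    combination : ∀ {f} → Linear f → ∀ x → f (comb x) ≡ x f0 * f v₁ + x f1 * f v₂ + x f2 * f v₃ + x f3 * f v₄
    combination lin x = trans (f-⊕ _ _) (cong₂ _+_ (trans (f-⊕ _ _) (cong₂ _+_ (trans (f-⊕ _ _)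
      (cong₂ _+_ (f-· _ _) (f-· _ _))) (f-· _ _))) (f-· _ _))
      where open Linear lin

    private
      only : ∀ {a b c d k₀ k₁ k₂ k₃} {y₀ y₁ y₂ y₃ : Carrier} → k₀ ≡ a → k₁ ≡ b → k₂ ≡ c → k₃ ≡ d →
             y₀ * k₀ + y₁ * k₁ + y₂ * k₂ + y₃ * k₃ ≡ y₀ * a + y₁ * b + y₂ * c + y₃ * d
      only refl refl refl refl = refl

      pick₀ : ∀ a b c d → a * 1# + b * 0# + c * 0# + d * 0# ≡ a
      pick₀ a b c d = trans (solve 5 (λ o a b c d → let z = con (pos 0) in a :* o :+ b :* z :+ c :* z :+ d :* z := a :* o) refl 1# a b c d) (*-identityʳ a)
      pick₁ : ∀ a b c d → a * 0# + b * - 1# + c * 0# + d * 0# ≡ - b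
      pick₁ a b c d = trans (solve 5 (λ o a b c d → let z = con (pos 0) in a :* z :+ b :* :- o :+ c :* z :+ d :* z := :- (b :* o)) refl 1# a b c d) (cong -_ (*-identityʳ b))
      pick₂ : ∀ a b c d → a * 0# + b * 0# + c * 1# + d * 0# ≡ c
      pick₂ a b c d = trans (solve 5 (λ o a b c d → let z = con (pos 0) in a :* z :+ b :* z :+ c :* o :+ d :* z := c :* o) refl 1# a b c d) (*-identityʳ c)
      pick₃ : ∀ a b c d → a * 0# + b * 0# + c * 0# + d * - 1# ≡ - d
      pick₃ a b c d = trans (solve 5 (λ o a b c d → let z = con (pos 0) in a :* z :+ b :* z :+ c :* z :+ d :* :- o := :- (d :* o)) refl 1# a b c d) (cong -_ (*-identityʳ d))

    -- The Gram matrix has a single entry ±1 in each row, so pairing with a basis vector returns one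
    -- coordinate up to sign. This gives independence of the basis and expresses both polarities in
    -- coordinates.
    comb-h₁ : ∀ x → h (comb x) v₁ ≡ x f2
    comb-h₁ x = trans (combination (h-linear v₁) x) (trans (only h₁₁ (h-flip0 h₁₂) (h-flip1 h₁₃) (h-flip0 h₁₄)) (pick₂ _ _ _ _))
    comb-h₂ : ∀ x → h (comb x) v₂ ≡ - x f3
    comb-h₂ x = trans (combination (h-linear v₂) x) (trans (only h₁₂ h₂₂ (h-flip0 h₂₃) (-1-flip h₂₄)) (pick₃ _ _ _ _))
    comb-h₃ : ∀ x → h (comb x) v₃ ≡ x f0
    comb-h₃ x = trans (combination (h-linear v₃) x) (trans (only h₁₃ h₂₃ h₃₃ (h-flip0 h₃₄)) (pick₀ _ _ _ _))
    comb-h₄ : ∀ x → h (comb x) v₄ ≡ - x f1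
    comb-h₄ x = trans (combination (h-linear v₄) x) (trans (only h₁₄ h₂₄ h₃₄ h₄₄) (pick₁ _ _ _ _))

    swap : ∀ {u v a} → B u v ≡ a → B v u ≡ a
    swap {u} {v} e = trans (B-sym v u) e

    comb-B₁ : ∀ x → B (comb x) v₁ ≡ x f2
    comb-B₁ x = trans (combination (B-linear v₁) x) (trans (only B₁₁ (swap B₁₂) (swap B₁₃) (swap B₁₄)) (pick₂ _ _ _ _))
    comb-B₂ : ∀ x → B (comb x) v₂ ≡ - x f3
    comb-B₂ x = trans (combination (B-linear v₂) x) (trans (only B₁₂ B₂₂ (swap B₂₃) (swap B₂₄)) (pick₃ _ _ _ _))
    comb-B₃ : ∀ x → B (comb x) v₃ ≡ x f0
    comb-B₃ x = trans (combination (B-linear v₃) x) (trans (only B₁₃ B₂₃ B₃₃ (swap B₃₄)) (pick₀ _ _ _ _))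
    comb-B₄ : ∀ x → B (comb x) v₄ ≡ - x f1
    comb-B₄ x = trans (combination (B-linear v₄) x) (trans (only B₁₄ B₂₄ B₃₄ B₄₄) (pick₁ _ _ _ _))

    -inj : ∀ {a b} → - a ≡ - b → a ≡ b
    -inj {a} {b} e = trans (solve 1 (λ a → a := :- (:- a)) refl a) (trans (cong -_ e) (solve 1 (λ a → :- (:- a) := a) refl b))

    comb-injective : ∀ {x y} → comb x ≐ comb y → x ≐ y
    comb-injective {x} {y} e zero = trans (sym (comb-h₃ x)) (trans (h-cong e ≐-refl) (comb-h₃ y))
    comb-injective {x} {y} e (suc zero) = -inj (trans (sym (comb-h₄ x)) (trans (h-cong e ≐-refl) (comb-h₄ y)))
    comb-injective {x} {y} e (suc (suc zero)) = trans (sym (comb-h₁ x)) (trans (h-cong e ≐-refl) (comb-h₁ y))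
    comb-injective {x} {y} e (suc (suc (suc zero))) = -inj (trans (sym (comb-h₂ x)) (trans (h-cong e ≐-refl) (comb-h₂ y)))

    mv-injective : ∀ {x y} → mv M x ≐ mv M y → x ≐ y
    mv-injective {x} {y} e = comb-injective {x} {y}
      (≐-trans (≐-sym {mv M x} {comb x} (mv≐comb x)) (≐-trans {mv M x} {mv M y} {comb y} e (mv≐comb y)))

    mv-zero : IsZero (mv M (λ _ → 0#))
    mv-zero i = solve 4 (λ a b c d → let z = con (pos 0) in a :* z :+ b :* z :+ c :* z :+ d :* z := z)
      refl (v₁ i) (v₂ i) (v₃ i) (v₄ i)

    invertible : Invertible M
    invertible x z = mv-injective {x} {λ _ → 0#} (λ i → trans (z i) (sym (mv-zero i)))

    mv-surjective : ∀ X → ∃ λ x → mv M x ≐ X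
    mv-surjective = vec-injective⇒surjective (mv M) mv-injective

    coordinates : ∀ X → ∃ λ x → X ≐ comb x
    coordinates X = x , λ i → trans (sym (proj₂ (mv-surjective X) i)) (mv≐comb x i)
      where
      x : Vec4
      x = proj₁ (mv-surjective X)

    comb-zero : ∀ {x} → IsZero x → IsZero (comb x)
    comb-zero {x} z i = trans (sym (mv≐comb x i)) (trans (mv-cong {x} {λ _ → 0#} z i) (mv-zero i))

    comb-· : ∀ t x → comb (t · x) ≐ t · comb x
    comb-· t x i = solve 9 (λ t a b c d p q r s → t :* a :* p :+ t :* b :* q :+ t :* c :* r :+ t :* d :* s
      := t :* (a :* p :+ b :* q :+ c :* r :+ d :* s)) refl t (x f0) (x f1) (x f2) (x f3) (v₁ i) (v₂ i) (v₃ i) (v₄ i)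

    nonDegQ : NonDegQ S
    nonDegQ X deg i = trans (X≐ i) (comb-zero {x} zero-coordinates i)
      where
      x = proj₁ (coordinates X)
      X≐ : X ≐ comb x
      X≐ = proj₂ (coordinates X)
      at : ∀ v → B (comb x) v ≡ 0#
      at v = trans (B-cong (≐-sym {X} {comb x} X≐) ≐-refl) (trans (B-sym X v) (bil⇒Q v X (deg v)))
      -0≡ : ∀ {a} → - a ≡ 0# → a ≡ 0#
      -0≡ e = -inj (trans e (sym -0≡0))
      zero-coordinates : IsZero x
      zero-coordinates zero = trans (sym (comb-B₃ x)) (at v₃)
      zero-coordinates (suc zero) = -0≡ (trans (sym (comb-B₄ x)) (at v₄))
      zero-coordinates (suc (suc zero)) = trans (sym (comb-B₁ x)) (at v₁)
      zero-coordinates (suc (suc (suc zero))) = -0≡ (trans (sym (comb-B₂ x)) (at v₂))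

    hyperbolic : Hyperbolic S
    hyperbolic = nonDegQ , v₁ , v₂ , independent , isotropic-line
      where
      independent : LinIndep v₁ v₂
      independent a b z = a≡0 , b≡0
        where
        vanishes : ∀ v → B (a · v₁ ⊕ b · v₂) v ≡ 0#
        vanishes v = trans (B-cong {u′ = 0# · v} (λ i → trans (z i) (sym (zeroˡ _))) ≐-refl)
          (trans (B-·ˡ 0# v v) (zeroˡ _))
        a≡0 : a ≡ 0#
        a≡0 = trans (sym (trans (trans (B-⊕·ˡ (a · v₁) b v₂ v₃) (+0* B₂₃))
          (trans (B-·ˡ a v₁ v₃) (trans (cong (a *_) B₁₃) (*-identityʳ a))))) (vanishes v₃)
        b≡0 : b ≡ 0#
        b≡0 = begin
          b                                       ≡⟨ *-identityʳ b ⟨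
          b * 1#                                  ≡⟨ solve 3 (λ a b o → b :* o := :- (a :* con (pos 0) :+ b :* :- o)) refl a b 1# ⟩
          - (a * 0# + b * - 1#)                   ≡⟨ cong₂ (λ x y → - (a * x + b * y)) B₁₄ B₂₄ ⟨
          - (a * B v₁ v₄ + b * B v₂ v₄)           ≡⟨ cong (λ x → - (x + b * B v₂ v₄)) (B-·ˡ a v₁ v₄) ⟨
          - (B (a · v₁) v₄ + b * B v₂ v₄)         ≡⟨ cong -_ (B-⊕·ˡ (a · v₁) b v₂ v₄) ⟨
          - B (a · v₁ ⊕ b · v₂) v₄                ≡⟨ cong -_ (vanishes v₄) ⟩
          - 0#                                    ≡⟨ -0≡0 ⟩
          0#                                      ∎
          where open ≡-Reasoning
      isotropic-line : ∀ a b → Qform S (lc a v₁ b v₂) ≡ 0#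
      isotropic-line a b = Q⇒bil (lc a v₁ b v₂) (lc a v₁ b v₂) (begin
        B (a · v₁ ⊕ b · v₂) (a · v₁ ⊕ b · v₂)
          ≡⟨ Q-⊕· (a · v₁) b v₂ ⟩
        B (a · v₁) (a · v₁) + b * ((B (a · v₁) v₂ + B (a · v₁) v₂) + b * B v₂ v₂)
          ≡⟨ cong₂ (λ x y → x + b * ((y + y) + b * B v₂ v₂)) (trans (Q-· a v₁) (cong (a * a *_) B₁₁)) (trans (B-·ˡ a v₁ v₂) (cong (a *_) B₁₂)) ⟩
        a * a * 0# + b * ((a * 0# + a * 0#) + b * B v₂ v₂)
          ≡⟨ cong (λ z → a * a * 0# + b * ((a * 0# + a * 0#) + b * z)) B₂₂ ⟩
        a * a * 0# + b * ((a * 0# + a * 0#) + b * 0#)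
          ≡⟨ solve 2 (λ a b → let z = con (pos 0) in a :* a :* z :+ b :* ((a :* z :+ a :* z) :+ b :* z) := z) refl a b ⟩
        0# ∎)
        where open ≡-Reasoning

    h-comb₁ : ∀ x → h v₁ (comb x) ≡ conj (x f2)
    h-comb₁ x = h-flip (comb-h₁ x)
    h-comb₂ : ∀ x → h v₂ (comb x) ≡ - conj (x f3)
    h-comb₂ x = trans (h-flip (comb-h₂ x)) (conj-neg _)
    h-comb₃ : ∀ x → h v₃ (comb x) ≡ conj (x f0)
    h-comb₃ x = h-flip (comb-h₃ x)
    h-comb₄ : ∀ x → h v₄ (comb x) ≡ - conj (x f1)
    h-comb₄ x = trans (h-flip (comb-h₄ x)) (conj-neg _)

    private
      -pull : ∀ {a b t} → - a ≡ t * - b → a ≡ t * b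
      -pull {a} {b} {t} e = -inj (trans e (solve 2 (λ t b → t :* :- b := :- (t :* b)) refl t b))

    -- In normal coordinates each of the two polarities followed by the other is x ↦ x̄.
    permutable : Permutable S A
    permutable X Z W X≢0 Z≢0 W≢0 zx wx = proportional
      (same-kernel⇒proportional (B-linear Z) (h-linear X)
        (λ y → mk⇔ (λ e → trans (h≡ y X) (Equivalence.to (zx y) (Q⇒bil y Z e)))
                   (λ e → bil⇒Q y Z (Equivalence.from (zx y) (trans (sym (h≡ y X)) e))))
        (ε (proj₁ (nonzero⇒h≢0 X≢0))) (proj₂ (nonzero⇒h≢0 X≢0)))
      (same-kernel⇒proportional (B-linear X) (h-linear W)
        (λ y → mk⇔ (λ e → trans (h≡ y W) (Equivalence.from (wx y) (Q⇒bil y X e)))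
                   (λ e → bil⇒Q y X (Equivalence.to (wx y) (trans (sym (h≡ y W)) e))))
        (ε (proj₁ (nonzero⇒h≢0 W≢0))) (proj₂ (nonzero⇒h≢0 W≢0)))
      where
      x = proj₁ (coordinates X)
      z = proj₁ (coordinates Z)
      w = proj₁ (coordinates W)
      X≐ : X ≐ comb x
      X≐ = proj₂ (coordinates X)
      Z≐ : Z ≐ comb z
      Z≐ = proj₂ (coordinates Z)
      W≐ : W ≐ comb w
      W≐ = proj₂ (coordinates W)
      proportional : (∃ λ μ → (μ ≢ 0#) × (∀ y → h y X ≡ μ * B y Z)) →
                     (∃ λ ν → (ν ≢ 0#) × (∀ y → h y W ≡ ν * B y X)) → Proportional Z W
      -- In coordinates the two hypotheses become x̄ = μ z and w̄ = ν x, whence w = ν̄ x̄ = ν̄ μ z.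
      proportional (μ , μ≢0 , hX) (ν , ν≢0 , hW) = conj ν * μ , *≢0 (conj≢0 ν≢0) μ≢0 , λ i → begin
        W i                                ≡⟨ W≐ i ⟩
        comb w i                           ≡⟨ trans (sym (mv≐comb w i)) (trans (mv-cong {w} {(conj ν * μ) · z} w≐ i) (mv≐comb ((conj ν * μ) · z) i)) ⟩
        comb ((conj ν * μ) · z) i            ≡⟨ comb-· (conj ν * μ) z i ⟩
        conj ν * μ * comb z i              ≡⟨ cong (conj ν * μ *_) (Z≐ i) ⟨
        conj ν * μ * Z i                   ∎
        where
        open ≡-Reasoning
        xz : ∀ v → h v (comb x) ≡ μ * B (comb z) v
        xz v = trans (h-cong {v} {v} ≐-refl (≐-sym {X} {comb x} X≐)) (trans (hX v) (cong (μ *_) (trans (B-sym v Z) (B-cong Z≐ ≐-refl))))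
        wx′ : ∀ v → h v (comb w) ≡ ν * B (comb x) v
        wx′ v = trans (h-cong {v} {v} ≐-refl (≐-sym {W} {comb w} W≐)) (trans (hW v) (cong (ν *_) (trans (B-sym v X) (B-cong X≐ ≐-refl))))
        chain : ∀ {a b c} → conj a ≡ ν * b → conj b ≡ μ * c → a ≡ conj ν * μ * c
        chain {a} {b} {c} p r = trans (sym (conj-conj a)) (trans (cong conj p) (trans (conj-* ν b)
          (trans (cong (conj ν *_) r) (sym (*-assoc _ _ _)))))
        w≐ : w ≐ (conj ν * μ) · z
        w≐ zero = chain (trans (sym (h-comb₃ w)) (trans (wx′ v₃) (cong (ν *_) (comb-B₃ x))))
                        (trans (sym (h-comb₃ x)) (trans (xz v₃) (cong (μ *_) (comb-B₃ z))))
        w≐ (suc zero) = chain (-pull (trans (sym (h-comb₄ w)) (trans (wx′ v₄) (cong (ν *_) (comb-B₄ x)))))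
                        (-pull (trans (sym (h-comb₄ x)) (trans (xz v₄) (cong (μ *_) (comb-B₄ z)))))
        w≐ (suc (suc zero)) = chain (trans (sym (h-comb₁ w)) (trans (wx′ v₁) (cong (ν *_) (comb-B₁ x))))
                        (trans (sym (h-comb₁ x)) (trans (xz v₁) (cong (μ *_) (comb-B₁ z))))
        w≐ (suc (suc (suc zero))) = chain (-pull (trans (sym (h-comb₂ w)) (trans (wx′ v₂) (cong (ν *_) (comb-B₂ x)))))
                        (-pull (trans (sym (h-comb₂ x)) (trans (xz v₂) (cong (μ *_) (comb-B₂ z)))))

    -- The quadric of the Baer subgeometry and its extended generators

    T : Matrix
    T zero (suc (suc zero)) = 1#
    T (suc (suc zero)) zero = 1#
    T (suc zero) (suc (suc (suc zero))) = - 1#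
    T (suc (suc (suc zero))) (suc zero) = - 1#
    T _ _ = 0#

    conj--1 : conj (- 1#) ≡ - 1#
    conj--1 = trans (conj-neg 1#) (cong -_ conj-1)

    T-subfield : ∀ i j → InSubfield (T i j)
    T-subfield zero zero = conj-0
    T-subfield zero (suc zero) = conj-0
    T-subfield zero (suc (suc zero)) = conj-1
    T-subfield zero (suc (suc (suc zero))) = conj-0
    T-subfield (suc zero) zero = conj-0
    T-subfield (suc zero) (suc zero) = conj-0
    T-subfield (suc zero) (suc (suc zero)) = conj-0
    T-subfield (suc zero) (suc (suc (suc zero))) = conj--1
    T-subfield (suc (suc zero)) zero = conj-1
    T-subfield (suc (suc zero)) (suc zero) = conj-0
    T-subfield (suc (suc zero)) (suc (suc zero)) = conj-0
    T-subfield (suc (suc zero)) (suc (suc (suc zero))) = conj-0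
    T-subfield (suc (suc (suc zero))) zero = conj-0
    T-subfield (suc (suc (suc zero))) (suc zero) = conj--1
    T-subfield (suc (suc (suc zero))) (suc (suc zero)) = conj-0
    T-subfield (suc (suc (suc zero))) (suc (suc (suc zero))) = conj-0

    T-symmetric : IsSymmetricMatrix T
    T-symmetric zero zero = refl
    T-symmetric zero (suc zero) = refl
    T-symmetric zero (suc (suc zero)) = refl
    T-symmetric zero (suc (suc (suc zero))) = refl
    T-symmetric (suc zero) zero = refl
    T-symmetric (suc zero) (suc zero) = refl
    T-symmetric (suc zero) (suc (suc zero)) = refl
    T-symmetric (suc zero) (suc (suc (suc zero))) = refl
    T-symmetric (suc (suc zero)) zero = refl
    T-symmetric (suc (suc zero)) (suc zero) = refl
    T-symmetric (suc (suc zero)) (suc (suc zero)) = refl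
    T-symmetric (suc (suc zero)) (suc (suc (suc zero))) = refl
    T-symmetric (suc (suc (suc zero))) zero = refl
    T-symmetric (suc (suc (suc zero))) (suc zero) = refl
    T-symmetric (suc (suc (suc zero))) (suc (suc zero)) = refl
    T-symmetric (suc (suc (suc zero))) (suc (suc (suc zero))) = refl

    -- The common Gram form: it is B in coordinates, and h once the second argument is conjugated.
    -- The two agree on GF(q)-coordinates.
    standard : Vec4 → Vec4 → Carrier
    standard x y = (x f0 * y f2 + - (x f1 * y f3)) + (x f2 * y f0 + - (x f3 * y f1))

    QT : ∀ x → Qform T x ≡ standard x x
    QT x = begin
      Qform T x
        ≡⟨ solve 5 (λ o a b c d → let z = con (pos 0); m = :- o in
             (a :* z :* a :+ a :* z :* b :+ a :* o :* c :+ a :* z :* d) :+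
             (b :* z :* a :+ b :* z :* b :+ b :* z :* c :+ b :* m :* d) :+
             (c :* o :* a :+ c :* z :* b :+ c :* z :* c :+ c :* z :* d) :+
             (d :* z :* a :+ d :* m :* b :+ d :* z :* c :+ d :* z :* d)
             := o :* ((a :* c :- b :* d) :+ (c :* a :- d :* b)))
             refl 1# (x f0) (x f1) (x f2) (x f3) ⟩
      1# * standard x x
        ≡⟨ *-identityˡ _ ⟩
      standard x x ∎
      where open ≡-Reasoning

    private
      arrange : ∀ {k₀ k₁ k₂ k₃} (x y : Vec4) → k₀ ≡ y f2 → k₁ ≡ - y f3 → k₂ ≡ y f0 → k₃ ≡ - y f1 →
                x f0 * k₀ + x f1 * k₁ + x f2 * k₂ + x f3 * k₃ ≡ standard x y
      arrange x y refl refl refl refl = solve 8 (λ a b c d p q r s →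
        a :* r :+ b :* :- s :+ c :* p :+ d :* :- q := (a :* r :- b :* s) :+ (c :* p :- d :* q))
        refl (x f0) (x f1) (x f2) (x f3) (y f0) (y f1) (y f2) (y f3)

    H-standard : ∀ x → h (comb x) (comb x) ≡ standard x (λ i → conj (x i))
    H-standard x = trans (combination (h-linear (comb x)) x)
      (arrange x (λ i → conj (x i)) (h-comb₁ x) (h-comb₂ x) (h-comb₃ x) (h-comb₄ x))

    Q-standard : ∀ x → B (comb x) (comb x) ≡ standard x x
    Q-standard x = trans (combination (B-linear (comb x)) x)
      (arrange x x (swap (comb-B₁ x)) (swap (comb-B₂ x)) (swap (comb-B₃ x)) (swap (comb-B₄ x)))

    Hform-mv : ∀ x → Hform A (mv M x) ≡ standard x (λ i → conj (x i))
    Hform-mv x = trans (sym (h≡ (mv M x) (mv M x)))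
      (trans (h-cong {mv M x} {comb x} {mv M x} {comb x} (mv≐comb x) (mv≐comb x)) (H-standard x))

    Qform-mv : ∀ x → s * Qform S (mv M x) ≡ standard x x
    Qform-mv x = trans (sym (B≡ (mv M x) (mv M x)))
      (trans (B-cong {mv M x} {comb x} {mv M x} {comb x} (mv≐comb x) (mv≐comb x)) (Q-standard x))

    baer-contained : ∀ x → SubVec x → Qform T x ≡ 0# → Hform A (mv M x) ≡ 0# × Qform S (mv M x) ≡ 0#
    baer-contained x real Tx =
      trans (Hform-mv x) (trans real-standard std≡0) , zero-product s≢0 (trans (Qform-mv x) std≡0)
      where
      std≡0 : standard x x ≡ 0#
      std≡0 = trans (sym (QT x)) Tx
      real-standard : standard x (λ i → conj (x i)) ≡ standard x x
      real-standard rewrite real f0 | real f1 | real f2 | real f3 = refl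

    -- The Segre parametrisation of the quadric x₀x₂ = x₁x₃.
    segre : Carrier → Carrier → Carrier → Carrier → Vec4
    segre a b c d = vec4 (a * c) (b * c) (b * d) (a * d)

    -- a : b is the ratio x₀ : x₁ = x₃ : x₂, and c : d is x₀ : x₃ = x₁ : x₂. If (x₀, x₃) is nonzero
    -- it serves as (c, d) with a = 1; otherwise (x₁, x₂) does, with a = 0 and b = 1.
    segre-surjective : ∀ x → x f0 * x f2 ≡ x f1 * x f3 →
      Σ Carrier λ a → Σ Carrier λ b → Σ Carrier λ c → Σ Carrier λ d → x ≐ segre a b c d
    segre-surjective x eq with x f0 ≟ 0# | x f3 ≟ 0#
    ... | no x₀≢0 | _ = 1# , x f1 * i , x f0 , x f3 , λ
      { zero → sym (*-identityˡ _)
      ; (suc zero) → sym (trans (*-assoc _ _ _) (trans (cong (x f1 *_) (recip-* x₀≢0)) (*-identityʳ _)))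
      ; (suc (suc zero)) → cancelˡ x₀≢0 (trans eq (sym (begin
          x f0 * (x f1 * i * x f3)   ≡⟨ solve 4 (λ a b i d → a :* (b :* i :* d) := (i :* a) :* (b :* d)) refl (x f0) (x f1) i (x f3) ⟩
          (i * x f0) * (x f1 * x f3) ≡⟨ trans (cong (_* (x f1 * x f3)) (recip-* x₀≢0)) (*-identityˡ _) ⟩
          x f1 * x f3                ∎)))
      ; (suc (suc (suc zero))) → sym (*-identityˡ _) }
      where
      open ≡-Reasoning
      i = recip x₀≢0
    ... | yes x₀≡0 | no x₃≢0 = 1# , x f2 * i , x f0 , x f3 , λ
      { zero → sym (*-identityˡ _)
      ; (suc zero) → trans x₁≡0 (sym (*0 x₀≡0))
      ; (suc (suc zero)) → sym (trans (*-assoc _ _ _) (trans (cong (x f2 *_) (recip-* x₃≢0)) (*-identityʳ _)))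
      ; (suc (suc (suc zero))) → sym (*-identityˡ _) }
      where
      i = recip x₃≢0
      x₁≡0 : x f1 ≡ 0#
      x₁≡0 = zero-product x₃≢0 (trans (*-comm _ _) (trans (sym eq) (trans (cong (_* x f2) x₀≡0) (zeroˡ _))))
    ... | yes x₀≡0 | yes x₃≡0 = 0# , 1# , x f1 , x f2 , λ
      { zero → trans x₀≡0 (sym (zeroˡ _))
      ; (suc zero) → sym (*-identityˡ _)
      ; (suc (suc zero)) → sym (*-identityˡ _)
      ; (suc (suc (suc zero))) → trans x₃≡0 (sym (zeroˡ _)) }

    -- (c, d) is a multiple of a pair over GF(q). The last clause says that this pair is nonzero, in
    -- the form in which independence of generators uses it.
    RealRatio : Carrier → Carrier → Set
    RealRatio c d = Σ Carrier λ μ → Σ Carrier λ c₀ → Σ Carrier λ d₀ →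
      InSubfield c₀ × InSubfield d₀ × (c ≡ μ * c₀) × (d ≡ μ * d₀) × (∀ t → t * c₀ ≡ 0# → t * d₀ ≡ 0# → t ≡ 0#)

    realRatio : ∀ c d → c * conj d + - (conj c * d) ≡ 0# → RealRatio c d
    realRatio c d eq with d ≟ 0#
    -- This also covers c = d = 0, with μ = 0 and the default pair (1, 0).
    ... | yes d≡0 = c , 1# , 0# , conj-1 , conj-0 , sym (*-identityʳ c) , trans d≡0 (sym (zeroʳ c)) ,
      λ t e _ → trans (sym (*-identityʳ t)) e
    ... | no d≢0 = d , c * i , 1# , real , conj-1 ,
      sym (trans (solve 3 (λ d c i → d :* (c :* i) := c :* (i :* d)) refl d c i)
        (trans (cong (c *_) (recip-* d≢0)) (*-identityʳ c))) ,
      sym (*-identityʳ d) , λ t _ e → trans (sym (*-identityʳ t)) e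
      where
      open ≡-Reasoning
      i = recip d≢0
      real : conj (c * i) ≡ c * i
      real = cancelˡ (*≢0 d≢0 (conj≢0 d≢0)) (begin
        d * conj d * conj (c * i)          ≡⟨ cong (d * conj d *_) (conj-* c i) ⟩
        d * conj d * (conj c * conj i)     ≡⟨ solve 4 (λ d d̄ c̄ ī → d :* d̄ :* (c̄ :* ī) := (c̄ :* d) :* (d̄ :* ī)) refl d (conj d) (conj c) (conj i) ⟩
        (conj c * d) * (conj d * conj i)   ≡⟨ cong₂ _*_ (sym (difference≡0 eq)) (trans (sym (conj-* d i)) (trans (cong conj (*-recip d≢0)) conj-1)) ⟩
        (c * conj d) * 1#                  ≡⟨ cong ((c * conj d) *_) (*-recip d≢0) ⟨
        (c * conj d) * (d * i)             ≡⟨ solve 4 (λ c d d̄ i → (c :* d̄) :* (d :* i) := d :* d̄ :* (c :* i)) refl c d (conj d) i ⟩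
        d * conj d * (c * i)               ∎)

    standard-cong : ∀ {x y} → x ≐ y → standard x x ≡ standard y y
    standard-cong {x} {y} e rewrite e f0 | e f1 | e f2 | e f3 = refl

    T-segre : ∀ {x} a b c d → x ≐ segre a b c d → Qform T x ≡ 0#
    T-segre {x} a b c d e = trans (QT x) (trans (standard-cong {x} {segre a b c d} e)
      (solve 4 (λ a b c d → ((a :* c) :* (b :* d) :- (b :* c) :* (a :* d)) :+ ((b :* d) :* (a :* c) :- (a :* d) :* (b :* c))
        := con (pos 0)) refl a b c d))

    OnGenerator : Vec4 → Set
    OnGenerator x = Σ Vec4 λ u → Σ Vec4 λ v → Generator T u v × (Σ Carrier λ a → Σ Carrier λ b → x ≐ lc a u b v)

    private
      *0-right : ∀ a b c → a * c + b * 0# ≡ a * c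
      *0-right a b c = trans (cong (a * c +_) (zeroʳ b)) (+-identityʳ _)
      *0-left : ∀ a b c → a * 0# + b * c ≡ b * c
      *0-left a b c = trans (cong (_+ b * c) (zeroʳ a)) (+-identityˡ _)

    -- With c : d fixed in GF(q), letting a : b vary over F traces the line through (c₀,0,0,d₀) and
    -- (0,c₀,d₀,0), both defined over GF(q). The factor μ is absorbed into the coefficients. A ratio
    -- a : b in GF(q) gives the opposite ruling in the same way.
    first-ruling : ∀ a b c d → RealRatio c d → OnGenerator (segre a b c d)
    first-ruling a b c d (μ , c₀ , d₀ , c₀-real , d₀-real , c≡ , d≡ , nonzero) =
      u , v , (u-real , v-real , independent , isotropic-line) , a * μ , b * μ , λ i → sym (trans (on (a * μ) (b * μ) i) (rescale i))
      where
      u = vec4 c₀ 0# 0# d₀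
      v = vec4 0# c₀ d₀ 0#
      u-real : SubVec u
      u-real = λ { zero → c₀-real ; (suc zero) → conj-0 ; (suc (suc zero)) → conj-0 ; (suc (suc (suc zero))) → d₀-real }
      v-real : SubVec v
      v-real = λ { zero → conj-0 ; (suc zero) → c₀-real ; (suc (suc zero)) → d₀-real ; (suc (suc (suc zero))) → conj-0 }
      on : ∀ a b → lc a u b v ≐ segre a b c₀ d₀
      on a b zero = *0-right a b c₀
      on a b (suc zero) = *0-left a b c₀
      on a b (suc (suc zero)) = *0-left a b d₀
      on a b (suc (suc (suc zero))) = *0-right a b d₀
      independent : ∀ a b → InSubfield a → InSubfield b → IsZero (lc a u b v) → (a ≡ 0#) × (b ≡ 0#)
      independent a b _ _ z =
        nonzero a (trans (sym (on a b f0)) (z f0)) (trans (sym (on a b f3)) (z f3)) ,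
        nonzero b (trans (sym (on a b f1)) (z f1)) (trans (sym (on a b f2)) (z f2))
      isotropic-line : ∀ a b → InSubfield a → InSubfield b → Qform T (lc a u b v) ≡ 0#
      isotropic-line a b _ _ = T-segre {lc a u b v} a b c₀ d₀ (on a b)
      scale : ∀ a c c₀ → c ≡ μ * c₀ → a * μ * c₀ ≡ a * c
      scale a c c₀ e = trans (*-assoc _ _ _) (cong (a *_) (sym e))
      rescale : segre (a * μ) (b * μ) c₀ d₀ ≐ segre a b c d
      rescale zero = scale a c c₀ c≡
      rescale (suc zero) = scale b c c₀ c≡
      rescale (suc (suc zero)) = scale b d d₀ d≡
      rescale (suc (suc (suc zero))) = scale a d d₀ d≡

    second-ruling : ∀ a b c d → RealRatio a b → OnGenerator (segre a b c d)
    second-ruling a b c d (μ , a₀ , b₀ , a₀-real , b₀-real , a≡ , b≡ , nonzero) =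
      u , v , (u-real , v-real , independent , isotropic-line) , μ * c , μ * d , λ i → sym (trans (on (μ * c) (μ * d) i) (rescale i))
      where
      u = vec4 a₀ b₀ 0# 0#
      v = vec4 0# 0# b₀ a₀
      u-real : SubVec u
      u-real = λ { zero → a₀-real ; (suc zero) → b₀-real ; (suc (suc zero)) → conj-0 ; (suc (suc (suc zero))) → conj-0 }
      v-real : SubVec v
      v-real = λ { zero → conj-0 ; (suc zero) → conj-0 ; (suc (suc zero)) → b₀-real ; (suc (suc (suc zero))) → a₀-real }
      on : ∀ c d → lc c u d v ≐ segre a₀ b₀ c d
      on c d zero = trans (*0-right c d a₀) (*-comm _ _)
      on c d (suc zero) = trans (*0-right c d b₀) (*-comm _ _)
      on c d (suc (suc zero)) = trans (*0-left c d b₀) (*-comm _ _)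
      on c d (suc (suc (suc zero))) = trans (*0-left c d a₀) (*-comm _ _)
      independent : ∀ c d → InSubfield c → InSubfield d → IsZero (lc c u d v) → (c ≡ 0#) × (d ≡ 0#)
      independent c d _ _ z =
        nonzero c (trans (sym (*0-right c d a₀)) (z f0)) (trans (sym (*0-right c d b₀)) (z f1)) ,
        nonzero d (trans (sym (*0-left c d a₀)) (z f3)) (trans (sym (*0-left c d b₀)) (z f2))
      isotropic-line : ∀ c d → InSubfield c → InSubfield d → Qform T (lc c u d v) ≡ 0#
      isotropic-line c d _ _ = T-segre {lc c u d v} a₀ b₀ c d (on c d)
      scale : ∀ a a₀ c → a ≡ μ * a₀ → a₀ * (μ * c) ≡ a * c
      scale a a₀ c e = trans (sym (*-assoc _ _ _)) (cong (_* c) (trans (*-comm _ _) (sym e)))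
      rescale : segre a₀ b₀ (μ * c) (μ * d) ≐ segre a b c d
      rescale zero = scale a a₀ c a≡
      rescale (suc zero) = scale b b₀ c b≡
      rescale (suc (suc zero)) = scale b b₀ d b≡
      rescale (suc (suc (suc zero))) = scale a a₀ d a≡

    -- On segre a b c d the Hermitian form is (a b̄ − ā b)(c d̄ − c̄ d).
    segre-generator : ∀ a b c d → standard (segre a b c d) (λ i → conj (segre a b c d i)) ≡ 0# →
                      OnGenerator (segre a b c d)
    segre-generator a b c d Hx = choose (integral factored)
      where
      open ≡-Reasoning
      choose : (a * conj b + - (conj a * b) ≡ 0#) ⊎ (c * conj d + - (conj c * d) ≡ 0#) → OnGenerator (segre a b c d)
      choose (inj₁ ab) = second-ruling a b c d (realRatio a b ab)
      choose (inj₂ cd) = first-ruling a b c d (realRatio c d cd)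
      exchange : ∀ w x y z → (w * x) * (y * z) ≡ (w * y) * (x * z)
      exchange = solve 4 (λ w x y z → (w :* x) :* (y :* z) := (w :* y) :* (x :* z)) refl
      exchange′ : ∀ w x y z → (w * x) * (y * z) ≡ (x * y) * (w * z)
      exchange′ = solve 4 (λ w x y z → (w :* x) :* (y :* z) := (x :* y) :* (w :* z)) refl
      exchange″ : ∀ w x y z → (w * x) * (y * z) ≡ (w * z) * (x * y)
      exchange″ = solve 4 (λ w x y z → (w :* x) :* (y :* z) := (w :* z) :* (x :* y)) refl
      exchange‴ : ∀ w x y z → (w * x) * (y * z) ≡ (x * z) * (w * y)
      exchange‴ = solve 4 (λ w x y z → (w :* x) :* (y :* z) := (x :* z) :* (w :* y)) refl
      factored : (a * conj b + - (conj a * b)) * (c * conj d + - (conj c * d)) ≡ 0#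
      factored = begin
        (a * conj b + - (conj a * b)) * (c * conj d + - (conj c * d))
          ≡⟨ solve 4 (λ p r t u → (p :- r) :* (t :- u) := (p :* t :- r :* t) :+ (r :* u :- p :* u))
               refl (a * conj b) (conj a * b) (c * conj d) (conj c * d) ⟩
        ((a * conj b) * (c * conj d) + - ((conj a * b) * (c * conj d))) + ((conj a * b) * (conj c * d) + - ((a * conj b) * (conj c * d)))
          ≡⟨ cong₂ _+_ (cong₂ (λ x y → x + - y) (exchange a (conj b) c (conj d)) (exchange′ (conj a) b c (conj d)))
                       (cong₂ (λ x y → x + - y) (exchange‴ (conj a) b (conj c) d) (exchange″ a (conj b) (conj c) d)) ⟩
        ((a * c) * (conj b * conj d) + - ((b * c) * (conj a * conj d))) + ((b * d) * (conj a * conj c) + - ((a * d) * (conj b * conj c)))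
          ≡⟨ cong₂ _+_ (cong₂ (λ x y → (a * c) * x + - ((b * c) * y)) (conj-* b d) (conj-* a d))
                       (cong₂ (λ x y → (b * d) * x + - ((a * d) * y)) (conj-* a c) (conj-* b c)) ⟨
        standard (segre a b c d) (λ i → conj (segre a b c d i))
          ≡⟨ Hx ⟩
        0# ∎

    on-generator : ∀ x → standard x x ≡ 0# → standard x (λ i → conj (x i)) ≡ 0# → OnGenerator x
    on-generator x Qx Hx = transport (segre-surjective x eq)
      where
      eq : x f0 * x f2 ≡ x f1 * x f3
      eq = difference≡0 (cancel2 (trans (cong ((x f0 * x f2 + - (x f1 * x f3)) +_)
        (cong₂ (λ p r → p + - r) (*-comm _ _) (*-comm _ _))) Qx))
      transport : (Σ Carrier λ a → Σ Carrier λ b → Σ Carrier λ c → Σ Carrier λ d → x ≐ segre a b c d) → OnGenerator x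
      transport (a , b , c , d , e) = back (segre-generator a b c d (trans (sym standard≡) Hx))
        where
        standard≡ : standard x (λ i → conj (x i)) ≡ standard (segre a b c d) (λ i → conj (segre a b c d i))
        standard≡ = cong₂ _+_
          (cong₂ (λ p r → p + - r) (cong₂ (λ p r → p * conj r) (e f0) (e f2)) (cong₂ (λ p r → p * conj r) (e f1) (e f3)))
          (cong₂ (λ p r → p + - r) (cong₂ (λ p r → p * conj r) (e f2) (e f0)) (cong₂ (λ p r → p * conj r) (e f3) (e f1)))
        back : OnGenerator (segre a b c d) → OnGenerator x
        back (u , v , gen , p , r , on) = u , v , gen , p , r , λ i → trans (e i) (on i)

    baerConclusion : BaerConclusion A S
    baerConclusion = M , T , invertible , T-subfield , T-symmetric , (f0 , f2 , 0≢1 ∘ sym) ,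
      (λ x real _ Tx → baer-contained x real Tx) , points
      where
      points : ∀ X → ¬ IsZero X → Hform A X ≡ 0# → Qform S X ≡ 0# →
        Σ Vec4 λ u → Σ Vec4 λ v → Generator T u v ×
          (Σ Carrier λ a → Σ Carrier λ b → Proportional X (mv M (lc a u b v)))
      points X _ HX QX = conclude (on-generator x
          (trans (sym (Q-standard x)) (trans (sym (B-cong {X} {comb x} {X} {comb x} X≐ X≐)) (bil⇒Q X X QX)))
          (trans (sym (H-standard x)) (trans (sym (h-cong {X} {comb x} {X} {comb x} X≐ X≐)) (trans (h≡ X X) HX))))
        where
        x = proj₁ (coordinates X)
        X≐ : X ≐ comb x
        X≐ = proj₂ (coordinates X)
        conclude : OnGenerator x → _
        conclude (u , v , gen , a , b , on) = u , v , gen , a , b , 1# , 0≢1 ∘ sym , λ i → begin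
          mv M (lc a u b v) i  ≡⟨ mv-cong {x} {lc a u b v} on i ⟨
          mv M x i             ≡⟨ mv≐comb x i ⟩
          comb x i             ≡⟨ X≐ i ⟨
          X i                  ≡⟨ *-identityˡ _ ⟨
          1# * X i             ∎
          where open ≡-Reasoning

-- Scaling the quadric so that both forms agree at P

theorem8 : (q : ℕ) → OddPrimePower q → (F : FiniteField (q N.* q)) →
    let open Geometry F q in
    (A S : Matrix) →
    IsHermitianMatrix A → NonDegH A →
    IsSymmetricMatrix S → NonZeroMatrix S → Irreducible S →
    (P : Vec4) → ¬ IsZero P → Hform A P ≡ 0# → Qform S P ≡ 0# →
    NonsingularQ S P → SamePlane (polarQ S P) (polarH A P) →
    countHQVectors A S ≡ (2 N.* q N.^ 3 N.+ q N.^ 2 N.+ 1) N.* (q N.^ 2 N.∸ 1) →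
    Hyperbolic S × Permutable S A × BaerConclusion A S
theorem8 q opp F A S A-herm A-nondeg S-sym _ irreducible P P≢0 HP QP _ same total =
  C.FromBasis.hyperbolic basis , C.FromBasis.permutable basis , C.FromBasis.baerConclusion basis
  where
  open MatrixForms q opp F
  -- The scalar s is not known yet; from this instance only facts about h are taken, and these are
  -- independent of it.
  module Unscaled = Tangency q opp F (formPair A S A-herm A-nondeg S-sym 1#) P

  y₀ : ∃ λ i → herm A (ε i) P ≢ 0#
  y₀ = Unscaled.nonzero⇒h≢0 P≢0

  scaling : ∃ λ s → (s ≢ 0#) × (∀ y → herm A y P ≡ s * bil S y P)
  scaling = same-kernel⇒proportional (bil-linear S P) (Unscaled.h-linear P) same (ε (proj₁ y₀)) (proj₂ y₀)

  s = proj₁ scaling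
  forms = formPair A S A-herm A-nondeg S-sym s
  module C = Conclusion q opp F A S s (proj₁ (proj₂ scaling)) forms (λ _ _ → refl) (λ _ _ → refl) P
  module NF = NormalForm q opp F forms P

  BP : ∀ x → s * bil S x P ≡ herm A x P
  BP x = sym (proj₂ (proj₂ scaling) x)

  R₀ : Vec4
  R₀ = recip (proj₂ y₀) · ε (proj₁ y₀)

  hR₀P : herm A R₀ P ≡ 1#
  hR₀P = trans (Unscaled.h-·ˡ (recip (proj₂ y₀)) (ε (proj₁ y₀)) P) (recip-* (proj₂ y₀))

  vanish-scaled : ∀ v → Qform S v ≡ 0# → s * Qform S v ≡ 0#
  vanish-scaled v e = *0 e

  basis : NF.NormalBasis
  basis = NF.Construction.normalBasis HP (vanish-scaled P QP) BP
    (NF.frame P≢0 HP (vanish-scaled P QP) BP (λ plane → irreducible (C.plane⇒reducible R₀ hR₀P plane))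
      (family-map (λ {v} x → proj₁ x , proj₁ (proj₂ x) , vanish-scaled v (proj₂ (proj₂ x))) (intersection-family A S)) total)
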